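{- Let $G$ be a plane graph and let $K$ be a set of at most three vertices incident with the outer face of $G$. Let $C\subseteq V(G)$ be disjoint from $K$ such that every vertex of $C$ has at most $4$ neighbors in $V(G)\setminus C$. Then there exists a linear ordering $\prec$ of $V(G)\setminus C$ that is $7$-two-degenerate relatively to $C$ and such that $u\prec v$ for every $u\in K$ and every $v\in V(G)\setminus(C\cup K)$.
   Context: Graphs are finite and may have parallel edges but no loops. Let $G$ be a graph, $C\subseteq V(G)$, and $\prec$ a linear ordering of $V(G)\setminus C$. For $v\in V(G)\setminus C$, let $L_{G,C,\prec}(v)$ be the set of vertices $u\in V(G)\setminus C$ with $u\prec v$ such that either $uv\in E(G)$, or $u$ and $v$ have a common neighbor $w\in V(G)\setminus C$ with $v\prec w$, or $u$ and $v$ have a common neighbor $w\in C$. The ordering $\prec$ is $d$-two-degenerate relatively to $C$ if $|L_{G,C,\prec}(v)|\le d$ for every $v\in V(G)\setminus C$. -}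

module Defs where

open import Data.Nat using (ℕ; zero; suc; _+_; _≤_)
open import Data.Fin using (Fin; _≟_)
open import Data.Fin.Subset using (Subset; _∈_; _∉_)
open import Data.Bool using (Bool; true; false; not; _∨_; _∧_)
open import Data.List using (List; length; allFin; filterᵇ; foldr)
open import Data.List.Membership.Propositional renaming (_∈_ to _∈ˡ_; _∉_ to _∉ˡ_)
open import Data.Product using (Σ; ∃; ∃-syntax; _×_; _,_; proj₁; proj₂)
open import Data.Sum using (_⊎_)
open import Function.Bundles using (_⇔_)
open import Relation.Nullary using (¬_)
open import Relation.Nullary.Decidable using (⌊_⌋)
open import Relation.Binary.PropositionalEquality using (_≡_; _≢_)

-- Multigraphs without loops.
-- Vertices are Fin n, edges are Fin m, each edge has two (distinct) ends.
-- Parallel edges are allowed (ends need not be injective).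

record Graph : Set where
  field
    n    : ℕ
    m    : ℕ
    ends : Fin m → Fin n × Fin n
    loopless : ∀ e → proj₁ (ends e) ≢ proj₂ (ends e)

module _ (G : Graph) where
  open Graph G

  Adj : Fin n → Fin n → Set
  Adj u v = ∃[ e ] (ends e ≡ (u , v) ⊎ ends e ≡ (v , u))

  data Reach : Fin n → Fin n → Set where
    here : ∀ {u} → Reach u u
    step : ∀ {u v w} → Adj u v → Reach v w → Reach u w

  isolatedᵇ : Fin n → Bool
  isolatedᵇ v = foldr (λ e b → not (⌊ proj₁ (ends e) ≟ v ⌋ ∨ ⌊ proj₂ (ends e) ≟ v ⌋) ∧ b) true (allFin m)

  numIsolated : ℕ
  numIsolated = length (filterᵇ isolatedᵇ (allFin n))

  Dart : Set
  Dart = Fin m × Bool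

  tail : Dart → Fin n
  tail (e , false) = proj₁ (ends e)
  tail (e , true)  = proj₂ (ends e)

  flip : Dart → Dart
  flip (e , b) = (e , not b)

iter : {A : Set} → (A → A) → ℕ → A → A
iter f zero    x = x
iter f (suc k) x = f (iter f k x)

module _ (G : Graph) where
  open Graph G

  -- A rotation system: a permutation σ of the darts whose cycles are
  -- exactly the sets of darts at each vertex (the local clockwise order).
  record Rotation : Set where
    field
      σ     : Dart G → Dart G
      σ⁻¹   : Dart G → Dart G
      σσ⁻¹  : ∀ d → σ (σ⁻¹ d) ≡ d
      σ⁻¹σ  : ∀ d → σ⁻¹ (σ d) ≡ d
      σ-tail : ∀ d → tail G (σ d) ≡ tail G d
      σ-cyclic : ∀ d d' → tail G d ≡ tail G d' → ∃[ k ] iter σ k d ≡ d'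

    φ : Dart G → Dart G
    φ d = σ (flip G d)

    SameFace : Dart G → Dart G → Set
    SameFace d d' = ∃[ k ] iter φ k d ≡ d'

  -- A plane graph: a rotation system of Euler genus 0, i.e.
  --   n − m + (f + i) = 2c
  -- where f = number of facial walks (φ-orbits), i = number of isolated
  -- vertices (each bounding one face of its own component) and c = number
  -- of connected components.  Together with a choice of outer face: at most
  -- one facial walk per component is designated as lying on the outer face.
  -- (Components are placed side by side in the outer face.)
  record PlaneGraph : Set where
    field
      rot : Rotation
    open Rotation rot public
    field
      f        : ℕ
      faceOf   : Dart G → Fin f
      faceOf-surj : ∀ (x : Fin f) → ∃[ d ] faceOf d ≡ x
      faceOf-ok   : ∀ d d' → (faceOf d ≡ faceOf d') ⇔ SameFace d d'
      c        : ℕ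
      compOf   : Fin n → Fin c
      compOf-surj : ∀ (x : Fin c) → ∃[ v ] compOf v ≡ x
      compOf-ok   : ∀ u v → (compOf u ≡ compOf v) ⇔ Reach G u v
      euler    : n + f + numIsolated G ≡ m + (c + c)
      outer    : Fin f → Bool
      outer-one : ∀ d d' → outer (faceOf d) ≡ true → outer (faceOf d') ≡ true →
                  Reach G (tail G d) (tail G d') → faceOf d ≡ faceOf d'

    OnOuterFace : Fin n → Set
    OnOuterFace v = isolatedᵇ G v ≡ true
                  ⊎ ∃[ d ] (tail G d ≡ v × outer (faceOf d) ≡ true)

record StrictLinearOrderOn {n : ℕ} (P : Fin n → Set) (_≺_ : Fin n → Fin n → Set) : Set where
  field
    irrefl : ∀ {x} → P x → ¬ (x ≺ x)
    trans  : ∀ {x y z} → P x → P y → P z → x ≺ y → y ≺ z → x ≺ z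
    total  : ∀ {x y} → P x → P y → x ≢ y → (x ≺ y) ⊎ (y ≺ x)

AtMost : {n : ℕ} → ℕ → (Fin n → Set) → Set
AtMost {n} d X = ∃[ xs ] (length xs ≤ d × (∀ (x : Fin n) → X x → x ∈ˡ xs))

module _ (G : Graph) where
  open Graph G

  L : Subset n → (Fin n → Fin n → Set) → Fin n → Fin n → Set
  L C _≺_ v u = u ∉ C × u ≺ v ×
      ( Adj G u v
      ⊎ (∃[ w ] (w ∉ C × v ≺ w × Adj G u w × Adj G v w))
      ⊎ (∃[ w ] (w ∈ C × Adj G u w × Adj G v w)))

  TwoDegenerate : ℕ → Subset n → (Fin n → Fin n → Set) → Set
  TwoDegenerate d C _≺_ = ∀ v → v ∉ C → AtMost d (L C _≺_ v)

{-# OPTIONS --safe #-}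
-- The ordering is built from its end.  Once the last vertex of the current set U has been chosen, it
-- may be moved to C: every earlier vertex sees through it exactly as through C.  So it suffices to find, as
-- long as U ≠ K, some vertices of U ∖ K that can be moved one after the other, each having at most 7 vertices
-- in its L, such that afterwards every vertex of C again has at most 4 neighbours in U.  Joining
-- consecutive neighbours of the vertices of C and discarding those of degree at most 3, we may assume
-- that every w ∈ C has degree 4 and lies inside a 4-cycle of U, so |L(v)| ≤ dU(v) + dC(v).
--
-- If no single vertex can be moved, then dU ≥ 5 or dU + dC ≥ 8 outside K.  Give v the charge
-- dU + (dC + t)/2 − 6, where t counts the non-triangular corners at v; by Euler's formula the charges add up
-- to at most −12.  Outside K only the small vertices (dU = 5, dC + t ≤ 1) are negative.  Let B be the
-- region reached from a small vertex s through flat vertices (dU = 6, dC + t = 0).  If B touches another vertex with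
-- dU = 5 and dC + t ≤ 2, all vertices of an induced path from it to s can be moved.  Otherwise the
-- neighbours of B have positive charge or lie in K, there are at least four of them because plane graphs are
-- sparse, and each can afford 1/4 for every region it meets along an edge between two triangles:
-- this pays for s.  Since K may be completed to a triangle in the outer face, its vertices together keep more
-- than −12, a contradiction.
module Submission where

open import Defs
open import Data.Nat using (ℕ; zero; suc; _+_; _*_; _∸_; _≤_; _<_; z≤n; s≤s; _≤ᵇ_; _≡ᵇ_; _≤?_; s≤s⁻¹)
open import Data.Nat.Properties renaming (_≟_ to _≟ℕ_)
open import Data.Nat.Tactic.RingSolver using (solve-∀)
open import Data.Fin using (Fin; zero; suc; _↑ˡ_; _↑ʳ_; toℕ; fromℕ<; punchOut; punchIn; splitAt; combine; remQuot)
open import Data.Fin.Properties using (_≟_; any?; all?; punchOut-cong; punchOut-punchIn; punchInᵢ≢i; splitAt-↑ˡ; splitAt-↑ʳ; splitAt⁻¹-↑ˡ; splitAt⁻¹-↑ʳ; remQuot-combine; combine-remQuot; toℕ-injective; toℕ<n; toℕ-fromℕ<) renaming (suc-injective to suc-injectiveF)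
import Data.Fin.Permutation as Perm
open import Data.Fin.Subset using (Subset; _∈_; _∉_)
open import Data.Fin.Subset.Properties using (anySubset?)
open import Data.Bool using (Bool; true; false; not; _∧_; _∨_; if_then_else_) renaming (_≟_ to _≟ᵇ_; T to True)
open import Data.Bool.Properties using (∧-comm)
open import Data.Vec using (Vec; []; _∷_; lookup; replicate; zipWith; map; tabulate)
open import Data.Vec.Properties using (lookup∘tabulate; []=⇒lookup; lookup⇒[]=)
open import Data.List using (List; []; _∷_; length; _++_; allFin; filterᵇ)
import Data.List as List
open import Data.List.Properties using (length-map; length-++)
open import Data.List.Membership.Propositional renaming (_∈_ to _∈ˡ_; _∉_ to _∉ˡ_)
open import Data.List.Membership.Propositional.Properties using (∈-map⁺; ∈-++⁺ˡ; ∈-++⁺ʳ; ∈-allFin)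
open import Data.List.Relation.Unary.Any using (Any; here; there)
import Data.List.Relation.Unary.Any as Any
open import Data.List.Relation.Unary.All using (All; []; _∷_)
import Data.List.Relation.Unary.All as All
open import Data.List.Relation.Unary.AllPairs using (AllPairs; []; _∷_)
open import Data.Product using (Σ; ∃; ∃-syntax; _×_; _,_; proj₁; proj₂)
open import Data.Sum using (_⊎_; inj₁; inj₂; [_,_])
open import Data.Empty using (⊥; ⊥-elim)
open import Data.Unit using (tt)
open import Function using (_∘_; id; case_of_)
open import Function.Bundles using (Equivalence)
open import Relation.Nullary using (¬_; Dec; yes; no)
open import Relation.Nullary.Decidable using (⌊_⌋; _×-dec_; _⊎-dec_; ¬?)
open import Relation.Binary.Definitions using (tri<; tri≈; tri>)
open import Relation.Binary.PropositionalEquality hiding ([_])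
open import Algebra.Properties.CommutativeMonoid.Sum +-0-commutativeMonoid renaming (sum to Sum; sum-cong-≗ to Sum-cong; ∑-distrib-+ to Sum-+; ∑-comm to Sum-comm; sum-permute to Sum-permute; sum-replicate-zero to Sum-zero) using ()

-- A vertex of C inside a 4-cycle shows each neighbour only one vertex not adjacent to it anyway,
-- the opposite one; hence the bound by dU + dC. The obstacle is dU = 5: moved alone, such a vertex
-- would have five neighbours in U. A path through flat vertices repairs this: each inner vertex
-- loses both path neighbours (6 - 2 = 4) and each end loses one (5 - 1 = 4). As the path is
-- induced, a vertex of it meets only its predecessor among those already moved, and triangles
-- beside the path edge leave few neighbours of the predecessor new. In Euler's formula every
-- further component costs another 6. This settles a K that meets two components or has at most two
-- vertices, each of charge at least -6. A triangle on K guarantees only 7/8 · 6 - 18 < -12 after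
-- gifts of up to dU/8; one more edge leaving K decides, and without it K is a component by itself,
-- so there are again two. All darts that may ever occur are fixed in advance; a map is altered by
-- switching darts on and off.

module Counting where

  -- Linear arithmetic over ℕ: an inequality follows from hypotheses taken with explicit multiplicities
  -- as soon as it does so coefficient by coefficient.

  infixl 6 _⊕_
  infixl 7 _⊗_
  data Lin (n : ℕ) : Set where
    var   : Fin n → Lin n
    cst : ℕ → Lin n
    _⊕_ : Lin n → Lin n → Lin n
    _⊗_ : ℕ → Lin n → Lin n

  ⟦_⟧ : ∀ {n} → Lin n → Vec ℕ n → ℕ
  ⟦ var i ⟧   ρ = lookup ρ i
  ⟦ cst k ⟧   ρ = k
  ⟦ a ⊕ b ⟧ ρ = ⟦ a ⟧ ρ + ⟦ b ⟧ ρ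
  ⟦ k ⊗ a ⟧ ρ = k * ⟦ a ⟧ ρ

  unit : ∀ {n} → Fin n → Vec ℕ n
  unit zero    = 1 ∷ replicate _ 0
  unit (suc i) = 0 ∷ unit i

  coeffs : ∀ {n} → Lin n → ℕ × Vec ℕ n
  coeffs (var i)   = 0 , unit i
  coeffs (cst k)   = k , replicate _ 0
  coeffs (a ⊕ b) = proj₁ (coeffs a) + proj₁ (coeffs b) , zipWith _+_ (proj₂ (coeffs a)) (proj₂ (coeffs b))
  coeffs (k ⊗ a) = k * proj₁ (coeffs a) , map (k *_) (proj₂ (coeffs a))

  dot : ∀ {n} → Vec ℕ n → Vec ℕ n → ℕ
  dot []       []       = 0
  dot (a ∷ as) (x ∷ xs) = a * x + dot as xs

  dot-zero : ∀ {n} (ρ : Vec ℕ n) → dot (replicate n 0) ρ ≡ 0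
  dot-zero []      = refl
  dot-zero (_ ∷ ρ) = dot-zero ρ

  dot-unit : ∀ {n} (i : Fin n) ρ → dot (unit i) ρ ≡ lookup ρ i
  dot-unit zero    (x ∷ ρ) rewrite dot-zero ρ = trans (+-identityʳ (x + 0)) (+-identityʳ x)
  dot-unit (suc i) (x ∷ ρ) = dot-unit i ρ

  dot-+ : ∀ {n} (as bs ρ : Vec ℕ n) → dot (zipWith _+_ as bs) ρ ≡ dot as ρ + dot bs ρ
  dot-+ [] [] [] = refl
  dot-+ (a ∷ as) (b ∷ bs) (x ∷ ρ) rewrite dot-+ as bs ρ = lem a b x (dot as ρ) (dot bs ρ)
    where lem : ∀ a b x p q → (a + b) * x + (p + q) ≡ a * x + p + (b * x + q)
          lem = solve-∀

  dot-* : ∀ {n} k (as ρ : Vec ℕ n) → dot (map (k *_) as) ρ ≡ k * dot as ρ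
  dot-* k [] [] = sym (*-zeroʳ k)
  dot-* k (a ∷ as) (x ∷ ρ) rewrite dot-* k as ρ = lem k a x (dot as ρ)
    where lem : ∀ k a x p → k * a * x + k * p ≡ k * (a * x + p)
          lem = solve-∀

  coeffs-sound : ∀ {n} (a : Lin n) ρ → ⟦ a ⟧ ρ ≡ proj₁ (coeffs a) + dot (proj₂ (coeffs a)) ρ
  coeffs-sound (var i)   ρ = sym (dot-unit i ρ)
  coeffs-sound (cst k)   ρ rewrite dot-zero ρ = sym (+-identityʳ k)
  coeffs-sound (a ⊕ b) ρ rewrite coeffs-sound a ρ | coeffs-sound b ρ | dot-+ (proj₂ (coeffs a)) (proj₂ (coeffs b)) ρ =
    lem (proj₁ (coeffs a)) _ (proj₁ (coeffs b)) _
    where lem : ∀ a p b q → a + p + (b + q) ≡ a + b + (p + q)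
          lem = solve-∀
  coeffs-sound (k ⊗ a) ρ rewrite coeffs-sound a ρ | dot-* k (proj₂ (coeffs a)) ρ = *-distribˡ-+ k (proj₁ (coeffs a)) _

  leq : ∀ {n} → Vec ℕ n → Vec ℕ n → Bool
  leq []       []       = true
  leq (a ∷ as) (b ∷ bs) = (a ≤ᵇ b) ∧ leq as bs

  ≤ᵇ-sound : ∀ m n → (m ≤ᵇ n) ≡ true → m ≤ n
  ≤ᵇ-sound m n e = ≤ᵇ⇒≤ m n (subst True (sym e) _)

  ∧-elim : ∀ {a b} → a ∧ b ≡ true → a ≡ true × b ≡ true
  ∧-elim {true} {true} _ = refl , refl

  leq-sound : ∀ {n} (as bs ρ : Vec ℕ n) → leq as bs ≡ true → dot as ρ ≤ dot bs ρ
  leq-sound [] [] [] _ = z≤n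
  leq-sound (a ∷ as) (b ∷ bs) (x ∷ ρ) e =
    +-mono-≤ (*-monoˡ-≤ x (≤ᵇ-sound a b (proj₁ (∧-elim e)))) (leq-sound as bs ρ (proj₂ (∧-elim {a ≤ᵇ b} e)))

  record Ineq (n : ℕ) : Set where
    constructor _*[_≼_]
    field
      mult : ℕ
      lo hi : Lin n

  Holds : ∀ {n} → Vec ℕ n → Ineq n → Set
  Holds ρ (_ *[ l ≼ r ]) = ⟦ l ⟧ ρ ≤ ⟦ r ⟧ ρ

  los his : ∀ {n} → List (Ineq n) → Lin n
  los [] = cst 0
  los ((k *[ l ≼ r ]) ∷ hs) = k ⊗ l ⊕ los hs
  his [] = cst 0
  his ((k *[ l ≼ r ]) ∷ hs) = k ⊗ r ⊕ his hs

  los≤his : ∀ {n} ρ (hs : List (Ineq n)) → All (Holds ρ) hs → ⟦ los hs ⟧ ρ ≤ ⟦ his hs ⟧ ρ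
  los≤his ρ [] [] = z≤n
  los≤his ρ ((k *[ l ≼ r ]) ∷ hs) (h ∷ ps) = +-mono-≤ (*-monoʳ-≤ k h) (los≤his ρ hs ps)

  check : ∀ {n} → Lin n → Lin n → Bool
  check a b = (proj₁ (coeffs a) ≤ᵇ proj₁ (coeffs b)) ∧ leq (proj₂ (coeffs a)) (proj₂ (coeffs b))

  check-sound : ∀ {n} (a b : Lin n) ρ → check a b ≡ true → ⟦ a ⟧ ρ ≤ ⟦ b ⟧ ρ
  check-sound a b ρ e rewrite coeffs-sound a ρ | coeffs-sound b ρ =
    +-mono-≤ (≤ᵇ-sound (proj₁ (coeffs a)) (proj₁ (coeffs b)) (proj₁ (∧-elim e)))
             (leq-sound (proj₂ (coeffs a)) (proj₂ (coeffs b)) ρ (proj₂ (∧-elim {proj₁ (coeffs a) ≤ᵇ proj₁ (coeffs b)} e)))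

  -- The hypotheses are added crosswise, `his` on the left and `los` on the right, so that no
  -- subtraction occurs in ℕ; the positive factor `suc k` can be cancelled.
  farkas : ∀ {n} (ρ : Vec ℕ n) (hs : List (Ineq n)) → All (Holds ρ) hs → ∀ k (l r : Lin n) →
           check (suc k ⊗ l ⊕ his hs) (suc k ⊗ r ⊕ los hs) ≡ true → ⟦ l ⟧ ρ ≤ ⟦ r ⟧ ρ
  farkas ρ hs ps k l r e =
    *-cancelˡ-≤ (suc k) (+-cancelʳ-≤ (⟦ his hs ⟧ ρ) _ _
      (≤-trans (check-sound (suc k ⊗ l ⊕ his hs) (suc k ⊗ r ⊕ los hs) ρ e) (+-monoʳ-≤ _ (los≤his ρ hs ps))))

  x₀ : ∀ {n} → Lin (1 + n)
  x₀ = var zero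
  x₁ : ∀ {n} → Lin (2 + n)
  x₁ = var (suc zero)
  x₂ : ∀ {n} → Lin (3 + n)
  x₂ = var (suc (suc zero))
  x₃ : ∀ {n} → Lin (4 + n)
  x₃ = var (suc (suc (suc zero)))
  x₄ : ∀ {n} → Lin (5 + n)
  x₄ = var (suc (suc (suc (suc zero))))
  x₅ : ∀ {n} → Lin (6 + n)
  x₅ = var (suc (suc (suc (suc (suc zero)))))
  x₆ : ∀ {n} → Lin (7 + n)
  x₆ = var (suc (suc (suc (suc (suc (suc zero))))))
  x₇ : ∀ {n} → Lin (8 + n)
  x₇ = var (suc (suc (suc (suc (suc (suc (suc zero)))))))

  true≢false : ∀ {b} → b ≡ true → b ≡ false → ⊥
  true≢false refl ()

  ∧-intro : ∀ {a b} → a ≡ true → b ≡ true → a ∧ b ≡ true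
  ∧-intro refl refl = refl

  not-intro : ∀ {b} → b ≡ false → not b ≡ true
  not-intro refl = refl

  not-elim : ∀ {b} → not b ≡ true → b ≡ false
  not-elim {false} _ = refl

  ≢true : ∀ {b} → b ≢ true → b ≡ false
  ≢true {true}  p = ⊥-elim (p refl)
  ≢true {false} p = refl

  ∨-elim : ∀ {a b} → a ∨ b ≡ true → a ≡ true ⊎ b ≡ true
  ∨-elim {true}  _ = inj₁ refl
  ∨-elim {false} e = inj₂ e

  ∨-introˡ : ∀ {a b} → a ≡ true → a ∨ b ≡ true
  ∨-introˡ refl = refl

  ∨-introʳ : ∀ {a b} → b ≡ true → a ∨ b ≡ true
  ∨-introʳ {true}  _ = refl
  ∨-introʳ {false} e = e

  bool-ext : ∀ {a b} → (a ≡ true → b ≡ true) → (b ≡ true → a ≡ true) → a ≡ b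
  bool-ext {true}  {b}     f g = sym (f refl)
  bool-ext {false} {false} f g = refl
  bool-ext {false} {true}  f g = g refl

  bdec : (b : Bool) → b ≡ true ⊎ b ≡ false
  bdec true  = inj₁ refl
  bdec false = inj₂ refl

  infix 4 _==_
  _==_ : ∀ {n} → Fin n → Fin n → Bool
  x == y = ⌊ x ≟ y ⌋

  ==⇒≡ : ∀ {n} {x y : Fin n} → (x == y) ≡ true → x ≡ y
  ==⇒≡ {x = x} {y} e with x ≟ y
  ... | yes p = p

  ≡⇒== : ∀ {n} {x y : Fin n} → x ≡ y → (x == y) ≡ true
  ≡⇒== {x = x} {y} e with x ≟ y
  ... | yes p = refl
  ... | no ¬p = ⊥-elim (¬p e)

  ≢⇒== : ∀ {n} {x y : Fin n} → x ≢ y → (x == y) ≡ false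
  ≢⇒== {x = x} {y} e with x ≟ y
  ... | yes p = ⊥-elim (e p)
  ... | no ¬p = refl

  ==⇒≢ : ∀ {n} {x y : Fin n} → (x == y) ≡ false → x ≢ y
  ==⇒≢ e p = true≢false (≡⇒== p) e

  dec-true : ∀ {p} {P : Set p} (d : Dec P) → P → ⌊ d ⌋ ≡ true
  dec-true (yes _) _ = refl
  dec-true (no ¬p) p = ⊥-elim (¬p p)

  true-dec : ∀ {p} {P : Set p} (d : Dec P) → ⌊ d ⌋ ≡ true → P
  true-dec (yes p) _ = p

  -- Finite sums and cardinalities.

  ind : Bool → ℕ
  ind true  = 1
  ind false = 0

  opaque
    sum : ∀ {n} → (Fin n → ℕ) → ℕ
    sum = Sum

    sum-mono : ∀ {n} {f g : Fin n → ℕ} → (∀ i → f i ≤ g i) → sum f ≤ sum g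
    sum-mono {zero}  h = z≤n
    sum-mono {suc n} h = +-mono-≤ (h zero) (sum-mono (h ∘ suc))

    sum-cong : ∀ {n} {f g : Fin n → ℕ} → (∀ i → f i ≡ g i) → sum f ≡ sum g
    sum-cong = Sum-cong

    sum-+ : ∀ {n} (f g : Fin n → ℕ) → sum (λ i → f i + g i) ≡ sum f + sum g
    sum-+ = Sum-+

    sum-comm : ∀ {m n} (f : Fin m → Fin n → ℕ) → sum (λ i → sum (f i)) ≡ sum (λ j → sum (λ i → f i j))
    sum-comm = Sum-comm

    sum-zero : ∀ {n} {f : Fin n → ℕ} → (∀ i → f i ≡ 0) → sum f ≡ 0
    sum-zero {n} h = trans (Sum-cong h) (Sum-zero n)

    sum-* : ∀ {n} k (f : Fin n → ℕ) → sum (λ i → k * f i) ≡ k * sum f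
    sum-* {zero}  k f = sym (*-zeroʳ k)
    sum-* {suc n} k f rewrite sum-* k (f ∘ suc) = sym (*-distribˡ-+ k (f zero) _)

    sum-≤-one : ∀ {n} (f : Fin n → ℕ) i → f i ≤ sum f
    sum-≤-one f zero    = m≤m+n _ _
    sum-≤-one f (suc i) = ≤-trans (sum-≤-one (f ∘ suc) i) (m≤n+m _ _)

    sum-perm : ∀ {n} (f : Fin n → ℕ) (p q : Fin n → Fin n) → (∀ d → p (q d) ≡ d) → (∀ d → q (p d) ≡ d) →
               sum (λ i → f (p i)) ≡ sum f
    sum-perm f p q pq qp = sym (Sum-permute f (Perm.permutation p q pq qp))

    -- Serves to show that an edge between two different faces is not a bridge: there the two
    -- summands can differ at a single dart only.
    sum-differ : ∀ {n} (f g : Fin n → ℕ) j → (∀ i → i ≢ j → f i ≡ g i) → sum f ≡ sum g → f j ≡ g j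
    sum-differ {suc n} f g zero h e = +-cancelʳ-≡ _ _ _ (trans e (cong (g zero +_) (Sum-cong λ i → sym (h (suc i) λ ()))))
    sum-differ {suc n} f g (suc j) h e =
      sum-differ (f ∘ suc) (g ∘ suc) j (λ i ne → h (suc i) (ne ∘ suc-injectiveF))
        (+-cancelˡ-≡ (f zero) _ _ (trans e (cong (_+ Sum (g ∘ suc)) (sym (h zero λ ())))))

    sum-++ : ∀ a b (f : Fin (a + b) → ℕ) → sum f ≡ sum (λ i → f (i ↑ˡ b)) + sum (λ j → f (a ↑ʳ j))
    sum-++ zero    b f = refl
    sum-++ (suc a) b f rewrite sum-++ a b (f ∘ suc) = sym (+-assoc (f zero) _ _)

    # : ∀ {n} → (Fin n → Bool) → ℕ
    # P = sum (ind ∘ P)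

    #-def : ∀ {n} (P : Fin n → Bool) → # P ≡ sum (λ i → ind (P i))
    #-def P = refl

    #-all : ∀ {n} → # {n} (λ _ → true) ≡ n
    #-all {zero}  = refl
    #-all {suc n} = cong suc (#-all {n})

    #-at : ∀ {n} (y : Fin n) → # (λ x → x == y) ≡ 1
    #-at {suc n} zero    = cong suc (sum-zero {n} λ i → refl)
    #-at {suc n} (suc y) = trans (Sum-cong {n} λ i → cong ind (bool-ext {suc i == suc y} {i == y}
      (λ e → ≡⇒== (suc-injectiveF (==⇒≡ e))) λ e → ≡⇒== (cong suc (==⇒≡ e)))) (#-at y)

    elems : ∀ {n} → (Fin n → Bool) → List (Fin n)
    elems {zero}  P = []
    elems {suc n} P = if P zero then zero ∷ List.map suc (elems (P ∘ suc)) else List.map suc (elems (P ∘ suc))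

    length-elems : ∀ {n} (P : Fin n → Bool) → length (elems P) ≡ # P
    length-elems {zero}  P = refl
    length-elems {suc n} P with P zero
    ... | true  = cong suc (trans (length-map (λ (i : Fin n) → suc i) (elems (P ∘ suc))) (length-elems (P ∘ suc)))
    ... | false = trans (length-map (λ (i : Fin n) → suc i) (elems (P ∘ suc))) (length-elems (P ∘ suc))

    ∈-elems : ∀ {n} (P : Fin n → Bool) i → P i ≡ true → i ∈ˡ elems P
    ∈-elems {suc n} P zero e rewrite e = here refl
    ∈-elems {suc n} P (suc i) e with P zero
    ... | true  = there (∈-map⁺ suc (∈-elems (P ∘ suc) i e))
    ... | false = ∈-map⁺ suc (∈-elems (P ∘ suc) i e)

    #-++ : ∀ a b (P : Fin (a + b) → Bool) → # P ≡ # (λ i → P (i ↑ˡ b)) + # (λ j → P (a ↑ʳ j))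
    #-++ a b P = sum-++ a b (ind ∘ P)

  ind-mono : ∀ {a b} → (a ≡ true → b ≡ true) → ind a ≤ ind b
  ind-mono {true}  h rewrite h refl = s≤s z≤n
  ind-mono {false} h = z≤n

  #-mono : ∀ {n} {P Q : Fin n → Bool} → (∀ i → P i ≡ true → Q i ≡ true) → # P ≤ # Q
  #-mono {P = P} {Q} h rewrite #-def P | #-def Q = sum-mono λ i → ind-mono (h i)

  #-cong : ∀ {n} {P Q : Fin n → Bool} → (∀ i → P i ≡ Q i) → # P ≡ # Q
  #-cong {P = P} {Q} h rewrite #-def P | #-def Q = sum-cong λ i → cong ind (h i)

  #-perm : ∀ {n} (P : Fin n → Bool) (p q : Fin n → Fin n) → (∀ d → p (q d) ≡ d) → (∀ d → q (p d) ≡ d) →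
           # (λ i → P (p i)) ≡ # P
  #-perm P p q pq qp rewrite #-def (λ i → P (p i)) | #-def P = sum-perm (ind ∘ P) p q pq qp

  #-empty : ∀ {n} {P : Fin n → Bool} → (∀ i → P i ≡ false) → # P ≡ 0
  #-empty {P = P} h rewrite #-def P = sum-zero λ i → cong ind (h i)

  #-pos : ∀ {n} (P : Fin n → Bool) i → P i ≡ true → 1 ≤ # P
  #-pos P i e rewrite #-def P = ≤-trans (≤-reflexive (cong ind (sym e))) (sum-≤-one (ind ∘ P) i)

  #-split : ∀ {n} (P Q : Fin n → Bool) → # P ≡ # (λ i → P i ∧ Q i) + # (λ i → P i ∧ not (Q i))
  #-split P Q rewrite #-def P | #-def (λ i → P i ∧ Q i) | #-def (λ i → P i ∧ not (Q i)) =
    trans (sum-cong λ i → lem (P i) (Q i)) (sum-+ _ _)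
    where lem : ∀ a b → ind a ≡ ind (a ∧ b) + ind (a ∧ not b)
          lem true true   = refl
          lem true false  = refl
          lem false b     = refl

  #-cover : ∀ {n} (P Q R : Fin n → Bool) → (∀ i → P i ≡ true → Q i ≡ true ⊎ R i ≡ true) → # P ≤ # Q + # R
  #-cover P Q R h rewrite #-def P | #-def Q | #-def R =
    ≤-trans (sum-mono λ i → lem (P i) (Q i) (R i) (h i)) (≤-reflexive (sum-+ _ _))
    where lem : ∀ a b d → (a ≡ true → b ≡ true ⊎ d ≡ true) → ind a ≤ ind b + ind d
          lem false b d h = z≤n
          lem true b d h with h refl
          ... | inj₁ refl = s≤s z≤n
          ... | inj₂ refl = m≤n+m 1 (ind b)

  #-disjoint : ∀ {n} (P Q R : Fin n → Bool) → (∀ i → Q i ≡ true → P i ≡ true) → (∀ i → R i ≡ true → P i ≡ true) →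
               (∀ i → Q i ≡ true → R i ≡ false) → # Q + # R ≤ # P
  #-disjoint P Q R q r qr rewrite #-def P | #-def Q | #-def R =
    ≤-trans (≤-reflexive (sym (sum-+ _ _))) (sum-mono λ i → lem (P i) (Q i) (R i) (q i) (r i) (qr i))
    where lem : ∀ a b d → (b ≡ true → a ≡ true) → (d ≡ true → a ≡ true) → (b ≡ true → d ≡ false) → ind b + ind d ≤ ind a
          lem a true d q r qr rewrite qr refl | q refl = s≤s z≤n
          lem a false d q r qr = ind-mono r

  #-remove : ∀ {n} (P : Fin n → Bool) y → P y ≡ true → # P ≡ suc (# (λ x → P x ∧ not (x == y)))
  #-remove P y e = trans (#-split P (_== y)) (cong (_+ # (λ x → P x ∧ not (x == y))) (trans (#-cong lem) (#-at y)))
    where lem : ∀ i → P i ∧ (i == y) ≡ (i == y)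
          lem i with i ≟ y
          ... | yes refl rewrite e = refl
          ... | no _ with P i
          ... | true  = refl
          ... | false = refl

  #-add : ∀ {n} (P : Fin n → Bool) y → P y ≡ false → # (λ x → P x ∨ (x == y)) ≡ suc (# P)
  #-add P y e = trans (#-remove (λ x → P x ∨ (x == y)) y (∨-introʳ {P y} (≡⇒== refl))) (cong suc (#-cong lem))
    where lem : ∀ i → (P i ∨ (i == y)) ∧ not (i == y) ≡ P i
          lem i with i ≟ y
          ... | yes refl rewrite e = refl
          ... | no _ with P i
          ... | true  = refl
          ... | false = refl

  #-add≤ : ∀ {n} (P : Fin n → Bool) y → # (λ x → P x ∨ (x == y)) ≤ suc (# P)
  #-add≤ P y = ≤-trans (#-cover _ P (_== y) λ i → ∨-elim) (≤-reflexive (trans (+-comm (# P) _) (cong (_+ # P) (#-at y))))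

  #≤n : ∀ {n} (P : Fin n → Bool) → # P ≤ n
  #≤n {n} P = ≤-trans (#-mono {Q = λ _ → true} λ _ _ → refl) (≤-reflexive (#-all {n}))

  elemᵇ : ∀ {n} → Fin n → List (Fin n) → Bool
  elemᵇ x []       = false
  elemᵇ x (y ∷ ys) = (x == y) ∨ elemᵇ x ys

  elemᵇ⇒∈ : ∀ {n} {x : Fin n} ys → elemᵇ x ys ≡ true → x ∈ˡ ys
  elemᵇ⇒∈ (y ∷ ys) e with ∨-elim e
  ... | inj₁ p = here (==⇒≡ p)
  ... | inj₂ p = there (elemᵇ⇒∈ ys p)

  ∈⇒elemᵇ : ∀ {n} {x : Fin n} {ys} → x ∈ˡ ys → elemᵇ x ys ≡ true
  ∈⇒elemᵇ (here {x = y} refl) = ∨-introˡ {y == y} (≡⇒== refl)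
  ∈⇒elemᵇ {x = x} {y ∷ _} (there p) = ∨-introʳ {x == y} (∈⇒elemᵇ p)

  Distinct : ∀ {n} → List (Fin n) → Set
  Distinct = AllPairs _≢_

  #-removes : ∀ {n} (P : Fin n → Bool) ys → Distinct ys → All (λ y → P y ≡ true) ys →
              # (λ x → P x ∧ not (elemᵇ x ys)) + length ys ≡ # P
  #-removes P [] [] [] = trans (+-identityʳ _) (#-cong λ i → lem (P i))
    where lem : ∀ a → a ∧ true ≡ a
          lem true = refl
          lem false = refl
  #-removes P (y ∷ ys) (y≢ ∷ ds) (p ∷ ps) =
    trans (trans (+-suc _ _) (cong suc (trans (cong (_+ length ys) (#-cong lem)) (#-removes P′ ys ds (shrink ys y≢ ps))))) (sym (#-remove P y p))
    where
    P′ : _ → Bool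
    P′ x = P x ∧ not (x == y)
    lem : ∀ i → P i ∧ not ((i == y) ∨ elemᵇ i ys) ≡ P′ i ∧ not (elemᵇ i ys)
    lem i with P i | (i == y)
    ... | true  | true  = refl
    ... | true  | false = refl
    ... | false | _     = refl
    shrink : ∀ zs → All (y ≢_) zs → All (λ z → P z ≡ true) zs → All (λ z → P′ z ≡ true) zs
    shrink [] [] [] = []
    shrink (z ∷ zs) (n ∷ ns) (q ∷ qs) = ∧-intro q (not-intro (≢⇒== (n ∘ sym))) ∷ shrink zs ns qs

  #-distinct : ∀ {n} (P : Fin n → Bool) ys → Distinct ys → All (λ y → P y ≡ true) ys → length ys ≤ # P
  #-distinct P ys ds ps = ≤-trans (m≤n+m (length ys) _) (≤-reflexive (#-removes P ys ds ps))

  #-inj : ∀ {n k} (P : Fin n → Bool) (h : Fin n → Fin k) xs →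
          (∀ i j → P i ≡ true → P j ≡ true → h i ≡ h j → i ≡ j) → (∀ i → P i ≡ true → h i ∈ˡ xs) → # P ≤ length xs
  #-inj P h [] inj cov = ≤-reflexive (#-empty λ i → ≢true λ p → nope (cov i p))
    where nope : ∀ {A : Set} {x : A} → ¬ (x ∈ˡ [])
          nope ()
  #-inj P h (x ∷ xs) inj cov with any? (λ i → (P i ≟ᵇ true) ×-dec (h i ≟ x))
  ... | no none = m≤n⇒m≤1+n (#-inj P h xs inj λ i p → shrink i p (cov i p))
    where shrink : ∀ i → P i ≡ true → h i ∈ˡ (x ∷ xs) → h i ∈ˡ xs
          shrink i p (here e) = ⊥-elim (none (i , p , e))
          shrink i p (there q) = q
  ... | yes (i₀ , p₀ , e₀) rewrite #-remove P i₀ p₀ = s≤s (#-inj P′ h xs inj′ λ i p → shrink i p (cov i (proj₁ (∧-elim p))))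
    where
    P′ : _ → Bool
    P′ i = P i ∧ not (i == i₀)
    inj′ : ∀ i j → P′ i ≡ true → P′ j ≡ true → h i ≡ h j → i ≡ j
    inj′ i j p q = inj i j (proj₁ (∧-elim p)) (proj₁ (∧-elim q))
    shrink : ∀ i → P′ i ≡ true → h i ∈ˡ (x ∷ xs) → h i ∈ˡ xs
    shrink i p (here e) = ⊥-elim (==⇒≢ (not-elim (proj₂ (∧-elim {P i} p))) (inj i i₀ (proj₁ (∧-elim p)) p₀ (trans e (sym e₀))))
    shrink i p (there q) = q

  #-unique : ∀ {n} (P : Fin n → Bool) → (∀ i j → P i ≡ true → P j ≡ true → i ≡ j) → # P ≤ 1
  #-unique {n} P u with any? (λ i → P i ≟ᵇ true)
  ... | no none = ≤-trans (≤-reflexive (#-empty λ i → ≢true λ p → none (i , p))) z≤n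
  ... | yes (i , p) = #-inj P id (i ∷ []) (λ _ _ _ _ e → e) λ j q → here (u j i q p)

  #-fibre : ∀ {n k} (P : Fin n → Bool) (h : Fin n → Fin k) → sum (λ x → # (λ d → P d ∧ (h d == x))) ≡ # P
  #-fibre P h = trans (sum-cong λ x → #-def _) (trans (sum-comm λ x d → ind (P d ∧ (h d == x)))
    (trans (sum-cong λ d → lem d (P d)) (sym (#-def P))))
    where lem : ∀ d b → sum (λ x → ind (b ∧ (h d == x))) ≡ ind b
          lem d false = sum-zero λ _ → refl
          lem d true  = trans (sym (#-def _)) (trans (#-cong {Q = _== h d} λ x → bool-ext (λ e → ≡⇒== (sym (==⇒≡ e))) λ e → ≡⇒== (sym (==⇒≡ e))) (#-at (h d)))

  #-fibreW : ∀ {n k} (P : Fin n → Bool) (h : Fin n → Fin k) (W : Fin k → Bool) →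
             sum (λ x → if W x then # (λ d → P d ∧ (h d == x)) else 0) ≡ # (λ d → P d ∧ W (h d))
  #-fibreW P h W = trans (sum-cong lem) (#-fibre (λ d → P d ∧ W (h d)) h)
    where
    lem : ∀ x → (if W x then # (λ d → P d ∧ (h d == x)) else 0) ≡ # (λ d → (P d ∧ W (h d)) ∧ (h d == x))
    lem x with W x in e
    ... | true  = #-cong λ d → bool-ext
                    (λ q → ∧-intro (∧-intro (proj₁ (∧-elim q)) (trans (cong W (==⇒≡ (proj₂ (∧-elim {P d} q)))) e)) (proj₂ (∧-elim {P d} q)))
                    (λ q → ∧-intro (proj₁ (∧-elim (proj₁ (∧-elim {P d ∧ W (h d)} q)))) (proj₂ (∧-elim {P d ∧ W (h d)} q)))
    ... | false = sym (#-empty λ d → ≢true λ q → true≢false (trans (cong W (sym (==⇒≡ (proj₂ (∧-elim {P d ∧ W (h d)} q))))) (proj₂ (∧-elim {P d} (proj₁ (∧-elim q))))) e)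


  sum-const : ∀ {n} k → sum {n} (λ _ → k) ≡ k * n
  sum-const {n} k = trans (sum-cong λ _ → sym (*-identityʳ k)) (trans (sum-* k (λ _ → 1)) (cong (k *_) (trans (sym (#-def {n} (λ _ → true))) #-all)))

  length-image : ∀ {n} {A : Set} (g : Fin n → A) (P : Fin n → Bool) → length (List.map g (elems P)) ≡ # P
  length-image g P = trans (length-map g (elems P)) (length-elems P)

open Counting

-- Darts, transpositions, and orderings built from the end.

module Basics where

  -- `fr x y` is a spare dart from `x` to `y`: new edges can be drawn without changing the set of
  -- darts.
  record Darts (N M : ℕ) : Set where
    field
      tl     : Fin M → Fin N
      rev    : Fin M → Fin M
      rev²   : ∀ d → rev (rev d) ≡ d
      fr     : Fin N → Fin N → Fin M
      tl-fr  : ∀ x y → tl (fr x y) ≡ x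
      rev-fr : ∀ x y → rev (fr x y) ≡ fr y x

    hd : Fin M → Fin N
    hd d = tl (rev d)

  sw : ∀ {n} → Fin n → Fin n → Fin n → Fin n
  sw x y d = if d == x then y else if d == y then x else d

  sw-l : ∀ {n} (x y : Fin n) → sw x y x ≡ y
  sw-l x y rewrite ≡⇒== {x = x} refl = refl

  sw-r : ∀ {n} (x y : Fin n) → sw x y y ≡ x
  sw-r x y with y ≟ x
  ... | yes e = e
  ... | no _ rewrite ≡⇒== {x = y} refl = refl

  sw-o : ∀ {n} {x y d : Fin n} → d ≢ x → d ≢ y → sw x y d ≡ d
  sw-o p q rewrite ≢⇒== p | ≢⇒== q = refl

  sw² : ∀ {n} (x y d : Fin n) → sw x y (sw x y d) ≡ d
  sw² x y d = case d ≟ x of λ where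
    (yes refl) → trans (cong (sw d y) (sw-l d y)) (sw-r d y)
    (no p) → case d ≟ y of λ where
      (yes refl) → trans (cong (sw x d) (sw-r x d)) (sw-l x d)
      (no q) → trans (cong (sw x y) (sw-o p q)) (sw-o p q)

  sw-resp : ∀ {n} {A : Set} (f : Fin n → A) {x y} → f x ≡ f y → ∀ d → f (sw x y d) ≡ f d
  sw-resp f {x} {y} e d = case d ≟ x of λ where
    (yes refl) → trans (cong f (sw-l d y)) (sym e)
    (no p) → case d ≟ y of λ where
      (yes refl) → trans (cong f (sw-r x d)) e
      (no q) → cong f (sw-o p q)

  mergeF : ∀ {f} (α β : Fin (suc f)) → α ≢ β → Fin (suc f) → Fin f
  mergeF α β ne x with α ≟ x
  ... | yes _ = punchOut ne
  ... | no p  = punchOut p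

  mergeF-eq : ∀ {f} (α β : Fin (suc f)) (ne : α ≢ β) → mergeF α β ne α ≡ mergeF α β ne β
  mergeF-eq α β ne with α ≟ α | α ≟ β
  ... | yes _ | yes p = ⊥-elim (ne p)
  ... | yes _ | no q  = punchOut-cong α refl
  ... | no p  | _     = ⊥-elim (p refl)

  mergeF-surj : ∀ {f} (α β : Fin (suc f)) (ne : α ≢ β) y → ∃[ x ] mergeF α β ne x ≡ y
  mergeF-surj α β ne y = punchIn α y , lem
    where lem : mergeF α β ne (punchIn α y) ≡ y
          lem with α ≟ punchIn α y
          ... | yes e = ⊥-elim (punchInᵢ≢i α y (sym e))
          ... | no p  = trans (punchOut-cong α refl) (punchOut-punchIn α {y} )

  infixl 6 _∖_
  _∖_ : ∀ {n} → (Fin n → Bool) → Fin n → (Fin n → Bool)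
  (U ∖ x) y = U y ∧ not (y == x)

  ∖⇒ : ∀ {n} {U : Fin n → Bool} {x y} → (U ∖ x) y ≡ true → U y ≡ true × y ≢ x
  ∖⇒ {U = U} {x} {y} p = let (a , b) = ∧-elim {U y} p in a , ==⇒≢ (not-elim b)

  ⇒∖ : ∀ {n} {U : Fin n → Bool} {x y} → U y ≡ true → y ≢ x → (U ∖ x) y ≡ true
  ⇒∖ a b = ∧-intro a (not-intro (≢⇒== b))

  ∖-false : ∀ {n} {U : Fin n → Bool} {x y} → (U ∖ x) y ≡ false → U y ≡ false ⊎ y ≡ x
  ∖-false {U = U} {x} {y} p = case y ≟ x of λ where
    (yes e) → inj₂ e
    (no ne) → inj₁ (≢true λ u → true≢false (⇒∖ {U = U} u ne) p)

  -- v is two-reachable from u when the vertices outside U are those that come later.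
  TwoReach : ∀ {n} → (Fin n → Fin n → Set) → (Fin n → Bool) → Fin n → Fin n → Set
  TwoReach A U u v = A u v ⊎ ∃[ w ] (U w ≡ false × A w u × A w v)

  -- The vertex eliminated first is the last of the ordering. `done` asks for no bound, since the
  -- remaining vertices lie in `K`, which is small.
  data Elim {n} (A : Fin n → Fin n → Set) (K : Fin n → Bool) : (Fin n → Bool) → Set where
    done  : ∀ {U} → (∀ x → U x ≡ true → K x ≡ true) → Elim A K U
    elim  : ∀ {U} v → U v ≡ true → K v ≡ false → AtMost 7 (λ u → U u ≡ true × u ≢ v × TwoReach A U u v) →
            Elim A K (U ∖ v) → Elim A K U

  -- An elimination for a graph with more two-reachable pairs also serves the original one. This is
  -- what permits adding edges and trading a vertex of C for edges between its neighbours.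
  Elim-mono : ∀ {n} {A A′ : Fin n → Fin n → Set} {K U : Fin n → Bool} →
    (∀ V → (∀ x → V x ≡ true → U x ≡ true) → ∀ u v → V u ≡ true → V v ≡ true → u ≢ v → TwoReach A V u v → TwoReach A′ V u v) →
    Elim A′ K U → Elim A K U
  Elim-mono h (done d) = done d
  Elim-mono {U = U} h (elim v u k (xs , le , cov) e) = elim v u k
    (xs , le , λ x (ux , ne , r) → cov x (ux , ne , h U (λ _ p → p) x v ux u ne r))
    (Elim-mono (λ V sub → h V (λ x p → proj₁ (∖⇒ {U = U} (sub x p)))) e)

open Basics

-- Rotations, plane maps, and the deletion of an edge.

module PlaneMaps {N M : ℕ} (𝔻 : Darts N M) where

  open Darts 𝔻 public

  rev-inj : ∀ {d e} → rev d ≡ rev e → d ≡ e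
  rev-inj {d} {e} p = trans (sym (rev² d)) (trans (cong rev p) (rev² e))

  -- A rotation at every vertex: a permutation fixing the absent darts, whose
  -- other cycles are the sets of present darts with a common tail.
  record Rot (on : Fin M → Bool) : Set where
    no-eta-equality
    field
      nx pv  : Fin M → Fin M
      nxpv   : ∀ d → nx (pv d) ≡ d
      pvnx   : ∀ d → pv (nx d) ≡ d
      nx-tl  : ∀ d → tl (nx d) ≡ tl d
      nx-off : ∀ d → on d ≡ false → nx d ≡ d
      -- Transitivity is expressed through invariant sets rather than iterates: an invariant set is
      -- easily transported when a dart is inserted or removed.
      rotc   : ∀ (S : Fin M → Bool) → (∀ d → S (nx d) ≡ S d) →
               ∀ d d′ → on d ≡ true → on d′ ≡ true → tl d ≡ tl d′ → S d ≡ S d′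

    nx-inj : ∀ {d e} → nx d ≡ nx e → d ≡ e
    nx-inj {d} {e} p = trans (sym (pvnx d)) (trans (cong pv p) (pvnx e))

    pv-tl : ∀ d → tl (pv d) ≡ tl d
    pv-tl d = trans (sym (nx-tl (pv d))) (cong tl (nxpv d))

    nx-on : ∀ d → on (nx d) ≡ on d
    nx-on d with on d in e | on (nx d) in e′
    ... | true  | true  = refl
    ... | false | false = refl
    ... | true  | false = ⊥-elim (true≢false e (subst (λ x → on x ≡ false) (nx-inj (nx-off (nx d) e′)) e′))
    ... | false | true  = ⊥-elim (true≢false (subst (λ x → on x ≡ true) (nx-off d e) e′) e)

    pv-on : ∀ d → on (pv d) ≡ on d
    pv-on d = trans (sym (nx-on (pv d))) (cong on (nxpv d))

  module _ {on : Fin M → Bool} (R : Rot on) where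
    open Rot R

    -- Following `nx` by the transposition of `d₀` and `nx d₀` makes `d₀` a fixed point and sends
    -- its predecessor to its successor. A set invariant afterwards becomes invariant before once
    -- `d₀` is given the value at `nx d₀`.
    cut : ∀ d₀ → on d₀ ≡ true → Rot (λ d → on d ∧ not (d == d₀))
    cut d₀ o = record
      { nx = nx′ ; pv = λ d → pv (s d)
      ; nxpv = λ d → trans (cong s (nxpv (s d))) (sw² _ _ d)
      ; pvnx = λ d → trans (cong pv (sw² d₀ (nx d₀) (nx d))) (pvnx d)
      ; nx-tl = λ d → trans (sw-resp tl (sym (nx-tl d₀)) (nx d)) (nx-tl d)
      ; nx-off = off ; rotc = rc }
      where
      s = sw d₀ (nx d₀)
      nx′ = λ d → s (nx d)
      off : ∀ d → on d ∧ not (d == d₀) ≡ false → nx′ d ≡ d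
      off d e with d ≟ d₀
      ... | yes refl = sw-r d (nx d)
      ... | no p with on d in e′
      ... | true  = ⊥-elim (true≢false refl e)
      ... | false = trans (cong s (nx-off d e′)) (sw-o p λ q → true≢false (trans (cong on q) (trans (nx-on d₀) o)) e′)
      rc : ∀ (S : Fin M → Bool) → (∀ d → S (nx′ d) ≡ S d) → ∀ d d′ → on d ∧ not (d == d₀) ≡ true → on d′ ∧ not (d′ == d₀) ≡ true →
           tl d ≡ tl d′ → S d ≡ S d′
      rc S cl d d′ p q e = trans (sym (S⁺-o d p)) (trans (rotc S⁺ cl⁺ d d′ (proj₁ (∧-elim p)) (proj₁ (∧-elim q)) e) (S⁺-o d′ q))
        where
        S⁺ : Fin M → Bool
        S⁺ d = if d == d₀ then S (nx d₀) else S d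
        S⁺-o : ∀ d → on d ∧ not (d == d₀) ≡ true → S⁺ d ≡ S d
        S⁺-o d p rewrite not-elim (proj₂ (∧-elim {on d} p)) = refl
        S⁺-n : ∀ d → d ≢ d₀ → S⁺ d ≡ S d
        S⁺-n d p rewrite ≢⇒== p = refl
        S⁺-h : S⁺ d₀ ≡ S (nx d₀)
        S⁺-h rewrite ≡⇒== {x = d₀} refl = refl
        cl⁺ : ∀ d → S⁺ (nx d) ≡ S⁺ d
        cl⁺ d = case d ≟ d₀ of λ where
          (yes refl) → case nx d ≟ d of λ where
            (yes e) → cong S⁺ e
            (no p) → trans (S⁺-n (nx d) p) (sym S⁺-h)
          (no p) → case nx d ≟ d₀ of λ where
            (yes e) → trans (trans (cong S⁺ e) S⁺-h) (trans (trans (cong S (sym (trans (cong s e) (sw-l d₀ (nx d₀))))) (cl d)) (sym (S⁺-n d p)))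
            (no q) → trans (S⁺-n (nx d) q) (trans (cong S (sym (sw-o q (p ∘ nx-inj)))) (trans (cl d) (sym (S⁺-n d p))))

    -- Following `nx` by the transposition of `g` and `a` puts the fixed point `g` into the cycle
    -- just before `a`.
    ins : ∀ g a → on g ≡ false → on a ≡ true → tl g ≡ tl a → Rot (λ d → on d ∨ (d == g))
    ins g a og oa ta = record
      { nx = nx′ ; pv = λ d → pv (s d)
      ; nxpv = λ d → trans (cong s (nxpv (s d))) (sw² _ _ d)
      ; pvnx = λ d → trans (cong pv (sw² g a (nx d))) (pvnx d)
      ; nx-tl = λ d → trans (sw-resp tl ta (nx d)) (nx-tl d)
      ; nx-off = off ; rotc = rc }
      where
      s = sw g a
      nx′ = λ d → s (nx d)
      off : ∀ d → on d ∨ (d == g) ≡ false → nx′ d ≡ d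
      off d e with on d in e′ | d ≟ g
      ... | false | no p = trans (cong s (nx-off d e′)) (sw-o p λ q → true≢false (trans (cong on q) oa) e′)
      rc : ∀ (S : Fin M → Bool) → (∀ d → S (nx′ d) ≡ S d) → ∀ d d′ → on d ∨ (d == g) ≡ true → on d′ ∨ (d′ == g) ≡ true →
           tl d ≡ tl d′ → S d ≡ S d′
      rc S cl d d′ p q e with to d p | to d′ q
        where
        to : ∀ d → on d ∨ (d == g) ≡ true → ∃[ x ] (on x ≡ true × tl x ≡ tl d × S x ≡ S d)
        to d p with ∨-elim {on d} p
        ... | inj₁ o = d , o , refl , refl
        ... | inj₂ h rewrite ==⇒≡ h = a , oa , sym ta , trans (cong S (sym (trans (cong s (nx-off g og)) (sw-l g a)))) (cl g)
      ... | x , ox , tx , Sx | y , oy , ty , Sy =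
        trans (sym Sx) (trans (rotc S cl⁻ x y ox oy (trans tx (trans e (sym ty)))) Sy)
        where
        Sag : S a ≡ S g
        Sag = trans (cong S (sym (trans (cong s (nx-off g og)) (sw-l g a)))) (cl g)
        cl⁻ : ∀ d → S (nx d) ≡ S d
        cl⁻ d = case nx d ≟ a of λ where
          (yes e) → trans (cong S e) (trans Sag (trans (cong S (sym (trans (cong s e) (sw-r g a)))) (cl d)))
          (no p) → case nx d ≟ g of λ where
            (yes e) → cong S (trans e (sym (nx-inj (trans e (sym (nx-off g og))))))
            (no q) → trans (cong S (sym (sw-o q p))) (cl d)

  -- A plane map on the vertices in alive, given by the darts in on.  The faces are only required to be unions
  -- of orbits of φ; they carry enough information because Euler's formula is kept as an inequality, together with
  -- the connectedness of the dual graph (dual) and a set of vertices meeting every component (root, hit).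
  record PMap : Set where
    no-eta-equality
    field
      f        : ℕ
      on       : Fin M → Bool
      on-rev   : ∀ d → on (rev d) ≡ on d
      alive    : Fin N → Bool
      on-alive : ∀ d → on d ≡ true → alive (tl d) ≡ true
      loopless : ∀ d → on d ≡ true → tl d ≢ hd d
      rot      : Rot on
    open Rot rot public
    field
      lab      : Fin M → Fin f
      corner   : ∀ d → on d ≡ true → lab (nx d) ≡ lab (rev d)
      dual     : ∀ (S : Fin f → Bool) → (∀ d → on d ≡ true → S (lab (rev d)) ≡ S (lab d)) → ∀ α β → S α ≡ S β

    Closed : (Fin N → Bool) → Set
    Closed S = ∀ d → on d ≡ true → S (hd d) ≡ S (tl d)

    field
      root     : Fin N → Bool
      hit      : ∀ S → Closed S → ∀ x → alive x ≡ true → S x ≡ true → ∃[ r ] (root r ≡ true × S r ≡ true)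
      euler    : # on + (2 + 2 * # root) ≤ 2 * # alive + 2 * f

    A : Fin N → Fin N → Set
    A u v = ∃[ d ] (on d ≡ true × tl d ≡ u × hd d ≡ v)

    A? : ∀ u v → Dec (A u v)
    A? u v = any? λ d → (on d ≟ᵇ true) ×-dec ((tl d ≟ u) ×-dec (hd d ≟ v))

    A-sym : ∀ {u v} → A u v → A v u
    A-sym (d , o , t , h) = rev d , trans (on-rev d) o , h , trans (cong tl (rev² d)) t

    A-irr : ∀ {u v} → A u v → u ≢ v
    A-irr (d , o , t , h) e = loopless d o (trans t (trans e (sym h)))

    φ ψ : Fin M → Fin M
    φ d = nx (rev d)
    ψ d = rev (pv d)

    φψ : ∀ d → φ (ψ d) ≡ d
    φψ d = trans (cong nx (rev² (pv d))) (nxpv d)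

    ψφ : ∀ d → ψ (φ d) ≡ d
    ψφ d = trans (cong rev (pvnx (rev d))) (rev² d)

    φ-on : ∀ d → on (φ d) ≡ on d
    φ-on d = trans (nx-on (rev d)) (on-rev d)

    φ-lab : ∀ d → on d ≡ true → lab (φ d) ≡ lab d
    φ-lab d o = trans (corner (rev d) (trans (on-rev d) o)) (cong lab (rev² d))

    φ-tl : ∀ d → tl (φ d) ≡ hd d
    φ-tl d = nx-tl (rev d)

  module Deletion (P : PMap) (d₀ : Fin M) (o : PMap.on P d₀ ≡ true) where
    open PMap P

    r₀ = rev d₀

    or₀ : on r₀ ≡ true
    or₀ = trans (on-rev d₀) o

    tne : tl d₀ ≢ tl r₀
    tne = loopless d₀ o

    d≢r : d₀ ≢ r₀
    d≢r e = tne (cong tl e)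

    on₁ on₂ : Fin M → Bool
    on₁ d = on d ∧ not (d == d₀)
    on₂ d = on₁ d ∧ not (d == r₀)

    on₁r : on₁ r₀ ≡ true
    on₁r = ∧-intro or₀ (not-intro (≢⇒== (d≢r ∘ sym)))

    rot₁ : Rot on₁
    rot₁ = cut rot d₀ o
    rot₂ : Rot on₂
    rot₂ = cut rot₁ r₀ on₁r

    nx₁ = Rot.nx rot₁
    nx₂ = Rot.nx rot₂

    on₂⇒ : ∀ {d} → on₂ d ≡ true → on d ≡ true × d ≢ d₀ × d ≢ r₀
    on₂⇒ {d} p with ∧-elim {on₁ d} p
    ... | p₁ , p₂ with ∧-elim {on d} p₁
    ... | q₁ , q₂ = q₁ , ==⇒≢ (not-elim q₂) , ==⇒≢ (not-elim p₂)

    ⇒on₂ : ∀ {d} → on d ≡ true → d ≢ d₀ → d ≢ r₀ → on₂ d ≡ true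
    ⇒on₂ p q r = ∧-intro (∧-intro p (not-intro (≢⇒== q))) (not-intro (≢⇒== r))

    nx₁r : nx₁ r₀ ≡ nx r₀
    nx₁r = sw-o (λ e → tne (sym (trans (sym (nx-tl r₀)) (cong tl e)))) (λ e → d≢r (sym (nx-inj e)))

    nx-d : ∀ d → nx d ≡ d₀ → nx₂ d ≡ nx d₀
    nx-d d e = trans (cong (sw r₀ (nx₁ r₀)) (trans (cong (sw d₀ (nx d₀)) e) (sw-l d₀ (nx d₀))))
      (sw-o (λ q → tne (trans (sym (nx-tl d₀)) (cong tl q))) (λ q → d≢r (nx-inj (trans q nx₁r))))

    nx-r : ∀ d → nx d ≡ r₀ → nx₂ d ≡ nx r₀
    nx-r d e = trans (cong (sw r₀ (nx₁ r₀)) (trans (cong (sw d₀ (nx d₀)) e) (sw-o (d≢r ∘ sym) λ q → tne (sym (trans (cong tl q) (nx-tl d₀))))))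
      (trans (sw-l r₀ (nx₁ r₀)) nx₁r)

    nx-o : ∀ d → nx d ≢ d₀ → nx d ≢ r₀ → d ≢ d₀ → d ≢ r₀ → nx₂ d ≡ nx d
    nx-o d p q p′ q′ = trans (cong (sw r₀ (nx₁ r₀)) (sw-o p (p′ ∘ nx-inj))) (sw-o q λ e → q′ (nx-inj (trans e nx₁r)))

    on₂-rev : ∀ d → on₂ (rev d) ≡ on₂ d
    on₂-rev d = bool-ext (λ p → let (a , b , c) = on₂⇒ p in ⇒on₂ (trans (sym (on-rev d)) a) (λ e → c (cong rev e)) (λ e → b (trans (cong rev e) (rev² d₀))))
      (λ p → let (a , b , c) = on₂⇒ p in ⇒on₂ (trans (on-rev d) a) (λ e → c (trans (sym (rev² d)) (cong rev e))) (λ e → b (rev-inj e)))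

    corner₂ : ∀ {f′} (h : Fin f → Fin f′) → h (lab d₀) ≡ h (lab r₀) → ∀ d → on₂ d ≡ true → h (lab (nx₂ d)) ≡ h (lab (rev d))
    corner₂ h e d p with on₂⇒ p
    ... | oo , p₁ , p₂ = case nx d ≟ d₀ of λ where
      (yes q) → trans (cong (h ∘ lab) (nx-d d q)) (trans (cong h (corner d₀ o)) (trans (sym e) (cong h (trans (cong lab (sym q)) (corner d oo)))))
      (no q₁) → case nx d ≟ r₀ of λ where
        (yes q) → trans (cong (h ∘ lab) (nx-r d q)) (trans (cong h (trans (corner r₀ or₀) (cong lab (rev² d₀)))) (trans e (cong h (trans (cong lab (sym q)) (corner d oo)))))
        (no q₂) → trans (cong (h ∘ lab) (nx-o d q₁ q₂ p₁ p₂)) (cong h (corner d oo))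

    #on₂ : # on ≡ 2 + # on₂
    #on₂ = trans (#-remove on d₀ o) (cong suc (#-remove on₁ r₀ on₁r))

    Closed₂ : (Fin N → Bool) → Set
    Closed₂ S = ∀ d → on₂ d ≡ true → S (hd d) ≡ S (tl d)

    close : ∀ S → Closed₂ S → S (hd d₀) ≡ S (tl d₀) → Closed S
    close S cl e d p = case d ≟ d₀ of λ where
      (yes refl) → e
      (no q) → case d ≟ r₀ of λ where
        (yes refl) → trans (cong S (cong tl (rev² d₀))) (sym e)
        (no r) → cl d (⇒on₂ p q r)

    record Result : Set where
      no-eta-equality
      field
        map′ₘ  : PMap
        onₘ    : ∀ d → PMap.on map′ₘ d ≡ on₂ d
        aliveₘ : ∀ x → PMap.alive map′ₘ x ≡ alive x
        nxₘ    : ∀ d → tl d ≢ tl d₀ → tl d ≢ hd d₀ → PMap.nx map′ₘ d ≡ nx d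

    nx₂-far : ∀ d → tl d ≢ tl d₀ → tl d ≢ hd d₀ → nx₂ d ≡ nx d
    nx₂-far d p q = nx-o d (λ e → p (trans (sym (nx-tl d)) (cong tl e))) (λ e → q (trans (sym (nx-tl d)) (cong tl e)))
      (λ e → p (cong tl e)) (λ e → q (cong tl e))

    build : ∀ {f′} (h : Fin f → Fin f′) → h (lab d₀) ≡ h (lab r₀) →
            (∀ (S : Fin f′ → Bool) → (∀ d → on₂ d ≡ true → S (h (lab (rev d))) ≡ S (h (lab d))) → ∀ α β → S α ≡ S β) →
            (root′ : Fin N → Bool) → (∀ S → Closed₂ S → ∀ x → alive x ≡ true → S x ≡ true → ∃[ r ] (root′ r ≡ true × S r ≡ true)) →
            # on₂ + (2 + 2 * # root′) ≤ 2 * # alive + 2 * f′ → Result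
    build h e du rt ht eu = record
      { map′ₘ = record
          { on = on₂ ; on-rev = on₂-rev ; alive = alive ; on-alive = λ d p → on-alive d (proj₁ (on₂⇒ p))
          ; loopless = λ d p → loopless d (proj₁ (on₂⇒ p)) ; rot = rot₂ ; lab = h ∘ lab ; corner = corner₂ h e
          ; dual = du ; root = rt ; hit = ht ; euler = eu }
      ; onₘ = λ _ → refl ; aliveₘ = λ _ → refl ; nxₘ = nx₂-far }

    -- An edge with different faces on its sides is not a bridge: the darts of the face
    -- on one side leave every vertex set as often as they enter it.
    notBridge : lab d₀ ≢ lab r₀ → ∀ S → Closed₂ S → S (hd d₀) ≡ S (tl d₀)
    notBridge ne S cl = sym (inj (subst (λ b → ind (b ∧ S (tl d₀)) ≡ ind (b ∧ S (hd d₀))) here≡ (sum-differ F G d₀ same total)))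
      where
      B F G : _
      B = λ d → on d ∧ (lab d == lab d₀)
      F = λ d → ind (B d ∧ S (tl d))
      G = λ d → ind (B d ∧ S (hd d))
      here≡ : B d₀ ≡ true
      here≡ = ∧-intro o (≡⇒== refl)
      inj : ∀ {a b} → ind (true ∧ a) ≡ ind (true ∧ b) → a ≡ b
      inj {true} {true} _ = refl
      inj {false} {false} _ = refl
      same : ∀ i → i ≢ d₀ → F i ≡ G i
      same i p with on i in oi | i ≟ r₀
      ... | false | _ = refl
      ... | true | yes refl rewrite ≢⇒== {x = lab r₀} {lab d₀} (ne ∘ sym) = refl
      ... | true | no q = cong (λ s → ind ((lab i == lab d₀) ∧ s)) (sym (cl i (⇒on₂ oi p q)))
      Bφ : ∀ d → B (φ d) ≡ B d
      Bφ d with on d in od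
      ... | true  = cong₂ _∧_ (trans (φ-on d) od) (cong (_== lab d₀) (φ-lab d od))
      ... | false = cong (_∧ (lab (φ d) == lab d₀)) (trans (φ-on d) od)
      total : sum F ≡ sum G
      total = trans (sym (sum-perm F φ ψ φψ ψφ)) (sum-cong λ d → cong₂ (λ b s → ind (b ∧ S s)) (Bφ d) (φ-tl d))

    module Merge {f′ : ℕ} (lab′ : Fin M → Fin (suc f′)) (ne : lab′ d₀ ≢ lab′ r₀)
      (du : ∀ (S : Fin (suc f′) → Bool) → (∀ d → on d ≡ true → S (lab′ (rev d)) ≡ S (lab′ d)) → ∀ α β → S α ≡ S β) where

      h = mergeF (lab′ d₀) (lab′ r₀) ne

      du′ : ∀ (S : Fin f′ → Bool) → (∀ d → on₂ d ≡ true → S (h (lab′ (rev d))) ≡ S (h (lab′ d))) → ∀ α β → S α ≡ S β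
      du′ S cl α β with mergeF-surj (lab′ d₀) (lab′ r₀) ne α | mergeF-surj (lab′ d₀) (lab′ r₀) ne β
      ... | x , refl | y , refl = du (S ∘ h) cl′ x y
        where
        cl′ : ∀ d → on d ≡ true → S (h (lab′ (rev d))) ≡ S (h (lab′ d))
        cl′ d p = case d ≟ d₀ of λ where
          (yes refl) → cong S (sym (mergeF-eq _ _ ne))
          (no q) → case d ≟ r₀ of λ where
            (yes refl) → trans (cong (S ∘ h ∘ lab′) (rev² d₀)) (cong S (mergeF-eq _ _ ne))
            (no r) → cl d (⇒on₂ p q r)

    -- One edge and one face disappear together, and the roots still suffice because the edge is not
    -- a bridge.
    mergeCase : lab d₀ ≢ lab r₀ → Result
    mergeCase ne with f | lab | dual | build | euler | notBridge
    ... | zero | lab′ | _ | _ | _ | _ = ⊥-elim (noFin (lab′ d₀))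
      where noFin : ¬ Fin 0
            noFin ()
    ... | suc f′ | lab′ | du | bu | eu | nb =
      bu (Merge.h lab′ ne du) (mergeF-eq _ _ ne) (Merge.du′ lab′ ne du) root (λ S cl → hit S (close S cl (nb ne S cl)))
         (farkas (# on₂ ∷ # root ∷ # alive ∷ f′ ∷ []) ((1 *[ cst 2 ⊕ x₀ ⊕ (cst 2 ⊕ 2 ⊗ x₁) ≼ 2 ⊗ x₂ ⊕ 2 ⊗ (cst 1 ⊕ x₃) ]) ∷ [])
            (subst (λ n → n + (2 + 2 * # root) ≤ 2 * # alive + 2 * suc f′) #on₂ eu ∷ []) 0 (x₀ ⊕ (cst 2 ⊕ 2 ⊗ x₁)) (2 ⊗ x₂ ⊕ 2 ⊗ x₃) refl)

    -- A witness that deleting the edge cuts the tail off from all roots; a `Subset` is used because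
    -- these can be searched.
    Lost : Subset N → Set
    Lost s = (∀ d → on₂ d ≡ true → lookup s (hd d) ≡ lookup s (tl d)) × lookup s (tl d₀) ≡ true × lookup s (hd d₀) ≡ false
             × (∀ r → root r ≡ true → lookup s r ≡ false)

    lost? : ∀ s → Dec (Lost s)
    lost? s = all? (λ d → imp? (on₂ d ≟ᵇ true) (lookup s (hd d) ≟ᵇ lookup s (tl d))) ×-dec ((lookup s (tl d₀) ≟ᵇ true) ×-dec ((lookup s (hd d₀) ≟ᵇ false)
      ×-dec all? λ r → imp? (root r ≟ᵇ true) (lookup s r ≟ᵇ false)))
      where
      imp? : ∀ {a b} {X : Set a} {Y : Set b} → Dec X → Dec Y → Dec (X → Y)
      imp? (no ¬x) _      = yes λ x → ⊥-elim (¬x x)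
      imp? (yes x) (yes y) = yes λ _ → y
      imp? (yes x) (no ¬y) = no λ k → ¬y (k x)

    -- Deleting an edge with the same face on both sides may disconnect one of its ends from all roots, but never both.
    newRoot : ∃[ u ] (∀ S → Closed₂ S → ∀ x → alive x ≡ true → S x ≡ true → ∃[ r ] (root r ∨ (r == u) ≡ true × S r ≡ true))
    newRoot with anySubset? lost?
    ... | yes (s , cls , su , sv , nr) = tl d₀ , ht
      where
      ht : ∀ S → Closed₂ S → ∀ x → alive x ≡ true → S x ≡ true → ∃[ r ] (root r ∨ (r == tl d₀) ≡ true × S r ≡ true)
      ht S cl x ax Sx with S (tl d₀) in Su | S (hd d₀) in Sv
      ... | true | _ = tl d₀ , ∨-introʳ {root (tl d₀)} (≡⇒== refl) , Su
      ... | false | false with hit S (close S cl (trans Sv (sym Su))) x ax Sx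
      ... | r , rr , Sr = r , ∨-introˡ rr , Sr
      -- `s` holds the tail and `S` the head, so their union is closed in the old map and meets a
      -- root; `s` contains none, so the root lies in `S`.
      ht S cl x ax Sx | false | true with hit (λ y → lookup s y ∨ S y) (close (λ y → lookup s y ∨ S y) (λ d p → cong₂ _∨_ (cls d p) (cl d p))
          (trans (∨-introʳ {lookup s (hd d₀)} Sv) (sym (∨-introˡ {b = S (tl d₀)} su)))) x ax (∨-introʳ {lookup s x} Sx)
      ... | r , rr , Sr with ∨-elim {lookup s r} Sr
      ... | inj₁ q = ⊥-elim (true≢false q (nr r rr))
      ... | inj₂ q = r , ∨-introˡ rr , q
    ... | no none = hd d₀ , ht
      where
      ht : ∀ S → Closed₂ S → ∀ x → alive x ≡ true → S x ≡ true → ∃[ r ] (root r ∨ (r == hd d₀) ≡ true × S r ≡ true)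
      ht S cl x ax Sx with S (hd d₀) in Sv | S (tl d₀) in Su
      ... | true | _ = hd d₀ , ∨-introʳ {root (hd d₀)} (≡⇒== refl) , Sv
      ... | false | false with hit S (close S cl (trans Sv (sym Su))) x ax Sx
      ... | r , rr , Sr = r , ∨-introˡ rr , Sr
      ht S cl x ax Sx | false | true with any? (λ r → (root r ≟ᵇ true) ×-dec (S r ≟ᵇ true))
      ... | yes (r , rr , Sr) = r , ∨-introˡ rr , Sr
      ... | no nr = ⊥-elim (none (tabulate S , (λ d p → trans (lookup∘tabulate S _) (trans (cl d p) (sym (lookup∘tabulate S _)))) ,
                      trans (lookup∘tabulate S _) Su , trans (lookup∘tabulate S _) Sv ,
                      λ r rr → trans (lookup∘tabulate S r) (≢true λ Sr → nr (r , rr , Sr))))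

    -- The number of faces stays, and the lost edge pays for the possible new root.
    splitCase : lab d₀ ≡ lab r₀ → Result
    splitCase e with newRoot
    ... | u , ht = build id e du (λ r → root r ∨ (r == u)) ht
        (farkas (# on₂ ∷ # root ∷ # (λ r → root r ∨ (r == u)) ∷ # alive ∷ f ∷ [])
          ((1 *[ cst 2 ⊕ x₀ ⊕ (cst 2 ⊕ 2 ⊗ x₁) ≼ 2 ⊗ x₃ ⊕ 2 ⊗ x₄ ]) ∷ (2 *[ x₂ ≼ cst 1 ⊕ x₁ ]) ∷ [])
          (subst (λ n → n + (2 + 2 * # root) ≤ 2 * # alive + 2 * f) #on₂ euler ∷ #-add≤ root u ∷ []) 0
          (x₀ ⊕ (cst 2 ⊕ 2 ⊗ x₂)) (2 ⊗ x₃ ⊕ 2 ⊗ x₄) refl)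
      where
      du : ∀ (S : Fin f → Bool) → (∀ d → on₂ d ≡ true → S (lab (rev d)) ≡ S (lab d)) → ∀ α β → S α ≡ S β
      du S cl = dual S λ d p → case d ≟ d₀ of λ where
        (yes refl) → cong S (sym e)
        (no q) → case d ≟ r₀ of λ where
          (yes refl) → trans (cong (S ∘ lab) (rev² d₀)) (cong S e)
          (no r) → cl d (⇒on₂ p q r)

    result : Result
    result = case lab d₀ ≟ lab r₀ of λ where
      (yes e) → splitCase e
      (no ne) → mergeCase ne

-- Chords, induced submaps, and the sparsity of simple plane maps.

module Surgery {N M : ℕ} (𝔻 : Darts N M) where

  open PlaneMaps 𝔻

  record Chorded (P : PMap) (a b g : Fin M) (T : Fin M → Bool) : Set where
    no-eta-equality
    open PMap P
    field
      P′     : PMap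
      alive′ : ∀ x → PMap.alive P′ x ≡ alive x
      on-o   : ∀ {d} → on d ≡ true → PMap.on P′ d ≡ true
      on-g   : PMap.on P′ g ≡ true
      on-rg  : PMap.on P′ (rev g) ≡ true
      on⇒    : ∀ {d} → PMap.on P′ d ≡ true → on d ≡ true ⊎ (d ≡ g ⊎ d ≡ rev g)
      nx-g′  : PMap.nx P′ g ≡ a
      nx-rg′ : PMap.nx P′ (rev g) ≡ b
      nx-a′  : ∀ d → nx d ≡ a → PMap.nx P′ d ≡ g
      nx-b′  : ∀ d → nx d ≡ b → PMap.nx P′ d ≡ rev g
      nx-o′  : ∀ d → on d ≡ true → nx d ≢ a → nx d ≢ b → PMap.nx P′ d ≡ nx d
      lab-o  : ∀ d e → on d ≡ true → on e ≡ true → T d ≡ false → T e ≡ false → lab d ≡ lab e → PMap.lab P′ d ≡ PMap.lab P′ e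

  -- A chord g is drawn through a face, just before the dart a at its tail and just before
  -- the dart b at its head; T is the arc of the face from a to b.
  module Chord (P : PMap) (a b g : Fin M)
    (oa : PMap.on P a ≡ true) (ob : PMap.on P b ≡ true) (og : PMap.on P g ≡ false)
    (tab : tl a ≢ tl b) (tg : tl g ≡ tl a) (hg : hd g ≡ tl b)
    (T : Fin M → Bool) (Ta : T a ≡ true) (Tb : T b ≡ false)
    (Tψa : T (PMap.ψ P a) ≡ false) (Tψb : T (PMap.ψ P b) ≡ true)
    (T-lab : ∀ d → PMap.on P d ≡ true → T d ≡ true → PMap.lab P d ≡ PMap.lab P a)
    (lab-b : PMap.lab P b ≡ PMap.lab P a)
    (T-φ : ∀ d → PMap.on P d ≡ true → PMap.φ P d ≢ a → PMap.φ P d ≢ b → T (PMap.φ P d) ≡ T d) where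
    open PMap P

    rg = rev g

    org : on rg ≡ false
    org = trans (on-rev g) og

    g≢rg : g ≢ rg
    g≢rg e = tab (trans (sym tg) (trans (cong tl e) hg))

    on≢ : ∀ {x y} → on x ≡ true → on y ≡ false → x ≢ y
    on≢ p q refl = true≢false p q

    a≢b : a ≢ b
    a≢b e = tab (cong tl e)

    on₁ on₂ : Fin M → Bool
    on₁ d = on d ∨ (d == g)
    on₂ d = on₁ d ∨ (d == rg)

    rot₁ : Rot on₁
    rot₁ = ins rot g a og oa tg

    on₁rg : on₁ rg ≡ false
    on₁rg rewrite org = ≢⇒== (g≢rg ∘ sym)

    rot₂ : Rot on₂
    rot₂ = ins rot₁ rg b on₁rg (∨-introˡ ob) hg

    nx₂ = Rot.nx rot₂

    nx-g : nx₂ g ≡ a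
    nx-g = trans (cong (sw rg b) (trans (cong (sw g a) (nx-off g og)) (sw-l g a))) (sw-o (on≢ oa org) a≢b)

    nx-rg : nx₂ rg ≡ b
    nx-rg = trans (cong (sw rg b) (trans (cong (sw g a) (nx-off rg org)) (sw-o (g≢rg ∘ sym) (on≢ oa org ∘ sym)))) (sw-l rg b)

    nx-a : ∀ d → nx d ≡ a → nx₂ d ≡ g
    nx-a d e = trans (cong (sw rg b) (trans (cong (sw g a) e) (sw-r g a))) (sw-o g≢rg (on≢ ob og ∘ sym))

    nx-b : ∀ d → nx d ≡ b → nx₂ d ≡ rg
    nx-b d e = trans (cong (sw rg b) (trans (cong (sw g a) e) (sw-o (on≢ ob og) (a≢b ∘ sym)))) (sw-r rg b)

    nx-o : ∀ d → on d ≡ true → nx d ≢ a → nx d ≢ b → nx₂ d ≡ nx d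
    nx-o d o p q = trans (cong (sw rg b) (sw-o (on≢ (trans (nx-on d) o) og) p)) (sw-o (on≢ (trans (nx-on d) o) org) q)

    on₂⇒ : ∀ {d} → on₂ d ≡ true → on d ≡ true ⊎ (d ≡ g ⊎ d ≡ rg)
    on₂⇒ {d} p with ∨-elim {on₁ d} p
    ... | inj₂ q = inj₂ (inj₂ (==⇒≡ q))
    ... | inj₁ q with ∨-elim {on d} q
    ... | inj₁ r = inj₁ r
    ... | inj₂ r = inj₂ (inj₁ (==⇒≡ r))

    on₂o : ∀ {d} → on d ≡ true → on₂ d ≡ true
    on₂o p = ∨-introˡ (∨-introˡ p)
    on₂g : on₂ g ≡ true
    on₂g = ∨-introˡ (∨-introʳ {on g} (≡⇒== refl))
    on₂rg : on₂ rg ≡ true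
    on₂rg = ∨-introʳ {on₁ rg} (≡⇒== refl)

    on₂-rev′ : ∀ d → on₂ d ≡ true → on₂ (rev d) ≡ true
    on₂-rev′ d p with on₂⇒ p
    ... | inj₁ o = on₂o (trans (on-rev d) o)
    ... | inj₂ (inj₁ refl) = on₂rg
    ... | inj₂ (inj₂ refl) = subst (λ x → on₂ x ≡ true) (sym (rev² g)) on₂g

    -- The arc `T` together with `rg` bounds the new face `zero`; `g` and the rest of the old face
    -- keep their label.
    lab₂ : Fin M → Fin (suc f)
    lab₂ d = if d == g then suc (lab a) else if d == rg then zero else if T d then zero else suc (lab d)

    lab-g : lab₂ g ≡ suc (lab a)
    lab-g rewrite ≡⇒== {x = g} refl = refl
    lab-rg : lab₂ rg ≡ zero
    lab-rg rewrite ≢⇒== {x = rg} {g} (g≢rg ∘ sym) | ≡⇒== {x = rg} refl = refl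
    lab-T : ∀ {d} → on d ≡ true → T d ≡ true → lab₂ d ≡ zero
    lab-T o t rewrite ≢⇒== (on≢ o og) | ≢⇒== (on≢ o org) | t = refl
    lab-F : ∀ {d} → on d ≡ true → T d ≡ false → lab₂ d ≡ suc (lab d)
    lab-F o t rewrite ≢⇒== (on≢ o og) | ≢⇒== (on≢ o org) | t = refl
    lab-cong : ∀ {d e} → on d ≡ true → on e ≡ true → T d ≡ T e → lab d ≡ lab e → lab₂ d ≡ lab₂ e
    lab-cong {d} {e} o o′ t l = case bdec (T e) of λ where
      (inj₁ te) → trans (lab-T o (trans t te)) (sym (lab-T o′ te))
      (inj₂ te) → trans (lab-F o (trans t te)) (trans (cong suc l) (sym (lab-F o′ te)))

    corner₂ : ∀ d → on₂ d ≡ true → lab₂ (nx₂ d) ≡ lab₂ (rev d)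
    corner₂ d p with on₂⇒ p
    ... | inj₂ (inj₁ refl) = trans (cong lab₂ nx-g) (trans (lab-T oa Ta) (sym lab-rg))
    ... | inj₂ (inj₂ refl) = trans (cong lab₂ nx-rg) (trans (lab-F ob Tb) (trans (cong suc lab-b) (trans (sym lab-g) (cong lab₂ (sym (rev² g))))))
    ... | inj₁ o = case nx d ≟ a of λ where
      (yes e) → trans (cong lab₂ (nx-a d e)) (trans lab-g (trans (cong suc (trans (cong lab (sym e)) (corner d o)))
                  (sym (lab-F or (trans (cong T (cong rev (trans (sym (pvnx d)) (cong pv e)))) Tψa)))))
      (no p₁) → case nx d ≟ b of λ where
        (yes e) → trans (cong lab₂ (nx-b d e)) (trans lab-rg (sym (lab-T or (trans (cong T (cong rev (trans (sym (pvnx d)) (cong pv e)))) Tψb))))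
        (no p₂) → trans (cong lab₂ (nx-o d o p₁ p₂)) (lab-cong (trans (nx-on d) o) or
                    (trans (cong T (sym eq)) (T-φ (rev d) or (λ e → p₁ (trans (sym eq) e)) (λ e → p₂ (trans (sym eq) e)))) (corner d o))
     where
      or = trans (on-rev d) o
      eq : nx (rev (rev d)) ≡ nx d
      eq = cong nx (rev² d)

    dual₂ : ∀ (S : Fin (suc f) → Bool) → (∀ d → on₂ d ≡ true → S (lab₂ (rev d)) ≡ S (lab₂ d)) → ∀ α β → S α ≡ S β
    dual₂ S cl α β = trans (all α) (sym (all β))
      where
      S0 : S zero ≡ S (suc (lab a))
      S0 = trans (cong S (sym lab-rg)) (trans (cl g on₂g) (cong S lab-g))
      val : ∀ d → on d ≡ true → S (lab₂ d) ≡ S (suc (lab d))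
      val d o = case bdec (T d) of λ where
        (inj₁ t) → trans (cong S (lab-T o t)) (trans S0 (cong (S ∘ suc) (sym (T-lab d o t))))
        (inj₂ t) → cong S (lab-F o t)
      old : ∀ α β → S (suc α) ≡ S (suc β)
      old = dual (S ∘ suc) λ d o → trans (sym (val (rev d) (trans (on-rev d) o))) (trans (cl d (on₂o o)) (val d o))
      all : ∀ α → S α ≡ S zero
      all zero = refl
      all (suc α) = trans (old α (lab a)) (sym S0)

    #on₂ : # on₂ ≡ 2 + # on
    #on₂ = trans (#-add on₁ rg on₁rg) (cong suc (#-add on g og))

    chordMap : PMap
    chordMap = record
      { on = on₂
      ; on-rev = λ d → bool-ext (λ p → subst (λ x → on₂ x ≡ true) (rev² d) (on₂-rev′ (rev d) p)) (on₂-rev′ d)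
      ; alive = alive
      ; on-alive = λ d p → on-al d (on₂⇒ p)
      ; loopless = λ d p → ll d (on₂⇒ p)
      ; rot = rot₂ ; lab = lab₂ ; corner = corner₂ ; dual = dual₂ ; root = root
      ; hit = λ S cl → hit S λ d o → cl d (on₂o o)
      ; euler = farkas (# on₂ ∷ # on ∷ # root ∷ # alive ∷ f ∷ [])
          ((1 *[ x₀ ≼ cst 2 ⊕ x₁ ]) ∷ (1 *[ x₁ ⊕ (cst 2 ⊕ 2 ⊗ x₂) ≼ 2 ⊗ x₃ ⊕ 2 ⊗ x₄ ]) ∷ [])
          (≤-reflexive #on₂ ∷ euler ∷ []) 0 (x₀ ⊕ (cst 2 ⊕ 2 ⊗ x₂)) (2 ⊗ x₃ ⊕ 2 ⊗ (cst 1 ⊕ x₄)) refl }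
      where
      on-al : ∀ d → on d ≡ true ⊎ (d ≡ g ⊎ d ≡ rg) → alive (tl d) ≡ true
      on-al d (inj₁ o) = on-alive d o
      on-al d (inj₂ (inj₁ refl)) = trans (cong alive tg) (on-alive a oa)
      on-al d (inj₂ (inj₂ refl)) = trans (cong alive hg) (on-alive b ob)
      ll : ∀ d → on d ≡ true ⊎ (d ≡ g ⊎ d ≡ rg) → tl d ≢ hd d
      ll d (inj₁ o) = loopless d o
      ll d (inj₂ (inj₁ refl)) e = tab (trans (sym tg) (trans e hg))
      ll d (inj₂ (inj₂ refl)) e = tab (trans (trans (sym tg) (cong tl (sym (rev² g)))) (trans (sym e) hg))

    opaque
      chorded : Chorded P a b g T
      chorded = record
        { P′ = chordMap ; alive′ = λ _ → refl ; on-o = on₂o ; on-g = on₂g ; on-rg = on₂rg ; on⇒ = on₂⇒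
        ; nx-g′ = nx-g ; nx-rg′ = nx-rg ; nx-a′ = nx-a ; nx-b′ = nx-b ; nx-o′ = nx-o
        ; lab-o = λ d e od oe td te eq → trans (lab-F od td) (trans (cong suc eq) (sym (lab-F oe te))) }

  -- The chord joins the far ends of two consecutive edges at a vertex and cuts off a triangle, so
  -- the arc consists of `rev d` and `nx d` only.
  module Corner (P : PMap) (d : Fin M) (o : PMap.on P d ≡ true) (ne : hd d ≢ hd (PMap.nx P d))
    (off : PMap.on P (fr (hd d) (hd (PMap.nx P d))) ≡ false) where
    open PMap P

    d₂ = nx d
    o₂ : on d₂ ≡ true
    o₂ = trans (nx-on d) o
    or : on (rev d) ≡ true
    or = trans (on-rev d) o
    or₂ : on (rev d₂) ≡ true
    or₂ = trans (on-rev d₂) o₂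
    T : Fin M → Bool
    T e = (e == rev d) ∨ (e == d₂)
    b = nx (rev d₂)
    tb : tl b ≡ hd d₂
    tb = nx-tl (rev d₂)
    t₂ : tl d₂ ≡ tl d
    t₂ = nx-tl d

    T-no : ∀ {e} → e ≢ rev d → e ≢ d₂ → T e ≡ false
    T-no p q rewrite ≢⇒== p | ≢⇒== q = refl
    T₁ : ∀ {e} → e ≡ rev d → T e ≡ true
    T₁ {e} p = ∨-introˡ {e == rev d} (≡⇒== p)
    T₂ : ∀ {e} → e ≡ d₂ → T e ≡ true
    T₂ {e} p = ∨-introʳ {e == rev d} (≡⇒== p)

    Tlab : ∀ e → (e == rev d) ≡ true ⊎ (e == d₂) ≡ true → lab e ≡ lab (rev d)
    Tlab e (inj₁ p) = cong lab (==⇒≡ p)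
    Tlab e (inj₂ p) = trans (cong lab (==⇒≡ p)) (corner d o)
    Tφ : ∀ e → on e ≡ true → φ e ≢ rev d → φ e ≢ b → T (φ e) ≡ T e
    Tφ e _ p q = case e ≟ rev d of λ where
      (yes refl) → trans (T₂ (cong nx (rev² d))) (sym (T₁ refl))
      (no r) → case e ≟ d₂ of λ where
        (yes refl) → ⊥-elim (q refl)
        (no s) → trans (T-no p (λ h → r (trans (sym (rev² e)) (cong rev (nx-inj h))))) (sym (T-no r s))

    module C = Chord P (rev d) b (fr (hd d) (hd d₂)) or (trans (nx-on (rev d₂)) or₂) off
      (λ e → ne (trans e tb)) (tl-fr _ _) (trans (cong tl (rev-fr _ _)) (trans (tl-fr _ _) (sym tb)))
      T (T₁ refl) (T-no (λ e → ne (trans (cong tl (sym e)) tb)) (λ e → loopless d₂ o₂ (trans (cong tl (sym e)) tb)))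
      (T-no (λ e → loopless d o (trans (cong tl (sym (rev-inj e))) (pv-tl (rev d)))) (λ e → ne (trans (sym (pv-tl (rev d))) (trans (cong tl (sym (rev² (pv (rev d))))) (cong (tl ∘ rev) e)))))
      (T₂ (trans (cong rev (pvnx (rev d₂))) (rev² d₂)))
      (λ e _ t → Tlab e (∨-elim {e == rev d} t))
      (trans (φ-lab d₂ o₂) (corner d o))
      Tφ

    open C public using (chordMap)

  module _ (P : PMap) (w : Fin N) (aw : PMap.alive P w ≡ true) (iso : ∀ d → PMap.on P d ≡ true → tl d ≢ w) where
    open PMap P

    private
      iso′ : ∀ d → on d ≡ true → hd d ≢ w
      iso′ d o = iso (rev d) (trans (on-rev d) o)

      rootw : root w ≡ true
      rootw with hit (_== w) (λ d o → trans (≢⇒== (iso′ d o)) (sym (≢⇒== (iso d o)))) w aw (≡⇒== refl)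
      ... | r , rr , e rewrite ==⇒≡ e = rr

    -- The singleton `w` is closed, so `w` is a root; a vertex and a root leave both sides of
    -- Euler's inequality together.
    dropIsolated : PMap
    dropIsolated = record
      { on = on ; on-rev = on-rev ; alive = λ x → alive x ∧ not (x == w)
      ; on-alive = λ d o → ∧-intro (on-alive d o) (not-intro (≢⇒== (iso d o)))
      ; loopless = loopless ; rot = rot ; lab = lab ; corner = corner ; dual = dual
      ; root = λ x → root x ∧ not (x == w)
      ; hit = ht
      ; euler = farkas (# on ∷ # root ∷ # alive ∷ # (λ x → root x ∧ not (x == w)) ∷ # (λ x → alive x ∧ not (x == w)) ∷ f ∷ [])
          ((1 *[ x₀ ⊕ (cst 2 ⊕ 2 ⊗ x₁) ≼ 2 ⊗ x₂ ⊕ 2 ⊗ x₅ ]) ∷ (2 *[ cst 1 ⊕ x₃ ≼ x₁ ]) ∷ (2 *[ x₂ ≼ cst 1 ⊕ x₄ ]) ∷ [])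
          (euler ∷ ≤-reflexive (sym (#-remove root w rootw)) ∷ ≤-reflexive (#-remove alive w aw) ∷ []) 0
          (x₀ ⊕ (cst 2 ⊕ 2 ⊗ x₃)) (2 ⊗ x₄ ⊕ 2 ⊗ x₅) refl }
      where
      ht : ∀ S → Closed S → ∀ x → alive x ∧ not (x == w) ≡ true → S x ≡ true → ∃[ r ] (root r ∧ not (r == w) ≡ true × S r ≡ true)
      ht S cl x ax Sx with hit (λ y → S y ∧ not (y == w)) (λ d o → cong₂ _∧_ (cl d o) (cong not (trans (≢⇒== (iso′ d o)) (sym (≢⇒== (iso d o))))))
                             x (proj₁ (∧-elim ax)) (∧-intro Sx (proj₂ (∧-elim {alive x} ax)))
      ... | r , rr , Sr = r , ∧-intro rr (proj₂ (∧-elim {S r} Sr)) , proj₁ (∧-elim Sr)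

  record EdgesDeleted (P : PMap) (Q : Fin M → Bool) : Set where
    no-eta-equality
    open PMap
    field
      P′     : PMap
      on′    : ∀ d → on P′ d ≡ on P d ∧ not (Q d)
      alive′ : ∀ x → alive P′ x ≡ alive P x
      nx′    : ∀ x → (∀ d → on P d ≡ true → tl d ≡ x → Q d ≡ false) → ∀ d → tl d ≡ x → nx P′ d ≡ nx P d

  deleteEdges : ∀ k (P : PMap) (Q : Fin M → Bool) → (∀ d → Q (rev d) ≡ Q d) → # (λ d → PMap.on P d ∧ Q d) ≤ k → EdgesDeleted P Q
  deleteEdges k P Q Qr le with any? (λ d → (PMap.on P d ≟ᵇ true) ×-dec (Q d ≟ᵇ true))
  ... | no none = record { P′ = P ; on′ = λ d → same d (PMap.on P d) refl ; alive′ = λ _ → refl ; nx′ = λ _ _ _ _ → refl }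
    where
    same : ∀ d b → PMap.on P d ≡ b → b ≡ b ∧ not (Q d)
    same d false e = refl
    same d true e = sym (not-intro (≢true λ q → none (d , e , q)))
  deleteEdges zero P Q Qr le | yes (d₀ , o , q) = ⊥-elim (1+n≰n (≤-trans (#-pos _ d₀ (∧-intro o q)) le))
  deleteEdges (suc k) P Q Qr le | yes (d₀ , o , q) = record
    { P′ = I.P′
    ; on′ = λ d → trans (I.on′ d) (trans (cong (_∧ not (Q d)) (D.onₘ d)) (sh d))
    ; alive′ = λ x → trans (I.alive′ x) (D.aliveₘ x)
    ; nx′ = λ x h d t → trans (I.nx′ x (λ e oe te → h e (proj₁ (Deletion.on₂⇒ P d₀ o (trans (sym (D.onₘ e)) oe))) te) d t)
              (D.nxₘ d (λ e → true≢false q (h d₀ o (trans (sym e) t))) (λ e → true≢false (trans (Qr d₀) q) (h (rev d₀) (trans (PMap.on-rev P d₀) o) (trans (sym e) t)))) }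
    where
    module D = Deletion.Result (Deletion.result P d₀ o)
    fewer : # (λ d → PMap.on D.map′ₘ d ∧ Q d) ≤ k
    fewer = s≤s⁻¹ (≤-trans (≤-trans (s≤s (#-mono λ d p →
        let (a , b , _) = Deletion.on₂⇒ P d₀ o (trans (sym (D.onₘ d)) (proj₁ (∧-elim p)))
        in ∧-intro (∧-intro a (proj₂ (∧-elim {PMap.on D.map′ₘ d} p))) (not-intro (≢⇒== b))))
      (≤-reflexive (sym (#-remove (λ d → PMap.on P d ∧ Q d) d₀ (∧-intro o q))))) le)
    module I = EdgesDeleted (deleteEdges k D.map′ₘ Q Qr fewer)
    sh : ∀ d → Deletion.on₂ P d₀ o d ∧ not (Q d) ≡ PMap.on P d ∧ not (Q d)
    sh d = bool-ext
      (λ p → ∧-intro (proj₁ (Deletion.on₂⇒ P d₀ o (proj₁ (∧-elim p)))) (proj₂ (∧-elim {Deletion.on₂ P d₀ o d} p)))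
      (λ p → let nq = not-elim (proj₂ (∧-elim {PMap.on P d} p)) in
         ∧-intro (Deletion.⇒on₂ P d₀ o (proj₁ (∧-elim p)) (λ { refl → true≢false q nq }) (λ { refl → true≢false (trans (Qr d₀) q) nq })) (not-intro nq))

  opaque
    deleteAll : ∀ P (Q : Fin M → Bool) → (∀ d → Q (rev d) ≡ Q d) → EdgesDeleted P Q
    deleteAll P Q Qr = deleteEdges M P Q Qr (#≤n _)

  record VerticesDropped (P : PMap) (W : Fin N → Bool) : Set where
    no-eta-equality
    open PMap
    field
      P′     : PMap
      on′    : ∀ d → on P′ d ≡ on P d
      alive′ : ∀ x → alive P′ x ≡ alive P x ∧ W x
      nx′    : ∀ d → nx P′ d ≡ nx P d

  dropVertices : ∀ k (P : PMap) W → (∀ d → PMap.on P d ≡ true → W (tl d) ≡ true) → # (λ x → PMap.alive P x ∧ not (W x)) ≤ k → VerticesDropped P W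
  dropVertices k P W h le with any? (λ x → (PMap.alive P x ≟ᵇ true) ×-dec (W x ≟ᵇ false))
  ... | no none = record { P′ = P ; on′ = λ _ → refl ; alive′ = λ x → same x (PMap.alive P x) refl ; nx′ = λ _ → refl }
    where
    same : ∀ x b → PMap.alive P x ≡ b → b ≡ b ∧ W x
    same x false e = refl
    same x true e with W x in w
    ... | true = refl
    ... | false = ⊥-elim (none (x , e , w))
  dropVertices zero P W h le | yes (w , aw , q) = ⊥-elim (1+n≰n (≤-trans (#-pos _ w (∧-intro aw (not-intro q))) le))
  dropVertices (suc k) P W h le | yes (w , aw , q) = record
    { P′ = I.P′ ; on′ = I.on′ ; alive′ = λ x → trans (I.alive′ x) (sh x) ; nx′ = I.nx′ }
    where
    D = dropIsolated P w aw λ d o e → true≢false (trans (cong W (sym e)) (h d o)) q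
    fewer : # (λ x → PMap.alive D x ∧ not (W x)) ≤ k
    fewer = s≤s⁻¹ (≤-trans (≤-trans (s≤s (#-mono λ x p →
        let (a , b) = ∧-elim {PMap.alive P x} (proj₁ (∧-elim p)) in ∧-intro (∧-intro a (proj₂ (∧-elim {PMap.alive D x} p))) b))
      (≤-reflexive (sym (#-remove (λ x → PMap.alive P x ∧ not (W x)) w (∧-intro aw (not-intro q)))))) le)
    module I = VerticesDropped (dropVertices k D W h fewer)
    sh : ∀ x → (PMap.alive P x ∧ not (x == w)) ∧ W x ≡ PMap.alive P x ∧ W x
    sh x = bool-ext (λ p → ∧-intro (proj₁ (∧-elim (proj₁ (∧-elim p)))) (proj₂ (∧-elim {PMap.alive P x ∧ not (x == w)} p)))
      (λ p → let wx = proj₂ (∧-elim {PMap.alive P x} p) in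
         ∧-intro (∧-intro (proj₁ (∧-elim {PMap.alive P x} p)) (not-intro (≢⇒== λ { refl → true≢false wx q }))) wx)

  opaque
    dropAll : ∀ P W → (∀ d → PMap.on P d ≡ true → W (tl d) ≡ true) → VerticesDropped P W
    dropAll P W h = dropVertices N P W h (#≤n _)

  -- `nx′` says that the rotation survives at a vertex that loses no neighbour; the 4-cycles around
  -- the vertices of C are kept by it.
  record Restricted (P : PMap) (W : Fin N → Bool) : Set where
    no-eta-equality
    open PMap
    field
      P′     : PMap
      on′    : ∀ d → on P′ d ≡ on P d ∧ (W (tl d) ∧ W (hd d))
      alive′ : ∀ x → alive P′ x ≡ alive P x ∧ W x
      nx′    : ∀ x → W x ≡ true → (∀ d → on P d ≡ true → tl d ≡ x → W (hd d) ≡ true) → ∀ d → tl d ≡ x → nx P′ d ≡ nx P d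

  opaque
    restrict : ∀ P W → Restricted P W
    restrict P W = record
      { P′ = V.P′ ; on′ = λ d → trans (V.on′ d) (on″ d) ; alive′ = λ x → trans (V.alive′ x) (cong (_∧ W x) (E.alive′ x))
      ; nx′ = λ x wx h d t → trans (V.nx′ d) (E.nx′ x (λ e oe te → cong not (∧-intro (trans (cong W te) wx) (h e oe te))) d t) }
      where
      Q : Fin M → Bool
      Q d = not (W (tl d) ∧ W (hd d))
      Q-rev : ∀ d → Q (rev d) ≡ Q d
      Q-rev d = cong not (trans (cong (λ x → W (hd d) ∧ W (tl x)) (rev² d)) (∧-comm (W (hd d)) (W (tl d))))
      module E = EdgesDeleted (deleteAll P Q Q-rev)
      on″ : ∀ d → PMap.on E.P′ d ≡ PMap.on P d ∧ (W (tl d) ∧ W (hd d))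
      on″ d = trans (E.on′ d) (cong (PMap.on P d ∧_) (nn (W (tl d) ∧ W (hd d))))
        where nn : ∀ b → not (not b) ≡ b
              nn true = refl
              nn false = refl
      module V = VerticesDropped (dropAll E.P′ W (λ d o → proj₁ (∧-elim {W (tl d)} (proj₂ (∧-elim {PMap.on P d} (trans (sym (on″ d)) o))))))

  module Faces (P : PMap) (simple : ∀ d d′ → PMap.on P d ≡ true → PMap.on P d′ ≡ true → tl d ≡ tl d′ → hd d ≡ hd d′ → d ≡ d′) where
    open PMap P

    Len : Fin f → ℕ
    Len α = # (λ d → on d ∧ (lab d == α))

    ΣLen : sum Len ≡ # on
    ΣLen = #-fibre on lab

    φ-≢ : ∀ d → on d ≡ true → d ≢ φ d
    φ-≢ d o e = loopless d o (trans (cong tl e) (φ-tl d))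

    -- If `d` has `α` on one side only, then `d`, `φ d`, `φ (φ d)` are distinct: a 2-orbit would
    -- force `φ d` to be `rev d` by simplicity. If no dart is of this kind, connectedness of the
    -- dual makes `α` the only label, and it carries all darts.
    Len≥3 : 3 ≤ # on → ∀ α → 3 ≤ Len α
    Len≥3 on≥3 α with any? (λ d → (on d ≟ᵇ true) ×-dec ((lab d ≟ α) ×-dec ¬? (lab (rev d) ≟ α)))
    ... | yes (d , o , l , l′) = #-distinct _ (d ∷ φ d ∷ φ (φ d) ∷ [])
        ((φ-≢ d o ∷ ne ∷ []) ∷ (φ-≢ (φ d) o₁ ∷ []) ∷ [] ∷ [])
        (∧-intro o (≡⇒== l) ∷ ∧-intro o₁ (≡⇒== l₁) ∷ ∧-intro (trans (φ-on (φ d)) o₁) (≡⇒== (trans (φ-lab (φ d) o₁) l₁)) ∷ [])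
      where
      o₁ = trans (φ-on d) o
      l₁ = trans (φ-lab d o) l
      ne : d ≢ φ (φ d)
      ne e = l′ (trans (cong lab (sym (simple (φ d) (rev d) o₁ (trans (on-rev d) o) (φ-tl d)
               (trans (sym (φ-tl (φ d))) (trans (cong tl (sym e)) (cong tl (sym (rev² d)))))))) l₁)
    ... | no none = ≤-trans on≥3 (≤-reflexive (#-cong λ d → lem d (on d)))
      where
      half : ∀ d → on d ≡ true → lab d ≡ α → lab (rev d) ≡ α
      half d o l with lab (rev d) ≟ α
      ... | yes p = p
      ... | no p = ⊥-elim (none (d , o , l , p))
      const : ∀ β γ → (β == α) ≡ (γ == α)
      const = dual (_== α) λ d o → bool-ext (λ e → ≡⇒== (trans (cong lab (sym (rev² d))) (half (rev d) (trans (on-rev d) o) (==⇒≡ e))))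
                                            (λ e → ≡⇒== (half d o (==⇒≡ e)))
      lem : ∀ d b → b ≡ b ∧ (lab d == α)
      lem d false = refl
      lem d true = sym (trans (const (lab d) α) (≡⇒== refl))

    root≥1 : 1 ≤ # on → 1 ≤ # root
    root≥1 h with any? (λ d → on d ≟ᵇ true)
    ... | yes (d , o) = let (r , rr , _) = hit (λ _ → true) (λ _ _ → refl) (tl d) (on-alive d o) refl in #-pos root r rr
    ... | no none = ⊥-elim (1+n≰n (≤-trans h (≤-reflexive (#-empty λ d → ≢true λ o → none (d , o)))))

    -- The classical bound of 3n - 6 edges, doubled because darts are counted.
    sparse : 3 ≤ # on → # on + 12 ≤ 6 * # alive
    sparse h = farkas (# on ∷ # root ∷ # alive ∷ f ∷ [])
      ((3 *[ x₀ ⊕ (cst 2 ⊕ 2 ⊗ x₁) ≼ 2 ⊗ x₂ ⊕ 2 ⊗ x₃ ]) ∷ (6 *[ cst 1 ≼ x₁ ]) ∷ (2 *[ 3 ⊗ x₃ ≼ x₀ ]) ∷ [])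
      (euler ∷ root≥1 (≤-trans (s≤s z≤n) h) ∷ ≤-trans (≤-reflexive (sym (sum-const {f} 3))) (≤-trans (sum-mono (Len≥3 h)) (≤-reflexive ΣLen)) ∷ [])
      0 (x₀ ⊕ cst 12) (6 ⊗ x₂) refl

  module _ (P : PMap) (simple : ∀ d d′ → PMap.on P d ≡ true → PMap.on P d′ ≡ true → tl d ≡ tl d′ → hd d ≡ hd d′ → d ≡ d′) where
    open PMap P

    sparseOn : ∀ W → 3 ≤ # (λ x → alive x ∧ W x) → # (λ d → on d ∧ (W (tl d) ∧ W (hd d))) + 12 ≤ 6 * # (λ x → alive x ∧ W x)
    sparseOn W h with 3 ≤? # (λ d → on d ∧ (W (tl d) ∧ W (hd d)))
    -- At most two darts and at least three vertices: 2 + 12 ≤ 6 · 3.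
    ... | no few = ≤-trans (+-monoˡ-≤ 12 (s≤s⁻¹ (≰⇒> few))) (≤-trans (m≤m+n 14 4) (*-monoʳ-≤ 6 h))
    ... | yes many = subst₂ (λ a b → a + 12 ≤ 6 * b) (#-cong R.on′) (#-cong R.alive′) (Faces.sparse R.P′ simple′ (subst (3 ≤_) (sym (#-cong R.on′)) many))
      where
      module R = Restricted (restrict P W)
      simple′ : ∀ d d′ → PMap.on R.P′ d ≡ true → PMap.on R.P′ d′ ≡ true → tl d ≡ tl d′ → hd d ≡ hd d′ → d ≡ d′
      simple′ d d′ o o′ = simple d d′ (proj₁ (∧-elim (trans (sym (R.on′ d)) o))) (proj₁ (∧-elim (trans (sym (R.on′ d′)) o′)))

-- Reduction to vertices of C of degree 4 surrounded by 4-cycles.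

module Normalise {N M : ℕ} (𝔻 : Darts N M) where

  open PlaneMaps 𝔻
  open Surgery 𝔻

  Simple : PMap → Set
  Simple P = ∀ d d′ → on d ≡ true → on d′ ≡ true → tl d ≡ tl d′ → hd d ≡ hd d′ → d ≡ d′
    where open PMap P

  module Local (P : PMap) where
    open PMap P

    deg : Fin N → ℕ
    deg x = # (λ d → on d ∧ (tl d == x))

    -- If `nx` returned to `d` after at most two steps, `d` and `nx d` would form an invariant set
    -- and thus include every dart at the vertex, against `d′`.
    around : ∀ d d′ → on d ≡ true → on d′ ≡ true → tl d′ ≡ tl d → d′ ≢ d → d′ ≢ nx d → Distinct (d ∷ nx d ∷ pv d ∷ [])
    around d d′ o o′ t p q = (d≢nx ∷ d≢pv ∷ []) ∷ (nx≢pv ∷ []) ∷ [] ∷ []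
      where
      S : Fin M → Bool
      S x = (x == d) ∨ (x == nx d)
      S∌ : S d′ ≡ false
      S∌ rewrite ≢⇒== p | ≢⇒== q = refl
      period : nx (nx d) ≡ d → ⊥
      period e = true≢false (trans (rotc S cl d′ d o′ o t) (∨-introˡ {d == d} (≡⇒== refl))) S∌
        where
        cl : ∀ x → S (nx x) ≡ S x
        cl x = bool-ext
          (λ s → case ∨-elim {nx x == d} s of λ where
            (inj₁ u) → ∨-introʳ {x == d} (≡⇒== (nx-inj (trans (==⇒≡ u) (sym e))))
            (inj₂ u) → ∨-introˡ {x == d} (≡⇒== (nx-inj (==⇒≡ u))))
          (λ s → case ∨-elim {x == d} s of λ where
            (inj₁ u) → ∨-introʳ {nx x == d} (≡⇒== (cong nx (==⇒≡ u)))
            (inj₂ u) → ∨-introˡ {nx x == d} (≡⇒== (trans (cong nx (==⇒≡ u)) e)))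
      d≢nx : d ≢ nx d
      d≢nx e = period (trans (cong nx (sym e)) (sym e))
      d≢pv : d ≢ pv d
      d≢pv e = d≢nx (trans (sym (nxpv d)) (cong nx (sym e)))
      nx≢pv : nx d ≢ pv d
      nx≢pv e = period (trans (cong nx e) (nxpv d))

    fourth : ∀ d d′ → on d ≡ true → on d′ ≡ true → tl d′ ≡ tl d → d′ ≢ d → d′ ≢ nx d → d′ ≢ pv d → 4 ≤ deg (tl d)
    fourth d d′ o o′ t p q r = #-distinct _ (d′ ∷ d ∷ nx d ∷ pv d ∷ []) ((p ∷ q ∷ r ∷ []) ∷ around d d′ o o′ t p q)
      (∧-intro o′ (≡⇒== t) ∷ ∧-intro o (≡⇒== refl) ∷ ∧-intro (trans (nx-on d) o) (≡⇒== (nx-tl d)) ∷ ∧-intro (trans (pv-on d) o) (≡⇒== (pv-tl d)) ∷ [])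

    fifth : ∀ d d′ d″ → on d ≡ true → on d′ ≡ true → on d″ ≡ true → tl d′ ≡ tl d → tl d″ ≡ tl d →
            d′ ≢ d → d′ ≢ nx d → d′ ≢ pv d → d″ ≢ d → d″ ≢ nx d → d″ ≢ pv d → d′ ≢ d″ → 5 ≤ deg (tl d)
    fifth d d′ d″ o o′ o″ t t″ p q r p″ q″ r″ ne =
      #-distinct _ (d″ ∷ d′ ∷ d ∷ nx d ∷ pv d ∷ []) (((ne ∘ sym) ∷ p″ ∷ q″ ∷ r″ ∷ []) ∷ (p ∷ q ∷ r ∷ []) ∷ around d d′ o o′ t p q)
      (∧-intro o″ (≡⇒== t″) ∷ ∧-intro o′ (≡⇒== t) ∷ ∧-intro o (≡⇒== refl) ∷ ∧-intro (trans (nx-on d) o) (≡⇒== (nx-tl d)) ∷ ∧-intro (trans (pv-on d) o) (≡⇒== (pv-tl d)) ∷ [])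

  BoundedC : PMap → (Fin N → Bool) → Set
  BoundedC P U = ∀ w → U w ≡ false → AtMost 4 (λ u → U u ≡ true × PMap.A P w u)

  -- The vertices outside U play the role of C.
  record Normal (P : PMap) (U : Fin N → Bool) : Set where
    no-eta-equality
    open PMap P
    field
      U-alive : ∀ x → U x ≡ true → alive x ≡ true
      simple  : Simple P
      noCC    : ∀ d → on d ≡ true → U (tl d) ≡ false → U (hd d) ≡ true
      deg4    : ∀ w → alive w ≡ true → U w ≡ false → # (λ d → on d ∧ (tl d == w)) ≡ 4
      closed  : ∀ d → on d ≡ true → U (tl d) ≡ false → hd d ≡ hd (nx d) ⊎ A (hd d) (hd (nx d))

  -- `keepA` and `keepR` make two-reachability grow, which `Elim-mono` asks for; `keepS` preserves a
  -- separation of two vertices of K.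
  record NormOf (P : PMap) (U : Fin N → Bool) : Set where
    no-eta-equality
    field
      P*     : PMap
      normal : Normal P* U
      keepA  : ∀ u v → U u ≡ true → U v ≡ true → PMap.A P u v → PMap.A P* u v
      keepR  : ∀ u v w → U u ≡ true → U v ≡ true → u ≢ v → U w ≡ false → PMap.A P w u → PMap.A P w v →
               PMap.A P* u v ⊎ ∃[ w′ ] (U w′ ≡ false × PMap.A P* w′ u × PMap.A P* w′ v)
      keepS  : ∀ S → PMap.Closed P S → PMap.Closed P* S

  record Thinned (P : PMap) : Set where
    no-eta-equality
    field
      P′      : PMap
      on′     : ∀ d → PMap.on P′ d ≡ true → PMap.on P d ≡ true
      alive′  : ∀ x → PMap.alive P′ x ≡ PMap.alive P x
      A′      : ∀ {u v} → PMap.A P u v → PMap.A P′ u v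
      simple′ : Simple P′

  thin : ∀ k P → # (PMap.on P) ≤ k → Thinned P
  thin k P le with any? (λ d → any? λ d′ → (PMap.on P d ≟ᵇ true) ×-dec ((PMap.on P d′ ≟ᵇ true) ×-dec ((tl d ≟ tl d′) ×-dec ((hd d ≟ hd d′) ×-dec ¬? (d ≟ d′)))))
  ... | no none = record { P′ = P ; on′ = λ _ o → o ; alive′ = λ _ → refl ; A′ = λ a → a ; simple′ = λ d d′ o o′ t h → case d ≟ d′ of λ where
      (yes e) → e
      (no ne) → ⊥-elim (none (d , d′ , o , o′ , t , h , ne)) }
  thin zero P le | yes (d , d′ , o , _) = ⊥-elim (1+n≰n (≤-trans (#-pos _ d o) le))
  thin (suc k) P le | yes (d , d′ , o , o′ , t , h , ne) = record
    { P′ = I.P′ ; on′ = λ e p → proj₁ (D.on₂⇒ (trans (sym (R.onₘ e)) (I.on′ e p))) ; alive′ = λ x → trans (I.alive′ x) (R.aliveₘ x)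
    ; A′ = λ a → I.A′ (keep a) ; simple′ = I.simple′ }
    where
    open PMap P
    module D = Deletion P d o
    module R = D.Result D.result
    module I = Thinned (thin k R.map′ₘ (s≤s⁻¹ (≤-trans (≤-trans (≤-reflexive (cong suc (#-cong R.onₘ))) (≤-trans (n≤1+n _) (≤-reflexive (sym D.#on₂)))) le)))
    or′ : on (rev d′) ≡ true
    or′ = trans (on-rev d′) o′
    d′≢r : d′ ≢ rev d
    d′≢r e = loopless d o (trans t (cong tl e))
    keep : ∀ {u v} → A u v → PMap.A R.map′ₘ u v
    keep (e , oe , te , he) = case e ≟ d of λ where
      (yes refl) → d′ , trans (R.onₘ d′) (D.⇒on₂ o′ (ne ∘ sym) d′≢r) , trans (sym t) te , trans (sym h) he
      (no p) → case e ≟ rev d of λ where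
        (yes refl) → rev d′ , trans (R.onₘ (rev d′)) (D.⇒on₂ or′ (λ q → d′≢r (trans (sym (rev² d′)) (cong rev q))) (λ q → ne (sym (rev-inj q))))
                    , trans (sym h) te , trans (cong tl (rev² d′)) (trans (sym t) (trans (cong tl (sym (rev² d))) he))
        (no q) → e , trans (R.onₘ e) (D.⇒on₂ oe p q) , te , he

  opaque
    thinned : ∀ P → Thinned P
    thinned P = thin M P (#≤n _)

  record Cornered (P : PMap) (U : Fin N → Bool) : Set where
    no-eta-equality
    field
      P′      : PMap
      alive′  : ∀ x → PMap.alive P′ x ≡ PMap.alive P x
      onC′    : ∀ d → PMap.on P′ d ≡ true → U (tl d) ≡ false → PMap.on P d ≡ true
      A′      : ∀ {u v} → PMap.A P u v → PMap.A P′ u v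
      keepS′  : ∀ S → PMap.Closed P S → PMap.Closed P′ S
      simple′ : Simple P′
      noCC′   : ∀ d → PMap.on P′ d ≡ true → U (tl d) ≡ false → U (hd d) ≡ true
      closed′ : ∀ d → PMap.on P′ d ≡ true → U (tl d) ≡ false → hd d ≡ hd (PMap.nx P′ d) ⊎ PMap.A P′ (hd d) (hd (PMap.nx P′ d))

  -- Every chord switches on a spare dart, so the number of absent darts bounds the process. If the
  -- spare dart is already present, its ends are adjacent and no chord is due.
  closeCorners : ∀ k P U → Simple P → (∀ d → PMap.on P d ≡ true → U (tl d) ≡ false → U (hd d) ≡ true) →
                 # (λ d → not (PMap.on P d)) ≤ k → Cornered P U
  closeCorners k P U si nc le with any? (λ d → (PMap.on P d ≟ᵇ true) ×-dec ((U (tl d) ≟ᵇ false) ×-dec (¬? (hd d ≟ hd (PMap.nx P d)) ×-dec ¬? (PMap.A? P (hd d) (hd (PMap.nx P d))))))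
  ... | no none = record { P′ = P ; alive′ = λ _ → refl ; onC′ = λ _ o _ → o ; A′ = λ a → a ; keepS′ = λ _ c → c ; simple′ = si ; noCC′ = nc
    ; closed′ = λ d o u → case hd d ≟ hd (PMap.nx P d) of λ where
        (yes e) → inj₁ e
        (no p) → case PMap.A? P (hd d) (hd (PMap.nx P d)) of λ where
          (yes a) → inj₂ a
          (no q) → ⊥-elim (none (d , o , u , p , q)) }
  closeCorners k P U si nc le | yes (d , o , u , p , q) with PMap.on P (fr (hd d) (hd (PMap.nx P d))) in off
  ... | true = ⊥-elim (q (fr (hd d) (hd (PMap.nx P d)) , off , tl-fr _ _ , trans (cong tl (rev-fr _ _)) (tl-fr _ _)))
  closeCorners zero P U si nc le | yes (d , o , u , p , q) | false = ⊥-elim (1+n≰n (≤-trans (#-pos _ (fr (hd d) (hd (PMap.nx P d))) (not-intro off)) le))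
  closeCorners (suc k) P U si nc le | yes (d , o , u , p , q) | false = record
    { P′ = I.P′ ; alive′ = I.alive′ ; onC′ = λ e oe ue → onC e (I.onC′ e oe ue) ue ; A′ = λ (e , oe , te , he) → I.A′ (e , C.on₂o oe , te , he)
    ; keepS′ = λ S cl → I.keepS′ S (keepS S cl) ; simple′ = I.simple′ ; noCC′ = I.noCC′ ; closed′ = I.closed′ }
    where
    open PMap P
    open Corner P d o p off
    x = hd d
    y = hd d₂
    g = fr x y
    hg : hd g ≡ y
    hg = trans (cong tl (rev-fr x y)) (tl-fr y x)
    Ux : U x ≡ true
    Ux = nc d o u
    Uy : U y ≡ true
    Uy = nc d₂ o₂ (trans (cong U t₂) u)
    onC : ∀ e → C.on₂ e ≡ true → U (tl e) ≡ false → on e ≡ true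
    onC e oe ue with C.on₂⇒ oe
    ... | inj₁ r = r
    ... | inj₂ (inj₁ refl) = ⊥-elim (true≢false (trans (cong U (tl-fr x y)) Ux) ue)
    ... | inj₂ (inj₂ refl) = ⊥-elim (true≢false (trans (cong U hg) Uy) ue)
    nc₂ : ∀ e → C.on₂ e ≡ true → U (tl e) ≡ false → U (hd e) ≡ true
    nc₂ e oe ue = nc e (onC e oe ue) ue
    noxy : ∀ e → on e ≡ true → tl e ≡ x → hd e ≡ y → ⊥
    noxy e oe te he = q (e , oe , te , he)
    noyx : ∀ e → on e ≡ true → tl e ≡ y → hd e ≡ x → ⊥
    noyx e oe te he = q (A-sym (e , oe , te , he))
    hrg : hd (rev g) ≡ x
    hrg = trans (cong tl (rev² g)) (tl-fr x y)
    si₂ : Simple chordMap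
    si₂ e e′ oe oe′ t h with C.on₂⇒ oe | C.on₂⇒ oe′
    ... | inj₁ a | inj₁ b = si e e′ a b t h
    ... | inj₁ a | inj₂ (inj₁ refl) = ⊥-elim (noxy e a (trans t (tl-fr x y)) (trans h hg))
    ... | inj₁ a | inj₂ (inj₂ refl) = ⊥-elim (noyx e a (trans t hg) (trans h hrg))
    ... | inj₂ (inj₁ refl) | inj₁ b = ⊥-elim (noxy e′ b (trans (sym t) (tl-fr x y)) (trans (sym h) hg))
    ... | inj₂ (inj₂ refl) | inj₁ b = ⊥-elim (noyx e′ b (trans (sym t) hg) (trans (sym h) hrg))
    ... | inj₂ (inj₁ refl) | inj₂ (inj₁ refl) = refl
    ... | inj₂ (inj₂ refl) | inj₂ (inj₂ refl) = refl
    ... | inj₂ (inj₁ refl) | inj₂ (inj₂ refl) = ⊥-elim (p (trans (sym (tl-fr x y)) (trans t hg)))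
    ... | inj₂ (inj₂ refl) | inj₂ (inj₁ refl) = ⊥-elim (p (trans (sym (tl-fr x y)) (trans (sym t) hg)))
    keepS : ∀ S → Closed S → PMap.Closed chordMap S
    keepS S cl e oe with C.on₂⇒ oe
    ... | inj₁ a = cl e a
    ... | inj₂ (inj₁ refl) = trans (cong S hg) (trans yx (cong S (sym (tl-fr x y))))
      where yx : S y ≡ S x
            yx = trans (cl d₂ o₂) (trans (cong S t₂) (sym (cl d o)))
    ... | inj₂ (inj₂ refl) = trans (cong S hrg) (trans xy (cong S (sym hg)))
      where xy : S x ≡ S y
            xy = sym (trans (cl d₂ o₂) (trans (cong S t₂) (sym (cl d o))))
    fewer : # (λ e → not (C.on₂ e)) ≤ k
    fewer = s≤s⁻¹ (≤-trans (s≤s (#-mono λ e h → lem e (not-elim h))) (≤-trans (≤-reflexive (sym (#-remove (λ e → not (on e)) g (not-intro off)))) le))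
      where
      lem : ∀ e → C.on₂ e ≡ false → not (on e) ∧ not (e == g) ≡ true
      lem e h = ∧-intro (not-intro (≢true λ oe → true≢false (C.on₂o oe) h)) (not-intro (≢⇒== λ { refl → true≢false C.on₂g h }))
    module I = Cornered (closeCorners k chordMap U si₂ nc₂ fewer)

  opaque
    cornered : ∀ P U → Simple P → (∀ d → PMap.on P d ≡ true → U (tl d) ≡ false → U (hd d) ≡ true) → Cornered P U
    cornered P U si nc = closeCorners M P U si nc (#≤n _)

  -- Edges inside C go first, so that every corner at C has both far ends in U; then parallel edges
  -- are thinned, which turns the bound on neighbours into a bound on degrees; then corners are
  -- closed; finally vertices of C of degree other than 4 are dropped.
  normalise : ∀ P U → (∀ x → U x ≡ true → PMap.alive P x ≡ true) → BoundedC P U → NormOf P U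
  normalise P U Ual bd = record
    { P* = R.P′
    ; normal = record { U-alive = λ x u → trans (R.alive′ x) (∧-intro (trans (K.alive′ x) (trans (T.alive′ x) (trans (E.alive′ x) (Ual x u)))) (∨-introˡ u))
        ; simple = λ d d′ o o′ → K.simple′ d d′ (o₂ d o) (o₂ d′ o′)
        ; noCC = λ d o → K.noCC′ d (o₂ d o)
        ; deg4 = d4
        ; closed = cl }
    ; keepA = λ u v Uu Uv a → toR Uu Uv (K.A′ (T.A′ (toE (inj₁ Uu) a)))
    ; keepR = kR
    ; keepS = λ S cl d o → K.keepS′ S (λ e oe → cl e (o₀ e (T.on′ e oe))) d (o₂ d o) }
    where
    Q : Fin M → Bool
    Q d = not (U (tl d)) ∧ not (U (hd d))
    Q-rev : ∀ d → Q (rev d) ≡ Q d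
    Q-rev d = trans (cong (λ z → not (U (hd d)) ∧ not (U (tl z))) (rev² d)) (∧-comm (not (U (hd d))) (not (U (tl d))))
    module E = EdgesDeleted (deleteAll P Q Q-rev)
    module T = Thinned (thinned E.P′)
    o₀ : ∀ d → PMap.on E.P′ d ≡ true → PMap.on P d ≡ true
    o₀ d o = proj₁ (∧-elim (trans (sym (E.on′ d)) o))
    nc : ∀ d → PMap.on T.P′ d ≡ true → U (tl d) ≡ false → U (hd d) ≡ true
    nc d o u = case bdec (U (hd d)) of λ where
      (inj₁ t) → t
      (inj₂ f) → ⊥-elim (true≢false (∧-intro (not-intro u) (not-intro f)) (not-elim (proj₂ (∧-elim {PMap.on P d} (trans (sym (E.on′ d)) (T.on′ d o))))))
    module K = Cornered (cornered T.P′ U T.simple′ nc)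
    P₂ = K.P′
    module L₂ = Local P₂
    W : Fin N → Bool
    W x = U x ∨ (L₂.deg x ≡ᵇ 4)
    module R = Restricted (restrict P₂ W)
    o₂ : ∀ d → PMap.on R.P′ d ≡ true → PMap.on P₂ d ≡ true
    o₂ d o = proj₁ (∧-elim (trans (sym (R.on′ d)) o))
    toE : ∀ {u v} → U u ≡ true ⊎ U v ≡ true → PMap.A P u v → PMap.A E.P′ u v
    toE h (d , o , t , k) = d , trans (E.on′ d) (∧-intro o (not-intro (≢true λ q → nope h (∧-elim {not (U (tl d))} q)))) , t , k
      where
      nope : U _ ≡ true ⊎ U _ ≡ true → not (U (tl d)) ≡ true × not (U (hd d)) ≡ true → ⊥
      nope (inj₁ a) (b , _) = true≢false (trans (cong U t) a) (not-elim b)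
      nope (inj₂ a) (_ , b) = true≢false (trans (cong U k) a) (not-elim b)
    toRW : ∀ {u v} → W u ≡ true → W v ≡ true → PMap.A P₂ u v → PMap.A R.P′ u v
    toRW a b (d , o , t , h) = d , trans (R.on′ d) (∧-intro o (∧-intro (trans (cong W t) a) (trans (cong W h) b))) , t , h
    toR : ∀ {u v} → U u ≡ true → U v ≡ true → PMap.A P₂ u v → PMap.A R.P′ u v
    toR a b = toRW (∨-introˡ a) (∨-introˡ b)
    ≡ᵇ⇒ : ∀ m n → (m ≡ᵇ n) ≡ true → m ≡ n
    ≡ᵇ⇒ m n e = ≡ᵇ⇒≡ m n (subst True (sym e) tt)
    ⇒≡ᵇ : ∀ m → (m ≡ᵇ m) ≡ true
    ⇒≡ᵇ zero = refl
    ⇒≡ᵇ (suc m) = ⇒≡ᵇ m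
    Ww : ∀ w → U w ≡ false → W w ≡ true → L₂.deg w ≡ 4
    Ww w u h with ∨-elim {U w} h
    ... | inj₁ t = ⊥-elim (true≢false t u)
    ... | inj₂ t = ≡ᵇ⇒ _ 4 t
    d4 : ∀ w → PMap.alive R.P′ w ≡ true → U w ≡ false → # (λ d → PMap.on R.P′ d ∧ (tl d == w)) ≡ 4
    d4 w a u = trans (#-cong λ d → bool-ext
        (λ p → ∧-intro (o₂ d (proj₁ (∧-elim p))) (proj₂ (∧-elim {PMap.on R.P′ d} p)))
        (λ p → let o = proj₁ (∧-elim p) ; t = proj₂ (∧-elim {PMap.on P₂ d} p) in
           ∧-intro (trans (R.on′ d) (∧-intro o (∧-intro (trans (cong W (==⇒≡ t)) wW) (∨-introˡ (K.noCC′ d o (trans (cong U (==⇒≡ t)) u)))))) t))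
      (Ww w u wW)
      where
      wW : W w ≡ true
      wW = proj₂ (∧-elim {PMap.alive P₂ w} (trans (sym (R.alive′ w)) a))
    cl : ∀ d → PMap.on R.P′ d ≡ true → U (tl d) ≡ false → hd d ≡ hd (PMap.nx R.P′ d) ⊎ PMap.A R.P′ (hd d) (hd (PMap.nx R.P′ d))
    cl d o u with R.nx′ (tl d) (proj₁ (∧-elim {W (tl d)} (proj₂ (∧-elim {PMap.on P₂ d} (trans (sym (R.on′ d)) o)))))
                    (λ e oe te → ∨-introˡ (K.noCC′ e oe (trans (cong U te) u))) d refl | K.closed′ d (o₂ d o) u
    ... | e | inj₁ h = inj₁ (trans h (cong hd (sym e)))
    ... | e | inj₂ a = inj₂ (subst (λ z → PMap.A R.P′ (hd d) (hd z)) (sym e)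
          (toR (K.noCC′ d (o₂ d o) u) (K.noCC′ (PMap.nx P₂ d) (trans (PMap.nx-on P₂ d) (o₂ d o)) (trans (cong U (PMap.nx-tl P₂ d)) u)) a))
    deg≤4 : ∀ w → U w ≡ false → L₂.deg w ≤ 4
    deg≤4 w u = ≤-trans (#-inj (λ d → PMap.on P₂ d ∧ (tl d == w)) hd (proj₁ (bd w u)) inj cov) (proj₁ (proj₂ (bd w u)))
      where
      inj : ∀ i j → PMap.on P₂ i ∧ (tl i == w) ≡ true → PMap.on P₂ j ∧ (tl j == w) ≡ true → hd i ≡ hd j → i ≡ j
      inj i j p q h = K.simple′ i j (proj₁ (∧-elim p)) (proj₁ (∧-elim q)) (trans (==⇒≡ (proj₂ (∧-elim {PMap.on P₂ i} p))) (sym (==⇒≡ (proj₂ (∧-elim {PMap.on P₂ j} q))))) h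
      cov : ∀ i → PMap.on P₂ i ∧ (tl i == w) ≡ true → hd i ∈ˡ proj₁ (bd w u)
      cov i p with ==⇒≡ (proj₂ (∧-elim {PMap.on P₂ i} p))
      ... | refl = proj₂ (proj₂ (bd w u)) (hd i) (K.noCC′ i (proj₁ (∧-elim p)) u , i , o₀ i (T.on′ i (K.onC′ i (proj₁ (∧-elim p)) u)) , refl , refl)
    -- With at most three darts at `w`, any two are consecutive and their corner is closed; thus `w`
    -- adds nothing beyond adjacency.
    triangle : ∀ w → U w ≡ false → L₂.deg w ≢ 4 → ∀ u v → u ≢ v → PMap.A P₂ w u → PMap.A P₂ w v → PMap.A P₂ u v
    triangle w uw d≢4 u v ne (d , o , refl , refl) (d′ , o′ , t′ , refl) = case d′ ≟ nx d of λ where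
        (yes refl) → case K.closed′ d o uw of λ where
          (inj₁ e) → ⊥-elim (ne e)
          (inj₂ a) → a
        (no p) → case d′ ≟ pv d of λ where
          (yes refl) → case K.closed′ (pv d) o′ (trans (cong U t′) uw) of λ where
            (inj₁ e) → ⊥-elim (ne (sym (trans e (cong hd (nxpv d)))))
            (inj₂ a) → A-sym (subst (A (hd (pv d))) (cong hd (nxpv d)) a)
          (no q) → ⊥-elim (d≢4 (≤-antisym (deg≤4 w uw) (L₂.fourth d d′ o o′ t′ (λ e → ne (cong hd (sym e))) p q)))
      where open PMap P₂
    kR : ∀ u v w → U u ≡ true → U v ≡ true → u ≢ v → U w ≡ false → PMap.A P w u → PMap.A P w v →
         PMap.A R.P′ u v ⊎ ∃[ w′ ] (U w′ ≡ false × PMap.A R.P′ w′ u × PMap.A R.P′ w′ v)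
    kR u v w Uu Uv ne uw a b = case bdec (L₂.deg w ≡ᵇ 4) of λ where
        (inj₁ e) → inj₂ (w , uw , toRW (∨-introʳ {U w} e) (∨-introˡ Uu) a₂ , toRW (∨-introʳ {U w} e) (∨-introˡ Uv) b₂)
        (inj₂ e) → inj₁ (toR Uu Uv (triangle w uw (λ q → true≢false (trans (cong (_≡ᵇ 4) q) refl) e) u v ne a₂ b₂))
      where
      a₂ = K.A′ (T.A′ (toE (inj₂ Uu) a))
      b₂ = K.A′ (T.A′ (toE (inj₂ Uv) b))

-- Counts of darts at a vertex, and Euler's formula as a charge.

module Degrees {N M : ℕ} (𝔻 : Darts N M) (P : PlaneMaps.PMap 𝔻) (U : Fin N → Bool) (nm : Normalise.Normal 𝔻 P U) where

  open PlaneMaps 𝔻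
  open Surgery 𝔻
  open Normalise 𝔻
  open PMap P public
  open Normal nm public
  open Local P public
  open Faces P simple public

  cnt : (Fin M → Bool) → Fin N → ℕ
  cnt Q x = # (λ d → (on d ∧ Q d) ∧ (tl d == x))

  cnt⇒ : ∀ {Q : Fin M → Bool} {x d} → (on d ∧ Q d) ∧ (tl d == x) ≡ true → on d ≡ true × Q d ≡ true × tl d ≡ x
  cnt⇒ {Q} {x} {d} p with ∧-elim {on d ∧ Q d} p
  ... | a , b with ∧-elim {on d} a
  ... | c , e = c , e , ==⇒≡ b

  ⇒cnt : ∀ {Q : Fin M → Bool} {x d} → on d ≡ true → Q d ≡ true → tl d ≡ x → (on d ∧ Q d) ∧ (tl d == x) ≡ true
  ⇒cnt a b c = ∧-intro (∧-intro a b) (≡⇒== c)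

  cnt-mono : ∀ {Q R} x → (∀ d → on d ≡ true → tl d ≡ x → Q d ≡ true → R d ≡ true) → cnt Q x ≤ cnt R x
  cnt-mono {Q} {R} x h = #-mono λ d p → let (a , b , c) = cnt⇒ {Q} p in ⇒cnt {R} a (h d a c b) c

  cnt-cover : ∀ Q R S x → (∀ d → on d ≡ true → tl d ≡ x → Q d ≡ true → R d ≡ true ⊎ S d ≡ true) → cnt Q x ≤ cnt R x + cnt S x
  cnt-cover Q R S x h = #-cover _ _ _ λ d p → let (a , b , c) = cnt⇒ {Q} p in
    [ (λ r → inj₁ (⇒cnt {R} a r c)) , (λ s → inj₂ (⇒cnt {S} a s c)) ] (h d a c b)

  cnt-disjoint : ∀ Q R S x → (∀ d → on d ≡ true → tl d ≡ x → R d ≡ true → Q d ≡ true) → (∀ d → on d ≡ true → tl d ≡ x → S d ≡ true → Q d ≡ true) →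
                 (∀ d → R d ≡ true → S d ≡ false) → cnt R x + cnt S x ≤ cnt Q x
  cnt-disjoint Q R S x r s rs = #-disjoint _ _ _
    (λ d p → let (a , b , c) = cnt⇒ {R} p in ⇒cnt {Q} a (r d a c b) c)
    (λ d p → let (a , b , c) = cnt⇒ {S} p in ⇒cnt {Q} a (s d a c b) c)
    (λ d p → ≢true λ q → true≢false (proj₁ (proj₂ (cnt⇒ {S} q))) (rs d (proj₁ (proj₂ (cnt⇒ {R} p)))))

  cnt-pv : ∀ Q x → cnt (Q ∘ pv) x ≡ cnt Q x
  cnt-pv Q x = trans (#-cong λ d → cong₂ _∧_ (cong (_∧ Q (pv d)) (sym (pv-on d))) (cong (_== x) (sym (pv-tl d))))
                     (#-perm (λ d → (on d ∧ Q d) ∧ (tl d == x)) pv nx pvnx nxpv)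

  cnt-nx : ∀ Q x → cnt (Q ∘ nx) x ≡ cnt Q x
  cnt-nx Q x = trans (#-cong λ d → cong₂ _∧_ (cong (_∧ Q (nx d)) (sym (nx-on d))) (cong (_== x) (sym (nx-tl d))))
                     (#-perm (λ d → (on d ∧ Q d) ∧ (tl d == x)) nx pv nxpv pvnx)

  cnt-sum : ∀ Q W → sum (λ x → if W x then cnt Q x else 0) ≡ # (λ d → (on d ∧ Q d) ∧ W (tl d))
  cnt-sum Q W = #-fibreW (λ d → on d ∧ Q d) tl W

  -- tri d says that the corner between pv d and d lies in a triangular face.
  isU isC tri tau : Fin M → Bool
  isU d = U (hd d)
  isC d = not (U (hd d))
  tri d = Len (lab d) ≡ᵇ 3
  tau d = tri d ∧ (U (hd d) ∧ U (hd (pv d)))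

  dU dC t τ : Fin N → ℕ
  dU = cnt isU
  dC = cnt isC
  t  = cnt (not ∘ tri)
  τ  = cnt tau

  lonely : ∀ d d′ → on d ≡ true → on d′ ≡ true → tl d ≡ tl d′ → nx d ≡ d → d ≡ d′
  lonely d d′ o o′ e n = sym (==⇒≡ (trans (sym (rotc (_== d) cl d d′ o o′ e)) (≡⇒== refl)))
    where
    cl : ∀ x → (nx x == d) ≡ (x == d)
    cl x = bool-ext (λ p → ≡⇒== (nx-inj (trans (==⇒≡ p) (sym n)))) (λ p → ≡⇒== (trans (cong nx (==⇒≡ p)) n))

  nx≢pv : ∀ d → on d ≡ true → 3 ≤ deg (tl d) → Distinct (d ∷ nx d ∷ pv d ∷ [])
  nx≢pv d o h with any? (λ e → (on e ≟ᵇ true) ×-dec ((tl e ≟ tl d) ×-dec (¬? (e ≟ d) ×-dec ¬? (e ≟ nx d))))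
  ... | yes (e , oe , te , p , q) = around d e o oe te p q
  ... | no none = ⊥-elim (1+n≰n (≤-trans h (#-inj _ id (d ∷ nx d ∷ []) (λ _ _ _ _ e → e) λ e p →
        let oe , te = ∧-elim {on e} p in locate e oe (==⇒≡ te))))
    where
    locate : ∀ e → on e ≡ true → tl e ≡ tl d → e ∈ˡ (d ∷ nx d ∷ [])
    locate e oe te = case e ≟ d of λ where
      (yes p) → here p
      (no p) → case e ≟ nx d of λ where
        (yes q) → there (here q)
        (no q) → ⊥-elim (none (e , oe , te , p , q))

  tri⇒ : ∀ d → tri d ≡ true → Len (lab d) ≡ 3
  tri⇒ d e = ≡ᵇ⇒≡ _ 3 (subst True (sym e) tt)

  φ-inj : ∀ {d e} → φ d ≡ φ e → d ≡ e
  φ-inj {d} {e} p = trans (sym (ψφ d)) (trans (cong ψ p) (ψφ e))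

  -- A label may be a union of orbits, yet one with three darts is a genuine triangle: otherwise
  -- `φ (φ d)`, `ψ d`, `d` and `φ d` would be four darts with that label.
  φφ : ∀ d → on d ≡ true → tri d ≡ true → pv d ≢ d → φ (φ d) ≡ ψ d
  φφ d o tr ne = case φ (φ d) ≟ ψ d of λ where
      (yes e) → e
      (no p) → ⊥-elim (1+n≰n (≤-trans (#-distinct (λ x → on x ∧ (lab x == lab d)) (φ (φ d) ∷ ψ d ∷ d ∷ φ d ∷ [])
          ((p ∷ (λ e → r≢φ (sym (φ-inj (trans e (sym (φψ d)))))) ∷ (λ e → φ-≢ d o (sym (φ-inj e))) ∷ []) ∷ (r≢d ∷ r≢φ ∷ []) ∷ (φ-≢ d o ∷ []) ∷ [] ∷ [])
          (∧-intro (trans (φ-on (φ d)) o₁) (≡⇒== (trans (φ-lab (φ d) o₁) (φ-lab d o))) ∷ ∧-intro oψ (≡⇒== (trans (sym (corner (pv d) op)) (cong lab (nxpv d))))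
            ∷ ∧-intro o (≡⇒== refl) ∷ ∧-intro o₁ (≡⇒== (φ-lab d o)) ∷ []))
          (≤-reflexive (tri⇒ d tr))))
    where
    o₁ = trans (φ-on d) o
    op = trans (pv-on d) o
    oψ = trans (on-rev (pv d)) op
    r≢d : ψ d ≢ d
    r≢d e = loopless (pv d) op (trans (pv-tl d) (cong tl (sym e)))
    r≢φ : ψ d ≢ φ d
    r≢φ e = ne (simple (pv d) d op o (pv-tl d) (trans (cong tl e) (φ-tl d)))

  third-nx : ∀ d → on d ≡ true → tri d ≡ true → pv d ≢ d → hd (nx (rev d)) ≡ hd (pv d)
  third-nx d o tr ne = trans (sym (φ-tl (φ d))) (cong tl (φφ d o tr ne))

  third : ∀ d → on d ≡ true → tri d ≡ true → pv d ≢ d → A (hd (pv d)) (hd d)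
  third d o tr ne = A-sym (φ d , trans (φ-on d) o , φ-tl d , third-nx d o tr ne)

  third-pv : ∀ e → on e ≡ true → tri (nx e) ≡ true → nx e ≢ e → hd (pv (rev e)) ≡ hd (nx e)
  third-pv e o tr ne = trans (cong hd eq) (trans (cong tl (rev² (φ (nx e)))) (φ-tl (nx e)))
    where
    ff : φ (φ (nx e)) ≡ rev e
    ff = trans (φφ (nx e) (trans (nx-on e) o) tr (λ q → ne (trans (sym q) (pvnx e)))) (cong rev (pvnx e))
    eq : pv (rev e) ≡ rev (φ (nx e))
    eq = trans (cong pv (sym ff)) (pvnx (rev (φ (nx e))))

  Cnx≢ : ∀ d → on d ≡ true → U (tl d) ≡ false → nx d ≢ d
  Cnx≢ d o u e = 1+n≰n (≤-trans (≤-trans (s≤s (s≤s z≤n)) (≤-reflexive (sym (deg4 (tl d) (on-alive d o) u))))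
    (#-unique _ λ i j p q → trans (sym (same i p)) (same j q)))
    where
    same : ∀ i → on i ∧ (tl i == tl d) ≡ true → d ≡ i
    same i p = lonely d i o (proj₁ (∧-elim p)) (sym (==⇒≡ (proj₂ (∧-elim {on i} p)))) e

  Cadj : ∀ d → on d ≡ true → U (tl d) ≡ false → A (hd d) (hd (nx d))
  Cadj d o u with closed d o u
  ... | inj₂ a = a
  ... | inj₁ e = ⊥-elim (Cnx≢ d o u (sym (simple d (nx d) o (trans (nx-on d) o) (sym (nx-tl d)) e)))

  -- The darts before and after `a` lead to neighbours of `hd a`; two further darts would give
  -- degree 5.
  Copp : ∀ a b c → on a ≡ true → on b ≡ true → on c ≡ true → U (tl a) ≡ false → tl b ≡ tl a → tl c ≡ tl a →
         b ≢ a → c ≢ a → ¬ A (hd a) (hd b) → ¬ A (hd a) (hd c) → b ≡ c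
  Copp a b c oa ob oc u tb tc b≢ c≢ nb nc = case b ≟ c of λ where
      (yes e) → e
      (no p) → ⊥-elim (1+n≰n (≤-trans (fifth a b c oa ob oc tb tc b≢ (nn b nb) (np b nb) c≢ (nn c nc) (np c nc) p) (≤-reflexive (deg4 (tl a) (on-alive a oa) u))))
    where
    nn : ∀ x → ¬ A (hd a) (hd x) → x ≢ nx a
    nn x n refl = n (Cadj a oa u)
    np : ∀ x → ¬ A (hd a) (hd x) → x ≢ pv a
    np x n refl = n (A-sym (subst (A (hd (pv a))) (cong hd (nxpv a)) (Cadj (pv a) (trans (pv-on a) oa) (trans (cong U (pv-tl a)) u))))

  -- The witness is a neighbour along the 4-cycle around the vertex of C.
  hasU : ∀ d → on d ≡ true → U (hd d) ≡ false → ∃[ e ] (on e ≡ true × tl e ≡ tl d × U (hd e) ≡ true)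
  hasU d o u = let (e , oe , te , he) = Cadj (rev d) or u in
      e , oe , trans te (cong tl (rev² d)) , trans (cong U he) (noCC (nx (rev d)) (trans (nx-on (rev d)) or) (trans (cong U (nx-tl (rev d))) u))
    where or = trans (on-rev d) o

  Upv≢ : ∀ d → on d ≡ true → U (hd d) ≡ false → pv d ≢ d
  Upv≢ d o u e with hasU d o u
  ... | e′ , oe , te , ue = true≢false ue (trans (cong (U ∘ hd) (sym (lonely d e′ o oe (sym te) (trans (cong nx (sym e)) (nxpv d))))) u)

  τ≤dU : ∀ x → τ x ≤ dU x
  τ≤dU x = cnt-mono x λ d _ _ p → proj₁ (∧-elim {U (hd d)} (proj₂ (∧-elim {tri d} p)))

  -- The dart after one into C leads to U, and then its corner is not counted by `τ`, or again into
  -- C, and then the corner is not a triangle, as C is independent.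
  τ+dC≤dU+t : ∀ x → τ x + dC x ≤ dU x + t x
  τ+dC≤dU+t x = farkas (τ x ∷ dC x ∷ dU x ∷ t x ∷ cnt X x ∷ [])
      ((1 *[ x₀ ⊕ x₄ ≼ x₂ ]) ∷ (1 *[ x₁ ≼ x₄ ⊕ x₃ ]) ∷ [])
      (cnt-disjoint isU tau X x (λ d _ _ p → proj₁ (∧-elim {U (hd d)} (proj₂ (∧-elim {tri d} p)))) (λ d _ _ p → proj₁ (∧-elim p))
          (λ d p → ≢true λ q → true≢false (proj₂ (∧-elim {U (hd d)} (proj₂ (∧-elim {tri d} p)))) (not-elim (proj₂ (∧-elim {U (hd d)} q))))
        ∷ ≤-trans (≤-reflexive (sym (cnt-pv isC x))) (cnt-cover (isC ∘ pv) X (not ∘ tri) x cov) ∷ []) 0 (x₀ ⊕ x₁) (x₂ ⊕ x₃) refl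
    where
    X : Fin M → Bool
    X d = U (hd d) ∧ not (U (hd (pv d)))
    cov : ∀ d → on d ≡ true → tl d ≡ x → isC (pv d) ≡ true → X d ≡ true ⊎ not (tri d) ≡ true
    cov d o _ p = case bdec (U (hd d)) of λ where
      (inj₁ u) → inj₁ (∧-intro u p)
      (inj₂ u) → inj₂ (not-intro (≢true λ tr → let (e , oe , te , he) = third d o tr (Upv≢ d o u) in
        true≢false (trans (sym (cong U he)) (noCC e oe (trans (cong U te) (not-elim p)))) u))

  -- A dart at the end of a non-triangular corner leads into C or is a dart into U that `τ` leaves
  -- out.
  τ+t≤dU+dC : ∀ x → τ x + t x ≤ dU x + dC x
  τ+t≤dU+dC x = farkas (τ x ∷ dC x ∷ dU x ∷ t x ∷ cnt X x ∷ [])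
      ((1 *[ x₀ ⊕ x₄ ≼ x₂ ]) ∷ (1 *[ x₃ ≼ x₄ ⊕ x₁ ]) ∷ [])
      (cnt-disjoint isU tau X x (λ d _ _ p → proj₁ (∧-elim {U (hd d)} (proj₂ (∧-elim {tri d} p)))) (λ d _ _ p → proj₁ (∧-elim p))
          (λ d p → ≢true λ q → true≢false (proj₁ (∧-elim {tri d} p)) (not-elim (proj₂ (∧-elim {U (hd d)} q))))
        ∷ cnt-cover (not ∘ tri) X isC x (λ d _ _ p → case bdec (U (hd d)) of λ where
            (inj₁ u) → inj₁ (∧-intro u p)
            (inj₂ u) → inj₂ (not-intro u)) ∷ []) 0 (x₀ ⊕ x₃) (x₂ ⊕ x₁) refl
    where
    X : Fin M → Bool
    X d = U (hd d) ∧ not (tri d)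

  deg-split : ∀ x → deg x ≡ dU x + dC x
  deg-split x = trans (#-split (λ d → on d ∧ (tl d == x)) isU) (cong₂ _+_ (#-cong λ d → sh (on d) (tl d == x) (isU d)) (#-cong λ d → sh (on d) (tl d == x) (isC d)))
    where sh : ∀ a b c → (a ∧ b) ∧ c ≡ (a ∧ c) ∧ b
          sh true  b c = ∧-comm b c
          sh false b c = refl

  module _ (big : 3 ≤ # on) where

    -- Per face of length ℓ: equality for ℓ = 3, and 12 + ℓ ≤ 4ℓ for ℓ ≥ 4, where all ℓ corners are
    -- counted.
    faces : 12 * f + # (λ d → on d ∧ not (tri d)) ≤ 4 * # on
    faces = ≤-trans (≤-reflexive (cong₂ _+_ (sym (sum-const {f} 12)) (sym (#-fibre (λ d → on d ∧ not (tri d)) lab))))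
      (≤-trans (≤-reflexive (sym (sum-+ _ _))) (≤-trans (sum-mono each) (≤-reflexive (trans (sum-* 4 Len) (cong (4 *_) ΣLen)))))
      where
      each : ∀ α → 12 + # (λ d → (on d ∧ not (tri d)) ∧ (lab d == α)) ≤ 4 * Len α
      each α with Len α in e | Len≥3 big α
      ... | suc (suc (suc zero)) | _ = ≤-reflexive (cong (12 +_) (#-empty λ d → ≢true λ p →
          let (a , b) = ∧-elim {on d ∧ not (tri d)} p in
          true≢false (cong (_≡ᵇ 3) (trans (cong Len (==⇒≡ b)) e)) (not-elim (proj₂ (∧-elim {on d} a)))))
      ... | suc (suc (suc (suc k))) | _ = farkas (# (λ d → (on d ∧ not (tri d)) ∧ (lab d == α)) ∷ k ∷ []) ((1 *[ x₀ ≼ cst 4 ⊕ x₁ ]) ∷ [])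
          (≤-trans (#-mono λ d p → let (a , b) = ∧-elim {on d ∧ not (tri d)} p in ∧-intro (proj₁ (∧-elim a)) b) (≤-reflexive e) ∷ []) 0
          (cst 12 ⊕ x₀) (4 ⊗ (cst 4 ⊕ x₁)) refl
      ... | suc (suc zero) | s≤s (s≤s ())
      ... | suc zero | s≤s ()
      ... | zero | ()

    ΣU : (Fin N → ℕ) → ℕ
    ΣU g = sum (λ x → if U x then g x else 0)

    -- A face of length ℓ ≥ 4 has 2ℓ − 6 ≥ ℓ/2 to share among its corners, and a vertex outside U needs
    -- 2 = 4 · 1/2 from its neighbours; all charges are multiplied by 8.
    charge : 8 * ΣU dU + 4 * ΣU dC + 4 * ΣU t + 48 + 48 * # root ≤ 48 * # U
    charge = farkas (ΣU dU ∷ ΣU dC ∷ ΣU t ∷ # root ∷ # U ∷ # C ∷ # on ∷ f ∷ # (λ d → on d ∧ not (tri d)) ∷ # alive ∷ [])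
      ((24 *[ x₆ ⊕ (cst 2 ⊕ 2 ⊗ x₃) ≼ 2 ⊗ x₉ ⊕ 2 ⊗ x₇ ]) ∷ (4 *[ 12 ⊗ x₇ ⊕ x₈ ≼ 4 ⊗ x₆ ]) ∷ (4 *[ x₂ ≼ x₈ ]) ∷ (8 *[ x₀ ⊕ x₁ ⊕ 4 ⊗ x₅ ≼ x₆ ])
        ∷ (4 *[ 4 ⊗ x₅ ≼ x₁ ]) ∷ (48 *[ x₉ ≼ x₄ ⊕ x₅ ]) ∷ [])
      (euler ∷ faces ∷ ≤-trans (≤-reflexive (cnt-sum (not ∘ tri) U)) (#-mono λ d p → proj₁ (∧-elim p))
        ∷ ≤-reflexive (sym on-eq) ∷ ≤-reflexive (sym C-eq) ∷ #-cover alive U C (λ x a → case bdec (U x) of λ where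
            (inj₁ u) → inj₁ u
            (inj₂ u) → inj₂ (∧-intro a (not-intro u))) ∷ [])
      0 (8 ⊗ x₀ ⊕ 4 ⊗ x₁ ⊕ 4 ⊗ x₂ ⊕ cst 48 ⊕ 48 ⊗ x₃) (48 ⊗ x₄) refl
      where
      x₈ x₉ : Lin 10
      x₈ = var (suc (suc (suc (suc (suc (suc (suc (suc zero))))))))
      x₉ = var (suc (suc (suc (suc (suc (suc (suc (suc (suc zero)))))))))
      C : Fin N → Bool
      C x = alive x ∧ not (U x)
      outC : # (λ d → on d ∧ not (U (tl d))) ≡ 4 * # C
      outC = trans (#-cong λ d → bool-ext (λ p → let (o , u) = ∧-elim {on d} p in ∧-intro o (∧-intro (on-alive d o) u))
                                          (λ p → let (o , u) = ∧-elim {on d} p in ∧-intro o (proj₂ (∧-elim {alive (tl d)} u))))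
        (trans (sym (#-fibreW on tl C)) (trans (sum-cong each) (trans (sum-* 4 (ind ∘ C)) (cong (4 *_) (sym (#-def C))))))
        where
        each : ∀ x → (if C x then deg x else 0) ≡ 4 * ind (C x)
        each x = go (C x) refl
          where
          go : ∀ b → C x ≡ b → (if b then deg x else 0) ≡ 4 * ind b
          go false e = refl
          go true e = deg4 x (proj₁ (∧-elim e)) (not-elim (proj₂ (∧-elim {alive x} e)))
      C-eq : ΣU dC ≡ 4 * # C
      C-eq = trans (cnt-sum isC U) (trans (sym (#-perm (λ d → (on d ∧ isC d) ∧ U (tl d)) rev rev rev² rev²)) (trans (#-cong λ d → bool-ext (fw d) (bw d)) outC))
        where
        fw : ∀ d → (on (rev d) ∧ isC (rev d)) ∧ U (hd d) ≡ true → on d ∧ not (U (tl d)) ≡ true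
        fw d p with ∧-elim {on (rev d)} (proj₁ (∧-elim p))
        ... | o , u = ∧-intro (trans (sym (on-rev d)) o) (trans (cong (not ∘ U ∘ tl) (sym (rev² d))) u)
        bw : ∀ d → on d ∧ not (U (tl d)) ≡ true → (on (rev d) ∧ isC (rev d)) ∧ U (hd d) ≡ true
        bw d p with ∧-elim {on d} p
        ... | o , u = ∧-intro (∧-intro (trans (on-rev d) o) (trans (cong (not ∘ U ∘ tl) (rev² d)) u)) (noCC d o (not-elim u))
      on-eq : # on ≡ ΣU dU + ΣU dC + 4 * # C
      on-eq = trans (#-split on (U ∘ tl)) (cong₂ _+_
          (trans (#-split (λ d → on d ∧ U (tl d)) isU) (cong₂ _+_
            (trans (#-cong λ d → sh (on d) (U (tl d)) (isU d)) (sym (cnt-sum isU U))) (trans (#-cong λ d → sh (on d) (U (tl d)) (isC d)) (sym (cnt-sum isC U)))))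
          outC)
        where sh : ∀ a b c → (a ∧ b) ∧ c ≡ (a ∧ c) ∧ b
              sh true  b c = ∧-comm b c
              sh false b c = refl

-- Discharging when no reduction applies.

module Discharge {N M : ℕ} (𝔻 : Darts N M) (P : PlaneMaps.PMap 𝔻) (U : Fin N → Bool) (nm : Normalise.Normal 𝔻 P U)
  (K : Fin N → Bool) (K⊆U : ∀ x → K x ≡ true → U x ≡ true) where

  open PlaneMaps 𝔻
  open Surgery 𝔻
  open Normalise 𝔻
  open Degrees 𝔻 P U nm public

  -- Vertices with charge dU + (dC + t)/2 − 6 equal to −1 or −1/2, 0, and 0.
  Small Flat Neutral : Fin N → Set
  Small x = U x ≡ true × K x ≡ false × dU x ≡ 5 × dC x + t x ≤ 1
  Flat  x = U x ≡ true × K x ≡ false × dU x ≡ 6 × dC x + t x ≡ 0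
  Neutral   x = U x ≡ true × K x ≡ false × dU x ≡ 5 × dC x + t x ≡ 2

  small? : ∀ x → Dec (Small x)
  small? x = (U x ≟ᵇ true) ×-dec ((K x ≟ᵇ false) ×-dec ((dU x ≟ℕ 5) ×-dec (dC x + t x ≤? 1)))
  flat? : ∀ x → Dec (Flat x)
  flat? x = (U x ≟ᵇ true) ×-dec ((K x ≟ᵇ false) ×-dec ((dU x ≟ℕ 6) ×-dec (dC x + t x ≟ℕ 0)))
  neutral? : ∀ x → Dec (Neutral x)
  neutral? x = (U x ≟ᵇ true) ×-dec ((K x ≟ᵇ false) ×-dec ((dU x ≟ℕ 5) ×-dec (dC x + t x ≟ℕ 2)))

  Small≢Flat : ∀ {x} → Small x → Flat x → ⊥
  Small≢Flat (_ , _ , a , _) (_ , _ , b , _) with trans (sym a) b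
  ... | ()

  -- A walk to `s` all of whose vertices before `s` are flat; it may repeat vertices and is
  -- shortened later.
  data Chain (s : Fin N) : Fin N → Set where
    base : Chain s s
    link : ∀ {b b′} → Flat b → A b b′ → Chain s b′ → Chain s b

  cnt0 : ∀ {Q x} → cnt Q x ≡ 0 → ∀ d → on d ≡ true → tl d ≡ x → Q d ≡ false
  cnt0 {Q} e d o te = ≢true λ q → 1+n≰n (≤-trans (#-pos _ d (⇒cnt {Q} o q te)) (≤-reflexive e))

  -- Both faces along the edge are triangles whose third vertices lie in U.
  good : Fin M → Bool
  good e = (tri e ∧ tri (nx e)) ∧ (U (hd (nx e)) ∧ U (hd (pv e)))

  good⇒ : ∀ {e} → good e ≡ true → tri e ≡ true × tri (nx e) ≡ true × U (hd (nx e)) ≡ true × U (hd (pv e)) ≡ true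
  good⇒ {e} g with ∧-elim {tri e ∧ tri (nx e)} g
  ... | a , b with ∧-elim {tri e} a | ∧-elim {U (hd (nx e))} b
  ... | a₁ , a₂ | b₁ , b₂ = a₁ , a₂ , b₁ , b₂

  flat-tri : ∀ {x} → Flat x → ∀ d → on d ≡ true → tl d ≡ x → tri d ≡ true × U (hd d) ≡ true
  flat-tri {x} (_ , _ , _ , q) d o te = notf (cnt0 (m+n≡0⇒n≡0 (dC x) q) d o te) , notf (cnt0 (m+n≡0⇒m≡0 (dC x) q) d o te)
    where notf : ∀ {b} → not b ≡ false → b ≡ true
          notf {true} _ = refl

  flat-good : ∀ {x} → Flat x → ∀ e → on e ≡ true → tl e ≡ x → good e ≡ true
  flat-good fx e o te =
    ∧-intro (∧-intro (proj₁ (flat-tri fx e o te)) (proj₁ (flat-tri fx (nx e) on′ tn)))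
            (∧-intro (proj₂ (flat-tri fx (nx e) on′ tn)) (proj₂ (flat-tri fx (pv e) (trans (pv-on e) o) (trans (pv-tl e) te))))
    where on′ = trans (nx-on e) o
          tn = trans (nx-tl e) te

  5≤deg : ∀ {x} → 5 ≤ dU x → 5 ≤ deg x
  5≤deg {x} h = ≤-trans h (≤-trans (m≤m+n _ _) (≤-reflexive (sym (deg-split x))))

  big-deg : ∀ {s b} → Small s → Chain s b → 5 ≤ deg b
  big-deg (_ , _ , e , _) base = 5≤deg (≤-reflexive (sym e))
  big-deg sm (link (_ , _ , e , _) _ _) = 5≤deg (≤-trans (n≤1+n 5) (≤-reflexive (sym e)))

  chain-U : ∀ {s b} → Small s → Chain s b → U b ≡ true
  chain-U (u , _) base = u
  chain-U _ (link (u , _) _ _) = u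

  big-around : ∀ e → on e ≡ true → 5 ≤ deg (tl e) → nx e ≢ e × pv e ≢ e × nx e ≢ pv e
  big-around e o h with nx≢pv e o (≤-trans (s≤s (s≤s (s≤s z≤n))) h)
  ... | (a ∷ b ∷ []) ∷ (c ∷ []) ∷ _ = a ∘ sym , b ∘ sym , c

  -- Seen from the head, the two triangles along `e` give two corners counted by `τ`; they are the
  -- corners that `e` uses up when its head pays.
  good-far : ∀ e → on e ≡ true → 5 ≤ deg (tl e) → U (tl e) ≡ true → good e ≡ true →
             tau (rev e) ≡ true × tau (nx (rev e)) ≡ true × rev e ≢ nx (rev e)
  good-far e o h u g with good⇒ g | big-around e o h
  ... | a , b , c , d | p , q , _ =
      ∧-intro (trans (cong (λ l → Len l ≡ᵇ 3) (sym (corner e o))) b) (∧-intro u′ (trans (cong U (third-pv e o b p)) c))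
    , ∧-intro (trans (cong (λ l → Len l ≡ᵇ 3) (φ-lab e o)) a) (∧-intro (trans (cong U (third-nx e o a q)) d) (trans (cong (U ∘ hd) (pvnx (rev e))) u′))
    , λ eq → loopless (pv e) (trans (pv-on e) o) (trans (pv-tl e) (trans (cong tl (sym (rev² e))) (trans (cong hd eq) (third-nx e o a q))))
    where
    u′ : U (hd (rev e)) ≡ true
    u′ = trans (cong (U ∘ tl) (rev² e)) u

  τ≤5 : ∀ c q τ → τ + c ≤ 6 + q → τ + q ≤ 6 + c → 1 ≤ c + q → c + q ≤ 1 → τ ≤ 5
  τ≤5 (suc zero) zero τ τc τq a b = s≤s⁻¹ (≤-trans (≤-reflexive (+-comm 1 τ)) τc)
  τ≤5 zero (suc zero) τ τc τq a b = s≤s⁻¹ (≤-trans (≤-reflexive (+-comm 1 τ)) τq)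
  τ≤5 zero (suc (suc _)) τ τc τq a (s≤s ())
  τ≤5 (suc zero) (suc _) τ τc τq a (s≤s ())
  τ≤5 (suc (suc _)) q τ τc τq a (s≤s ())

  -- In units of 1/8. For u ≤ 4 there are at least four neighbours in C, and the surplus c - u
  -- forces non-triangular corners. For u ≥ 7 the bound 2p ≤ u suffices. For u = 5 the exclusions
  -- leave c + q ≥ 3, and p ≤ 2 gives 52 ≤ 52; for u = 6 and c + q = 1 the same holds because τ ≤ 5.
  capacity : ∀ u c q τ p → 2 * p ≤ τ → τ ≤ u → τ + c ≤ u + q → τ + q ≤ u + c → 5 ≤ u ⊎ 8 ≤ u + c →
             ¬ (u ≡ 5 × c + q ≤ 1) → ¬ (u ≡ 6 × c + q ≡ 0) → ¬ (u ≡ 5 × c + q ≡ 2) → 48 + 2 * p ≤ 8 * u + 4 * c + 4 * q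
  capacity u c q τ p pτ τu τc τq st n1 n2 n3 with u ≤? 4
  ... | yes u≤4 = farkas (u ∷ c ∷ q ∷ τ ∷ p ∷ []) ((8 *[ cst 8 ≼ x₀ ⊕ x₁ ]) ∷ (4 *[ x₀ ≼ cst 4 ]) ∷ (4 *[ x₃ ⊕ x₁ ≼ x₀ ⊕ x₂ ]) ∷ (1 *[ 2 ⊗ x₄ ≼ x₃ ]) ∷ [])
        (u+c st ∷ u≤4 ∷ τc ∷ pτ ∷ []) 0 (cst 48 ⊕ 2 ⊗ x₄) (8 ⊗ x₀ ⊕ 4 ⊗ x₁ ⊕ 4 ⊗ x₂) refl
    where u+c : 5 ≤ u ⊎ 8 ≤ u + c → 8 ≤ u + c
          u+c (inj₁ h) = ⊥-elim (1+n≰n (≤-trans h u≤4))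
          u+c (inj₂ h) = h
  ... | no u>4 with 7 ≤? u
  ... | yes u≥7 = farkas (u ∷ c ∷ q ∷ τ ∷ p ∷ []) ((7 *[ cst 7 ≼ x₀ ]) ∷ (1 *[ x₃ ≼ x₀ ]) ∷ (1 *[ 2 ⊗ x₄ ≼ x₃ ]) ∷ [])
        (u≥7 ∷ τu ∷ pτ ∷ []) 0 (cst 48 ⊕ 2 ⊗ x₄) (8 ⊗ x₀ ⊕ 4 ⊗ x₁ ⊕ 4 ⊗ x₂) refl
  ... | no u<7 = mid (≤-antisym-cases (≰⇒> u>4) (s≤s⁻¹ (≰⇒> u<7)))
    where
    ≤-antisym-cases : 5 ≤ u → u ≤ 6 → u ≡ 5 ⊎ u ≡ 6
    ≤-antisym-cases a b with m≤n⇒m<n∨m≡n a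
    ... | inj₂ e = inj₁ (sym e)
    ... | inj₁ l = inj₂ (≤-antisym b l)
    half : 2 * p ≤ 5 → p ≤ 2
    half h = case p ≤? 2 of λ where
      (yes x) → x
      (no x) → ⊥-elim (1+n≰n (≤-trans (*-monoʳ-≤ 2 (≰⇒> x)) h))
    from5 : u ≡ 5 → 3 ≤ c + q
    from5 e = case 3 ≤? c + q of λ where
      (yes h) → h
      (no h) → case c + q ≤? 1 of λ where
        (yes l) → ⊥-elim (n1 (e , l))
        (no l) → ⊥-elim (n3 (e , ≤-antisym (s≤s⁻¹ (≰⇒> h)) (≰⇒> l)))
    fin : ∀ k m → m ≤ c + q → k ≤ u → 48 + 2 * 2 ≤ 8 * k + 4 * m → p ≤ 2 → 48 + 2 * p ≤ 8 * u + 4 * c + 4 * q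
    fin k m mq ku h p2 = farkas (u ∷ c ∷ q ∷ p ∷ k ∷ m ∷ []) ((2 *[ x₃ ≼ cst 2 ]) ∷ (1 *[ cst 52 ≼ 8 ⊗ x₄ ⊕ 4 ⊗ x₅ ]) ∷ (8 *[ x₄ ≼ x₀ ]) ∷ (4 *[ x₅ ≼ x₁ ⊕ x₂ ]) ∷ [])
       (p2 ∷ h ∷ ku ∷ mq ∷ []) 0 (cst 48 ⊕ 2 ⊗ x₃) (8 ⊗ x₀ ⊕ 4 ⊗ x₁ ⊕ 4 ⊗ x₂) refl
    mid : u ≡ 5 ⊎ u ≡ 6 → 48 + 2 * p ≤ 8 * u + 4 * c + 4 * q
    mid (inj₁ e) = fin 5 3 (from5 e) (≤-reflexive (sym e)) ≤-refl (half (≤-trans pτ (≤-trans τu (≤-reflexive e))))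
    mid (inj₂ e) = case 1 ≤? c + q of λ where
      (no h) → ⊥-elim (n2 (e , n≤0⇒n≡0 (s≤s⁻¹ (≰⇒> h))))
      (yes h) → case 2 ≤? c + q of λ where
        (yes h2) → farkas (u ∷ c ∷ q ∷ τ ∷ p ∷ []) ((1 *[ 2 ⊗ x₄ ≼ x₃ ]) ∷ (1 *[ x₃ ≼ x₀ ]) ∷ (1 *[ x₀ ≼ cst 6 ]) ∷ (8 *[ cst 6 ≼ x₀ ]) ∷ (4 *[ cst 2 ≼ x₁ ⊕ x₂ ]) ∷ [])
          (pτ ∷ τu ∷ ≤-reflexive e ∷ ≤-reflexive (sym e) ∷ h2 ∷ []) 0 (cst 48 ⊕ 2 ⊗ x₄) (8 ⊗ x₀ ⊕ 4 ⊗ x₁ ⊕ 4 ⊗ x₂) refl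
        (no h2) → fin 6 1 h (≤-reflexive (sym e)) ≤-refl (half (≤-trans pτ (τ≤5 c q τ (≤-trans τc (≤-reflexive (cong (_+ q) e))) (≤-trans τq (≤-reflexive (cong (_+ c) e))) h (s≤s⁻¹ (≰⇒> h2)))))

  module Stuck
    (B : Fin N → Fin N → Bool) (Bs : ∀ s → B s s ≡ true) (Bc : ∀ s b → B s b ≡ true → Chain s b)
    (Bcl : ∀ s b b′ → Flat b → A b b′ → B s b′ ≡ true → B s b ≡ true)
    (stuck : ∀ x → U x ≡ true → K x ≡ false → 5 ≤ dU x ⊎ 8 ≤ dU x + dC x)
    (NR : ∀ s y b → Small s → Small y ⊎ Neutral y → y ≢ s → B s b ≡ true → ¬ A y b)
    (x∗ : Fin N) (Ux∗ : U x∗ ≡ true) (Kx∗ : K x∗ ≡ false) where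

    big : 3 ≤ # on
    big = ≤-trans (≤-trans (s≤s (s≤s (s≤s z≤n))) (≤-trans (5d (stuck x∗ Ux∗ Kx∗)) (≤-reflexive (sym (deg-split x∗))))) (#-mono λ d p → proj₁ (∧-elim p))
      where 5d : 5 ≤ dU x∗ ⊎ 8 ≤ dU x∗ + dC x∗ → 5 ≤ dU x∗ + dC x∗
            5d (inj₁ h) = ≤-trans h (m≤m+n _ _)
            5d (inj₂ h) = ≤-trans (m≤m+n 5 3) h

    -- The region of `s` absorbs the flat vertices of the chain to `s′` one after the other, until
    -- `s′` itself touches it, which `NR` forbids unless `s` and `s′` coincide.
    uniq : ∀ {s s′ b b′} → Small s → Small s′ → B s b ≡ true → Chain s′ b′ → b ≡ b′ ⊎ A b b′ → s ≡ s′
    uniq {s} {s′} sm sm′ h base r = case s ≟ s′ of λ where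
        (yes e) → e
        (no ne) → ⊥-elim (bad ne r)
      where
      bad : s ≢ s′ → _ ≡ s′ ⊎ A _ s′ → ⊥
      bad ne (inj₂ a) = NR s s′ _ sm (inj₁ sm′) (ne ∘ sym) h (A-sym a)
      bad ne (inj₁ refl) with Bc s s′ h
      ... | base = ne refl
      ... | link fl _ _ = Small≢Flat sm′ fl
    uniq sm sm′ h (link {b′} fl a ch) r = uniq sm sm′ (inB r) ch (inj₂ a)
      where
      inB : _ ≡ b′ ⊎ A _ b′ → B _ b′ ≡ true
      inB (inj₁ refl) = h
      inB (inj₂ e) = Bcl _ b′ _ fl (A-sym e) h

    -- Every z gives 1/4 to each region it is joined to by an edge between two triangles.
    Pay : Fin N → Fin N → Set
    Pay s z = Small s × U z ≡ true × B s z ≡ false × ∃[ e ] (on e ≡ true × hd e ≡ z × B s (tl e) ≡ true × good e ≡ true)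

    pay? : ∀ s z → Dec (Pay s z)
    pay? s z = small? s ×-dec ((U z ≟ᵇ true) ×-dec ((B s z ≟ᵇ false) ×-dec
      any? λ e → (on e ≟ᵇ true) ×-dec ((hd e ≟ z) ×-dec ((B s (tl e) ≟ᵇ true) ×-dec (good e ≟ᵇ true)))))

    pay : Fin N → Fin N → Bool
    pay s z = ⌊ pay? s z ⌋

    -- The corners at a vertex that region `s` may claim: triangles inside U with another vertex in
    -- the region.
    own : Fin N → Fin M → Bool
    own s d = ⌊ small? s ⌋ ∧ (tau d ∧ (B s (hd d) ∨ B s (hd (pv d))))

    own⇒ : ∀ {s d} → own s d ≡ true → Small s × tau d ≡ true × (B s (hd d) ≡ true ⊎ B s (hd (pv d)) ≡ true)
    own⇒ {s} {d} p with ∧-elim {⌊ small? s ⌋} p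
    ... | a , b with ∧-elim {tau d} b
    ... | c , e = true-dec (small? s) a , c , ∨-elim e

    -- The two other vertices of the triangle are adjacent or equal, so they cannot lie in different
    -- regions.
    own-uniq : ∀ d → on d ≡ true → ∀ s s′ → own s d ≡ true → own s′ d ≡ true → s ≡ s′
    own-uniq d o s s′ p q with own⇒ {s} p | own⇒ {s′} q
    ... | sm , ta , r | sm′ , _ , r′ = go r r′
      where
      adj : hd (pv d) ≡ hd d ⊎ A (hd (pv d)) (hd d)
      adj = case pv d ≟ d of λ where
        (yes e) → inj₁ (cong hd e)
        (no ne) → inj₂ (third d o (proj₁ (∧-elim ta)) ne)
      go : B s (hd d) ≡ true ⊎ B s (hd (pv d)) ≡ true → B s′ (hd d) ≡ true ⊎ B s′ (hd (pv d)) ≡ true → s ≡ s′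
      go (inj₁ a) (inj₁ b) = uniq sm sm′ a (Bc _ _ b) (inj₁ refl)
      go (inj₂ a) (inj₂ b) = uniq sm sm′ a (Bc _ _ b) (inj₁ refl)
      go (inj₂ a) (inj₁ b) = uniq sm sm′ a (Bc _ _ b) adj
      go (inj₁ a) (inj₂ b) = sym (uniq sm′ sm b (Bc _ _ a) adj)

    given received : Fin N → ℕ
    given z = # (λ s → pay s z)
    received s = # (λ z → pay s z)

    -- Each payment claims the two corners beside its edge, and no corner is claimed by two regions.
    given≤ : ∀ z → 2 * given z ≤ τ z
    given≤ z = ≤-trans (≤-reflexive (trans (cong (2 *_) (#-def _)) (sym (sum-* 2 _)))) (≤-trans (sum-mono two)
      (≤-trans (≤-reflexive (trans (sum-cong λ s → #-def _) (sum-comm λ s d → ind ((on d ∧ own s d) ∧ (tl d == z)))))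
        (≤-trans (sum-mono one) (≤-reflexive (sym (#-def _))))))
      where
      two : ∀ s → 2 * ind (pay s z) ≤ cnt (own s) z
      two s with pay? s z
      ... | no _ = z≤n
      ... | yes (sm , uz , nb , e , o , refl , be , g) with good-far e o (big-deg sm (Bc s _ be)) (chain-U sm (Bc s _ be)) g
      ... | ta , tb , ne = #-distinct (λ d → (on d ∧ own s d) ∧ (tl d == hd e)) (rev e ∷ nx (rev e) ∷ []) ((ne ∷ []) ∷ [] ∷ [])
          (⇒cnt {own s} or (∧-intro (dec-true (small? s) sm) (∧-intro ta (∨-introˡ be′))) refl
          ∷ ⇒cnt {own s} (trans (nx-on (rev e)) or) (∧-intro (dec-true (small? s) sm) (∧-intro tb (∨-introʳ {B s (hd (nx (rev e)))} (trans (cong (B s ∘ hd) (pvnx (rev e))) be′)))) (nx-tl (rev e)) ∷ [])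
        where or = trans (on-rev e) o
              be′ : B s (hd (rev e)) ≡ true
              be′ = trans (cong (B s ∘ tl) (rev² e)) be
      one : ∀ d → sum (λ s → ind ((on d ∧ own s d) ∧ (tl d == z))) ≤ ind ((on d ∧ tau d) ∧ (tl d == z))
      one d = ≤-trans (≤-reflexive (sym (#-def _))) (go ((on d ∧ tau d) ∧ (tl d == z)) refl)
        where
        go : ∀ b → (on d ∧ tau d) ∧ (tl d == z) ≡ b → # (λ s → (on d ∧ own s d) ∧ (tl d == z)) ≤ ind b
        go true e = #-unique _ λ s s′ p q → own-uniq d (proj₁ (cnt⇒ {own s} p)) s s′ (proj₁ (proj₂ (cnt⇒ {own s} p))) (proj₁ (proj₂ (cnt⇒ {own s′} q)))
        go false e = ≤-reflexive (#-empty λ s → ≢true λ p → let (o , w , h) = cnt⇒ {own s} p in true≢false (⇒cnt {tau} o (proj₁ (proj₂ (own⇒ {s} w))) h) e)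

    given0 : ∀ z → (∀ s → ¬ Pay s z) → given z ≡ 0
    given0 z n = #-empty λ s → ≢true λ p → n s (true-dec (pay? s z) p)

    pay-adj : ∀ {s z} → Pay s z → ∃[ b ] (B s b ≡ true × A z b)
    pay-adj (_ , _ , _ , e , o , refl , be , _) = tl e , be , A-sym (e , o , refl , refl)

    -- A flat vertex that touches a region belongs to it; a small or neutral one contradicts `NR`.
    noPay : ∀ z → Small z ⊎ Flat z ⊎ Neutral z → ∀ s → ¬ Pay s z
    noPay z k s p@(sm , uz , nb , _) with pay-adj p
    ... | b , bb , a = go k
      where
      z≢s : z ≢ s
      z≢s refl = true≢false (Bs s) nb
      go : Small z ⊎ Flat z ⊎ Neutral z → ⊥
      go (inj₁ q) = NR s z b sm (inj₁ q) z≢s bb a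
      go (inj₂ (inj₁ q)) = true≢false (Bcl s z b q a bb) nb
      go (inj₂ (inj₂ q)) = NR s z b sm (inj₂ q) z≢s bb a

    module _ (s : Fin N) (sm : Small s) where
      NB : Fin N → Set
      NB z = U z ≡ true × B s z ≡ false × ∃[ e ] (on e ≡ true × hd e ≡ z × B s (tl e) ≡ true)
      nb? : ∀ z → Dec (NB z)
      nb? z = (U z ≟ᵇ true) ×-dec ((B s z ≟ᵇ false) ×-dec any? λ e → (on e ≟ᵇ true) ×-dec ((hd e ≟ z) ×-dec (B s (tl e) ≟ᵇ true)))
      nb : Fin N → Bool
      nb z = ⌊ nb? z ⌋
      ng : Fin M → Bool
      ng e = isU e ∧ not (good e)

      -- All edges at a flat vertex are good, so a neighbour of the region that does not pay is
      -- reached by a bad edge from `s` itself.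
      nb≤ : # nb ≤ received s + cnt ng s
      nb≤ = ≤-trans (≤-reflexive (#-def _)) (≤-trans (sum-mono each) (≤-reflexive (trans (sum-+ _ _) (cong₂ _+_ (sym (#-def _)) (#-fibre _ hd)))))
        where
        each : ∀ z → ind (nb z) ≤ ind (pay s z) + # (λ d → ((on d ∧ ng d) ∧ (tl d == s)) ∧ (hd d == z))
        each z with nb? z
        ... | no _ = z≤n
        ... | yes (uz , n , e , o , refl , be) with Bc s (tl e) be | bdec (good e)
        ... | _ | inj₁ g = ≤-trans (≤-reflexive (cong ind (sym (dec-true (pay? s (hd e)) (sm , uz , n , e , o , refl , be , g))))) (m≤m+n _ _)
        ... | link fl _ _ | inj₂ g = ⊥-elim (true≢false (flat-good fl e o refl) g)
        ... | base | inj₂ g = ≤-trans (#-pos _ e (∧-intro (⇒cnt {ng} o (∧-intro uz (not-intro g)) refl) (≡⇒== refl))) (m≤n+m _ _)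

      -- A non-triangular corner spoils the two edges that bound it, and a neighbour in C the two
      -- edges beside it.
      ng≤ : cnt ng s ≤ 2 * (dC s + t s)
      ng≤ = farkas (cnt ng s ∷ dC s ∷ t s ∷ cnt (not ∘ tri ∘ nx) s ∷ cnt (isC ∘ nx) s ∷ cnt (isC ∘ pv) s ∷ cnt X s ∷ cnt Y s ∷ [])
        ((1 *[ x₀ ≼ x₂ ⊕ x₆ ]) ∷ (1 *[ x₆ ≼ x₃ ⊕ x₇ ]) ∷ (1 *[ x₇ ≼ x₄ ⊕ x₅ ]) ∷ (1 *[ x₃ ≼ x₂ ]) ∷ (1 *[ x₄ ≼ x₁ ]) ∷ (1 *[ x₅ ≼ x₁ ]) ∷ [])
        (cnt-cover ng (not ∘ tri) X s (λ d _ _ p → split d (not-elim (proj₂ (∧-elim {isU d} p)))) ∷ cnt-cover X (not ∘ tri ∘ nx) Y s (λ d _ _ p → ∨-elim p)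
          ∷ cnt-cover Y (isC ∘ nx) (isC ∘ pv) s (λ d _ _ p → ∨-elim p)
          ∷ ≤-reflexive (cnt-nx (not ∘ tri) s) ∷ ≤-reflexive (cnt-nx isC s) ∷ ≤-reflexive (cnt-pv isC s) ∷ []) 0 x₀ (2 ⊗ (x₁ ⊕ x₂)) refl
        where
        X Y : Fin M → Bool
        Y d = isC (nx d) ∨ isC (pv d)
        X d = not (tri (nx d)) ∨ Y d
        split : ∀ d → good d ≡ false → not (tri d) ≡ true ⊎ X d ≡ true
        split d = lem (tri d) (tri (nx d)) (U (hd (nx d))) (U (hd (pv d)))
          where lem : ∀ a b c e → (a ∧ b) ∧ (c ∧ e) ≡ false → not a ≡ true ⊎ (not b ∨ (not c ∨ not e)) ≡ true
                lem false _ _ _ _ = inj₁ refl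
                lem true false _ _ _ = inj₂ refl
                lem true true false _ _ = inj₂ refl
                lem true true true false _ = inj₂ refl

      Bset W : Fin N → Bool
      Bset = B s
      W x = Bset x ∨ nb x

      B-U : ∀ x → Bset x ≡ true → U x ≡ true
      B-U x b = chain-U sm (Bc s x b)

      nb-U : ∀ x → nb x ≡ true → U x ≡ true × Bset x ≡ false
      nb-U x p = let (a , b , _) = true-dec (nb? x) p in a , b

      X DB DW Y Y′ : ℕ
      X  = # (λ d → (on d ∧ isU d) ∧ Bset (tl d))
      DB = # (λ d → on d ∧ (Bset (tl d) ∧ Bset (hd d)))
      DW = # (λ d → on d ∧ (W (tl d) ∧ W (hd d)))
      Y  = # (λ d → on d ∧ (Bset (tl d) ∧ nb (hd d)))
      Y′ = # (λ d → on d ∧ (nb (tl d) ∧ Bset (hd d)))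

      -- Every vertex of the region has dU = 6 except `s`, which has 5.
      X-val : X + 1 ≡ 6 * # Bset
      X-val = trans (cong₂ _+_ (sym (cnt-sum isU Bset)) (sym (#-at s))) (trans (cong (sum (λ x → if Bset x then dU x else 0) +_) (#-def _)) (trans (sym (sum-+ _ _))
        (trans (sum-cong each) (trans (sum-* 6 (ind ∘ Bset)) (cong (6 *_) (sym (#-def _)))))))
        where
        each : ∀ x → (if Bset x then dU x else 0) + ind (x == s) ≡ 6 * ind (Bset x)
        each x = go (Bset x) refl
          where
          go : ∀ b → Bset x ≡ b → (if b then dU x else 0) + ind (x == s) ≡ 6 * ind b
          go false e = cong ind (≢⇒== λ { refl → true≢false (Bs s) e })
          go true e with Bc s x e
          ... | base = cong₂ _+_ (proj₁ (proj₂ (proj₂ sm))) (cong ind (≡⇒== {x = s} refl))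
          ... | link fl _ _ = cong₂ _+_ (proj₁ (proj₂ (proj₂ fl))) (cong ind (≢⇒== λ { refl → Small≢Flat sm fl }))

      X≤ : X ≤ DB + Y
      X≤ = #-cover _ _ _ λ d p → let (a , b) = ∧-elim {on d ∧ isU d} p ; (o , u) = ∧-elim {on d} a in
        case bdec (Bset (hd d)) of λ where
          (inj₁ q) → inj₁ (∧-intro o (∧-intro b q))
          (inj₂ q) → inj₂ (∧-intro o (∧-intro b (dec-true (nb? (hd d)) (u , q , d , o , refl , b))))

      Y≡ : Y ≡ Y′
      Y≡ = trans (sym (#-perm (λ d → on d ∧ (Bset (tl d) ∧ nb (hd d))) rev rev rev² rev²))
        (#-cong λ d → cong₂ _∧_ (on-rev d) (trans (cong (λ z → Bset (hd d) ∧ nb (tl z)) (rev² d)) (∧-comm (Bset (hd d)) (nb (tl d)))))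

      DW≥ : DB + (Y + Y′) ≤ DW
      DW≥ = ≤-trans (+-monoʳ-≤ DB (#-disjoint Z _ _
              (λ d p → let (o , q) = ∧-elim {on d} p ; (a , b) = ∧-elim {Bset (tl d)} q in ∧-intro o (∨-introˡ {Bset (tl d) ∧ nb (hd d)} (∧-intro a b)))
              (λ d p → let (o , q) = ∧-elim {on d} p in ∧-intro o (∨-introʳ {Bset (tl d) ∧ nb (hd d)} q))
              (λ d p → ≢true λ q → true≢false (proj₁ (∧-elim {Bset (tl d)} (proj₂ (∧-elim {on d} p)))) (proj₂ (nb-U (tl d) (proj₁ (∧-elim {nb (tl d)} (proj₂ (∧-elim {on d} q)))))))))
            (#-disjoint _ _ _
              (λ d p → let (o , q) = ∧-elim {on d} p ; (a , b) = ∧-elim {Bset (tl d)} q in ∧-intro o (∧-intro (∨-introˡ a) (∨-introˡ b)))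
              (λ d p → let (o , q) = ∧-elim {on d} p in ∧-intro o (zz d (∨-elim {Bset (tl d) ∧ nb (hd d)} q)))
              (λ d p → ≢true λ q → let (a , b) = ∧-elim {Bset (tl d)} (proj₂ (∧-elim {on d} p)) in
                 no-both d a b (∨-elim {Bset (tl d) ∧ nb (hd d)} (proj₂ (∧-elim {on d} q)))))
        where
        Z : Fin M → Bool
        Z d = on d ∧ ((Bset (tl d) ∧ nb (hd d)) ∨ (nb (tl d) ∧ Bset (hd d)))
        zz : ∀ d → Bset (tl d) ∧ nb (hd d) ≡ true ⊎ nb (tl d) ∧ Bset (hd d) ≡ true → W (tl d) ∧ W (hd d) ≡ true
        zz d (inj₁ q) = let (a , b) = ∧-elim {Bset (tl d)} q in ∧-intro (∨-introˡ a) (∨-introʳ {Bset (hd d)} b)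
        zz d (inj₂ q) = let (a , b) = ∧-elim {nb (tl d)} q in ∧-intro (∨-introʳ {Bset (tl d)} a) (∨-introˡ b)
        no-both : ∀ d → Bset (tl d) ≡ true → Bset (hd d) ≡ true → Bset (tl d) ∧ nb (hd d) ≡ true ⊎ nb (tl d) ∧ Bset (hd d) ≡ true → ⊥
        no-both d a b (inj₁ q) = true≢false b (proj₂ (nb-U (hd d) (proj₂ (∧-elim {Bset (tl d)} q))))
        no-both d a b (inj₂ q) = true≢false a (proj₂ (nb-U (tl d) (proj₁ (∧-elim {nb (tl d)} q))))

      #aB : # (λ x → alive x ∧ Bset x) ≡ # Bset
      #aB = #-cong λ x → bool-ext (λ p → proj₂ (∧-elim {alive x} p)) (λ b → ∧-intro (U-alive x (B-U x b)) b)

      #aW : # (λ x → alive x ∧ W x) ≡ # Bset + # nb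
      #aW = ≤-antisym (#-cover _ _ _ λ x p → ∨-elim (proj₂ (∧-elim {alive x} p)))
        (#-disjoint _ _ _ (λ x b → ∧-intro (U-alive x (B-U x b)) (∨-introˡ b)) (λ x b → ∧-intro (U-alive x (proj₁ (nb-U x b))) (∨-introʳ {Bset x} b))
          (λ x b → ≢true λ q → true≢false b (proj₂ (nb-U x q))))

      dU≤ : dU s + 1 ≤ # Bset + # nb
      dU≤ = ≤-trans (+-monoˡ-≤ 1 (≤-trans (#-inj (λ d → (on d ∧ isU d) ∧ (tl d == s)) hd (elems B′ ++ elems nb) inj cov)
          (≤-reflexive (trans (length-++ (elems B′)) (cong₂ _+_ (length-elems B′) (length-elems nb)))))) (≤-reflexive (trans (+-comm _ 1) (cong (_+ # nb) (sym (#-remove Bset s (Bs s))))))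
        where
        B′ : Fin N → Bool
        B′ x = Bset x ∧ not (x == s)
        inj : ∀ i j → (on i ∧ isU i) ∧ (tl i == s) ≡ true → (on j ∧ isU j) ∧ (tl j == s) ≡ true → hd i ≡ hd j → i ≡ j
        inj i j p q h = let (a , _ , b) = cnt⇒ {isU} p ; (a′ , _ , b′) = cnt⇒ {isU} q in simple i j a a′ (trans b (sym b′)) h
        cov : ∀ i → (on i ∧ isU i) ∧ (tl i == s) ≡ true → hd i ∈ˡ (elems B′ ++ elems nb)
        cov i p with cnt⇒ {isU} p
        ... | o , u , refl = case bdec (Bset (hd i)) of λ where
          (inj₁ b) → ∈-++⁺ˡ (∈-elems B′ (hd i) (∧-intro b (not-intro (≢⇒== λ e → loopless i o (sym e)))))
          (inj₂ b) → ∈-++⁺ʳ (elems B′) (∈-elems nb (hd i) (dec-true (nb? (hd i)) (u , b , i , o , refl , Bs (tl i))))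

      -- Let b and k be the sizes of the region and of its neighbourhood. If b ≥ 3, sparsity gives
      -- DB ≤ 6b - 12 and DB + 2Y ≤ 6(b + k) - 12, while DB + Y ≥ 6b - 1; adding up, 6k ≥ 22. If b ≤
      -- 2, the vertex `s` and its five neighbours lie in the union, so b + k ≥ 6.
      nb≥4 : 4 ≤ # nb
      nb≥4 = case 4 ≤? # nb of λ where
          (yes h) → h
          (no h) → ⊥-elim (few (s≤s⁻¹ (≰⇒> h)))
        where
        few : # nb ≤ 3 → ⊥
        few h with 3 ≤? # Bset
        ... | no b = 1+n≰n {0} (farkas (dU s ∷ # Bset ∷ # nb ∷ []) ((1 *[ x₀ ⊕ cst 1 ≼ x₁ ⊕ x₂ ]) ∷ (1 *[ cst 5 ≼ x₀ ]) ∷ (1 *[ x₁ ≼ cst 2 ]) ∷ (1 *[ x₂ ≼ cst 3 ]) ∷ [])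
              (dU≤ ∷ ≤-reflexive (sym (proj₁ (proj₂ (proj₂ sm)))) ∷ s≤s⁻¹ (≰⇒> b) ∷ h ∷ []) 0 (cst 1) (cst 0) refl)
        ... | yes b = 1+n≰n {0} (farkas (X ∷ DB ∷ DW ∷ Y ∷ Y′ ∷ # Bset ∷ # nb ∷ [])
              ((2 *[ x₀ ≼ x₁ ⊕ x₃ ]) ∷ (2 *[ 6 ⊗ x₅ ≼ x₀ ⊕ cst 1 ]) ∷ (1 *[ x₁ ⊕ (x₃ ⊕ x₄) ≼ x₂ ]) ∷ (1 *[ x₃ ≼ x₄ ]) ∷ (1 *[ x₁ ⊕ cst 12 ≼ 6 ⊗ x₅ ]) ∷ (1 *[ x₂ ⊕ cst 12 ≼ 6 ⊗ (x₅ ⊕ x₆) ]) ∷ (6 *[ x₆ ≼ cst 3 ]) ∷ [])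
              (X≤ ∷ ≤-reflexive (sym X-val) ∷ DW≥ ∷ ≤-reflexive Y≡
                ∷ subst (λ z → DB + 12 ≤ 6 * z) #aB (sparseOn P simple Bset (subst (3 ≤_) (sym #aB) b))
                ∷ subst (λ z → DW + 12 ≤ 6 * z) #aW (sparseOn P simple W (subst (3 ≤_) (sym #aW) (≤-trans b (m≤m+n _ _)))) ∷ h ∷ []) 0 (cst 1) (cst 0) refl)

      -- Exactly what lifts `s` to charge 0: it lacks 1 - (dC + t)/2, and each payer brings 1/4.
      enough : 4 ≤ received s + 2 * (dC s + t s)
      enough = ≤-trans nb≥4 (≤-trans nb≤ (+-monoʳ-≤ (received s) ng≤))

    lhs rhs : Fin N → ℕ
    lhs x = if U x then (if K x then 7 * dU x else 48) else 0
    rhs x = if U x then 8 * dU x + 4 * dC x + 4 * t x else 0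

    -- Outside K every final charge is nonnegative. On K the gifts take at most one eighth of dU,
    -- which leaves the `7 * dU x` in `lhs`.
    vertex : ∀ x → lhs x + 2 * given x ≤ rhs x + 2 * received x
    vertex x = go (U x) (K x) refl refl
     where
     go : ∀ a b → U x ≡ a → K x ≡ b → (if a then (if b then 7 * dU x else 48) else 0) + 2 * given x ≤ (if a then 8 * dU x + 4 * dC x + 4 * t x else 0) + 2 * received x
     go false _ u k = ≤-trans (≤-reflexive (cong (2 *_) (given0 x λ s p → true≢false (proj₁ (proj₂ p)) u))) z≤n
     go true true u k = farkas (dU x ∷ dC x ∷ t x ∷ τ x ∷ given x ∷ received x ∷ []) ((1 *[ 2 ⊗ x₄ ≼ x₃ ]) ∷ (1 *[ x₃ ≼ x₀ ]) ∷ [])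
        (given≤ x ∷ τ≤dU x ∷ []) 0 (7 ⊗ x₀ ⊕ 2 ⊗ x₄) (8 ⊗ x₀ ⊕ 4 ⊗ x₁ ⊕ 4 ⊗ x₂ ⊕ 2 ⊗ x₅) refl
     go true false u k = case small? x of λ where
        (yes q) → special (inj₁ q) (≤-trans (≤-reflexive (cong (λ z → 8 * z + 8) (sym (proj₁ (proj₂ (proj₂ q)))))) (farkas (dU x ∷ dC x ∷ t x ∷ received x ∷ []) ((2 *[ cst 4 ≼ x₃ ⊕ 2 ⊗ (x₁ ⊕ x₂) ]) ∷ [])
              (enough x q ∷ []) 0 (8 ⊗ x₀ ⊕ cst 8) (8 ⊗ x₀ ⊕ 4 ⊗ x₁ ⊕ 4 ⊗ x₂ ⊕ 2 ⊗ x₃) refl))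
        (no n1) → case flat? x of λ where
          (yes q) → special (inj₂ (inj₁ q)) (≤-trans (≤-reflexive (cong (8 *_) (sym (proj₁ (proj₂ (proj₂ q)))))) (farkas (dU x ∷ dC x ∷ t x ∷ received x ∷ []) [] [] 0 (8 ⊗ x₀) (8 ⊗ x₀ ⊕ 4 ⊗ x₁ ⊕ 4 ⊗ x₂ ⊕ 2 ⊗ x₃) refl))
          (no n2) → case neutral? x of λ where
            (yes q) → special (inj₂ (inj₂ q)) (farkas (dU x ∷ dC x ∷ t x ∷ received x ∷ []) ((8 *[ cst 5 ≼ x₀ ]) ∷ (4 *[ cst 2 ≼ x₁ ⊕ x₂ ]) ∷ [])
                (≤-reflexive (sym (proj₁ (proj₂ (proj₂ q)))) ∷ ≤-reflexive (sym (proj₂ (proj₂ (proj₂ q)))) ∷ []) 0 (cst 48) (8 ⊗ x₀ ⊕ 4 ⊗ x₁ ⊕ 4 ⊗ x₂ ⊕ 2 ⊗ x₃) refl)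
            (no n3) → ≤-trans (capacity (dU x) (dC x) (t x) (τ x) (given x) (given≤ x) (τ≤dU x) (τ+dC≤dU+t x) (τ+t≤dU+dC x) (stuck x u k)
                (λ (a , b) → n1 (u , k , a , b)) (λ (a , b) → n2 (u , k , a , b)) (λ (a , b) → n3 (u , k , a , b))) (m≤m+n _ _)
      where
      special : Small x ⊎ Flat x ⊎ Neutral x → 48 ≤ 8 * dU x + 4 * dC x + 4 * t x + 2 * received x → 48 + 2 * given x ≤ 8 * dU x + 4 * dC x + 4 * t x + 2 * received x
      special k h rewrite given0 x (noPay x k) = h

    KdU : ℕ
    KdU = sum (λ x → if K x then dU x else 0)

    -- Gifts and receipts cancel, so only K is left to make up the deficit of Euler's formula, in
    -- units of 1/8.
    total : 7 * KdU + 48 + 48 * # root ≤ 48 * # K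
    total = farkas (KdU ∷ # root ∷ # K ∷ # (λ x → U x ∧ not (K x)) ∷ # U ∷ sum given ∷ sum received ∷ ΣU big dU ∷ ΣU big dC ∷ ΣU big t ∷ [])
        ((1 *[ 7 ⊗ x₀ ⊕ 48 ⊗ x₃ ⊕ 2 ⊗ x₅ ≼ 8 ⊗ x₇ ⊕ 4 ⊗ x₈ ⊕ 4 ⊗ x₉ ⊕ 2 ⊗ x₆ ]) ∷ (2 *[ x₆ ≼ x₅ ]) ∷ (1 *[ 8 ⊗ x₇ ⊕ 4 ⊗ x₈ ⊕ 4 ⊗ x₉ ⊕ cst 48 ⊕ 48 ⊗ x₁ ≼ 48 ⊗ x₄ ]) ∷ (48 *[ x₄ ≼ x₂ ⊕ x₃ ]) ∷ [])
        (subst₂ _≤_ eqL eqR (sum-mono vertex) ∷ ≤-reflexive swap ∷ charge big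
          ∷ #-cover U K (λ x → U x ∧ not (K x)) (λ x u → case bdec (K x) of λ where
              (inj₁ k) → inj₁ k
              (inj₂ k) → inj₂ (∧-intro u (not-intro k))) ∷ [])
        0 (7 ⊗ x₀ ⊕ cst 48 ⊕ 48 ⊗ x₁) (48 ⊗ x₂) refl
      where
      x₈ x₉ : Lin 10
      x₈ = var (suc (suc (suc (suc (suc (suc (suc (suc zero))))))))
      x₉ = var (suc (suc (suc (suc (suc (suc (suc (suc (suc zero)))))))))
      swap : sum received ≡ sum given
      swap = trans (sum-cong λ s → #-def _) (trans (sum-comm λ s z → ind (pay s z)) (sum-cong λ z → sym (#-def _)))
      eqL : sum (λ x → lhs x + 2 * given x) ≡ 7 * KdU + 48 * # (λ x → U x ∧ not (K x)) + 2 * sum given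
      eqL = trans (sum-+ _ _) (cong₂ _+_ (trans (sum-cong each) (trans (sum-+ _ _) (cong₂ _+_ (sum-* 7 _) (trans (sum-* 48 _) (cong (48 *_) (sym (#-def _))))))) (sum-* 2 given))
        where
        each : ∀ x → lhs x ≡ 7 * (if K x then dU x else 0) + 48 * ind (U x ∧ not (K x))
        each x with U x in u | K x in k
        ... | true | true = sym (+-identityʳ _)
        ... | true | false = refl
        ... | false | true = ⊥-elim (true≢false (K⊆U x k) u)
        ... | false | false = refl
      eqR : sum (λ x → rhs x + 2 * received x) ≡ 8 * ΣU big dU + 4 * ΣU big dC + 4 * ΣU big t + 2 * sum received
      eqR = trans (sum-+ _ _) (cong₂ _+_ (trans (sum-cong each) (trans (sum-+ _ _) (cong₂ _+_ (trans (sum-+ _ _) (cong₂ _+_ (sum-* 8 _) (sum-* 4 _))) (sum-* 4 _)))) (sum-* 2 received))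
        where
        each : ∀ x → rhs x ≡ 8 * (if U x then dU x else 0) + 4 * (if U x then dC x else 0) + 4 * (if U x then t x else 0)
        each x with U x
        ... | true = refl
        ... | false = refl

-- The two reductions, and why one of them always applies.

module Reductions {N M : ℕ} (𝔻 : Darts N M) (P : PlaneMaps.PMap 𝔻) (U : Fin N → Bool) (nm : Normalise.Normal 𝔻 P U)
  (K : Fin N → Bool) (K⊆U : ∀ x → K x ≡ true → U x ≡ true) where

  open PlaneMaps 𝔻
  open Normalise 𝔻
  open Discharge 𝔻 P U nm K K⊆U

  -- `lift` prepends the eliminations of the moved vertices. Only the final `U′` must satisfy the
  -- bound for C; between two moves it may fail.
  record Reduction : Set where
    field
      U′      : Fin N → Bool
      sub     : ∀ x → U′ x ≡ true → U x ≡ true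
      keepK   : ∀ x → K x ≡ true → U′ x ≡ true
      smaller : # U′ < # U
      bounded : BoundedC P U′
      lift    : Elim A K U′ → Elim A K U

  heads : (Fin M → Bool) → Fin N → List (Fin N)
  heads Q x = List.map hd (elems (λ d → (on d ∧ Q d) ∧ (tl d == x)))

  length-heads : ∀ Q x → length (heads Q x) ≡ cnt Q x
  length-heads Q x = length-image hd (λ d → (on d ∧ Q d) ∧ (tl d == x))

  ∈-heads : ∀ Q {x} d → on d ≡ true → Q d ≡ true → tl d ≡ x → hd d ∈ˡ heads Q x
  ∈-heads Q d o q e = ∈-map⁺ hd (∈-elems _ d (⇒cnt {Q} o q e))

  -- The vertex opposite to tl c in the 4-cycle around hd c (tl c itself if there is none).
  opp : Fin M → Fin N
  opp c with any? (λ d → (on d ≟ᵇ true) ×-dec ((tl d ≟ hd c) ×-dec (¬? (hd d ≟ tl c) ×-dec ¬? (A? (hd d) (tl c)))))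
  ... | yes (d , _) = hd d
  ... | no _ = tl c

  opp-spec : ∀ c d → on c ≡ true → U (hd c) ≡ false → on d ≡ true → tl d ≡ hd c → hd d ≢ tl c → ¬ A (hd d) (tl c) → hd d ≡ opp c
  opp-spec c d oc uc od td ne na with any? (λ d → (on d ≟ᵇ true) ×-dec ((tl d ≟ hd c) ×-dec (¬? (hd d ≟ tl c) ×-dec ¬? (A? (hd d) (tl c)))))
  ... | no none = ⊥-elim (none (d , od , td , ne , na))
  ... | yes (d′ , od′ , td′ , ne′ , na′) = cong hd (Copp (rev c) d d′ (trans (on-rev c) oc) od od′ uc td td′
        (λ { refl → ne rr }) (λ { refl → ne′ rr }) (λ a → na (A-sym (subst (λ z → A z (hd d)) rr a))) (λ a → na′ (A-sym (subst (λ z → A z (hd d′)) rr a))))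
    where rr : hd (rev c) ≡ tl c
          rr = cong tl (rev² c)

  opps : Fin N → List (Fin N)
  opps x = List.map opp (elems (λ d → (on d ∧ isC d) ∧ (tl d == x)))

  length-opps : ∀ x → length (opps x) ≡ dC x
  length-opps x = length-image opp (λ d → (on d ∧ isC d) ∧ (tl d == x))

  -- Of the four neighbours of `w`, one is `x` and two are adjacent to `x`; only the opposite one is
  -- seen through `w` alone.
  ∈-opps : ∀ {x u w} → U w ≡ false → A w u → A w x → u ≢ x → ¬ A u x → u ∈ˡ opps x
  ∈-opps {x} {u} {w} uw (d , od , td , refl) (c , oc , tc , refl) ne na =
    subst (_∈ˡ opps x) (sym (trans (opp-spec (rev c) d (trans (on-rev c) oc) (trans (cong (U ∘ tl) (rev² c)) uw′) od (trans td (trans (sym tc) (cong tl (sym (rev² c))))) ne na) refl))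
      (∈-map⁺ opp (∈-elems _ (rev c) (⇒cnt {isC} (trans (on-rev c) oc) (not-intro (trans (cong (U ∘ tl) (rev² c)) uw′)) refl)))
    where uw′ : U (tl c) ≡ false
          uw′ = trans (cong U tc) uw

  bounded-old : ∀ w → U w ≡ false → (V : Fin N → Bool) → AtMost 4 (λ u → V u ≡ true × A w u)
  bounded-old w u V = heads (λ _ → true) w , ≤-trans (≤-reflexive (length-heads _ w)) le , λ { _ (_ , d , o , e , refl) → ∈-heads _ d o refl e }
    where
    le : cnt (λ _ → true) w ≤ 4
    le = case bdec (alive w) of λ where
      (inj₁ a) → ≤-trans (#-mono λ d p → let (o , _ , e) = cnt⇒ {λ _ → true} p in ∧-intro o (≡⇒== e)) (≤-reflexive (deg4 w a u))
      (inj₂ a) → ≤-trans (≤-reflexive (#-empty λ d → ≢true λ p → let (o , _ , e) = cnt⇒ {λ _ → true} p in true≢false (on-alive d o) (trans (cong alive e) a))) z≤n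

  bounded-new : ∀ x (V : Fin N → Bool) → cnt (V ∘ hd) x ≤ 4 → AtMost 4 (λ u → V u ≡ true × A x u)
  bounded-new x V le = heads (V ∘ hd) x , ≤-trans (≤-reflexive (length-heads _ x)) le , λ { _ (v , d , o , e , refl) → ∈-heads (V ∘ hd) d o v e }

  single-L : ∀ x → dU x + dC x ≤ 7 → AtMost 7 (λ u → U u ≡ true × u ≢ x × TwoReach A U u x)
  single-L x le = heads isU x ++ opps x
    , ≤-trans (≤-reflexive (trans (length-++ (heads isU x)) (cong₂ _+_ (length-heads isU x) (length-opps x)))) le
    , cov
    where
    direct : ∀ {u} → U u ≡ true → A u x → u ∈ˡ (heads isU x ++ opps x)
    direct uu a with A-sym a
    ... | d , o , e , refl = ∈-++⁺ˡ (∈-heads isU d o uu e)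
    cov : ∀ u → U u ≡ true × u ≢ x × TwoReach A U u x → u ∈ˡ (heads isU x ++ opps x)
    cov u (uu , ne , inj₁ a) = direct uu a
    cov u (uu , ne , inj₂ (w , uw , a , b)) = case A? u x of λ where
      (yes h) → direct uu h
      (no h) → ∈-++⁺ʳ (heads isU x) (∈-opps uw a b ne h)

  #∖ : ∀ {V : Fin N → Bool} x → V x ≡ true → # (V ∖ x) < # V
  #∖ {V} x v = ≤-reflexive (sym (#-remove V x v))

  single : ∀ x → U x ≡ true → K x ≡ false → dU x ≤ 4 → dU x + dC x ≤ 7 → Reduction
  single x u k a b = record
    { U′ = U ∖ x ; sub = λ y p → proj₁ (∖⇒ {U = U} p) ; keepK = λ y p → ⇒∖ {U = U} (K⊆U y p) (λ { refl → true≢false p k })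
    ; smaller = #∖ x u ; bounded = bd ; lift = elim x u k (single-L x b) }
    where
    bd : BoundedC P (U ∖ x)
    bd w p with ∖-false {U = U} p
    ... | inj₁ q = bounded-old w q (U ∖ x)
    ... | inj₂ refl = bounded-new x (U ∖ x) (≤-trans (cnt-mono {(U ∖ x) ∘ hd} {isU} x λ d _ _ p → proj₁ (∖⇒ {U = U} p)) a)

  -- An induced path of flat vertices ending in `s`; the list holds the vertices after the first.
  data IP (s : Fin N) : Fin N → List (Fin N) → Set where
    end  : IP s s []
    cons : ∀ {x y r} → Flat x → A x y → All (λ z → ¬ A x z) r → All (x ≢_) (y ∷ r) → IP s y r → IP s x (y ∷ r)

  Attached : Fin N → Fin N → Set
  Attached s x = ∃[ y ] ∃[ r ] (IP s y r × A x y × All (λ z → ¬ A x z) r × All (x ≢_) (y ∷ r))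

  near? : ∀ x z → Dec (x ≡ z ⊎ A x z)
  near? x z = (x ≟ z) ⊎-dec A? x z

  -- Skipping to the last vertex that `x` equals or is adjacent to makes the extension induced; if
  -- that vertex is `x`, the rest of the path already starts there.
  trim : ∀ {s} x {y r} → IP s y r → (x ≡ y ⊎ A x y) ⊎ Any (λ z → x ≡ z ⊎ A x z) r → (∃[ r′ ] IP s x r′) ⊎ Attached s x
  trim x {y} {r} p n with Any.any? (near? x) r
  trim x (cons _ _ _ _ p) n | yes (here h) = trim x p (inj₁ h)
  trim x (cons _ _ _ _ p) n | yes (there h) = trim x p (inj₂ h)
  trim x p (inj₂ h) | no none = ⊥-elim (none h)
  trim x {y} {r} p (inj₁ (inj₁ refl)) | no none = inj₁ (r , p)
  trim x {y} {r} p (inj₁ (inj₂ a)) | no none = inj₂ (y , r , p , a , none⇒ r none (λ z h → inj₂ h) , (A-irr a ∷ none⇒ r none (λ z h → inj₁ h)))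
    where
    none⇒ : ∀ {Q R : Fin N → Set} r → ¬ Any R r → (∀ z → Q z → R z) → All (λ z → ¬ Q z) r
    none⇒ [] n f = []
    none⇒ (z ∷ r) n f = (λ q → n (here (f z q))) ∷ none⇒ r (n ∘ there) f

  chain-IP : ∀ {s b} → Chain s b → ∃[ r ] IP s b r
  chain-IP base = [] , end
  chain-IP (link fl a ch) with chain-IP ch
  ... | r , p with trim _ p (inj₁ (inj₂ a))
  ... | inj₁ q = q
  ... | inj₂ (y , r′ , q , a′ , na , ne) = y ∷ r′ , cons fl a′ na ne q

  -- `y` cannot lie on the path: it differs from `s`, and the other vertices have dU = 6 instead of
  -- 5.
  attach : ∀ {s y b} → Small s → Small y ⊎ Neutral y → y ≢ s → Chain s b → A y b → Attached s y
  attach sm ky ne ch a with chain-IP ch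
  ... | r , p with trim _ p (inj₁ (inj₂ a))
  ... | inj₂ q = q
  ... | inj₁ (_ , end) = ⊥-elim (ne refl)
  ... | inj₁ (_ , cons (_ , _ , d6 , _) _ _ _ _) = ⊥-elim (six (five ky) d6)
    where
    five : Small _ ⊎ Neutral _ → dU _ ≡ 5
    five (inj₁ (_ , _ , e , _)) = e
    five (inj₂ (_ , _ , e , _)) = e
    six : ∀ {m} → m ≡ 5 → m ≡ 6 → ⊥
    six refl ()

  -- V is the set of remaining vertices and p the vertex removed last.

  module Along (s : Fin N) (sm : Small s) where

    -- `gone` is where inducedness enters: among the moved vertices only `p` can see the rest of the
    -- path. The 5 in `cVp` is dU for the first vertex and 6 - 1 for a flat one.
    record State (V : Fin N → Bool) (p x : Fin N) (r : List (Fin N)) : Set where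
      field
        V⊆U  : ∀ z → V z ≡ true → U z ≡ true
        gone : ∀ z → U z ≡ true → V z ≡ false → z ≡ p ⊎ All (λ y → ¬ A z y) (x ∷ r)
        pr   : All (λ z → ¬ A p z) r
        px   : A x p
        inV  : All (λ y → V y ≡ true) (x ∷ r)
        Vp   : V p ≡ false
        Up   : U p ≡ true
        V-K  : ∀ z → K z ≡ true → V z ≡ true
        cVp  : cnt (V ∘ hd) p ≤ 5

    module Step {V : Fin N → Bool} {p x : Fin N} {r : List (Fin N)} (st : State V p x r) where
      open State st

      Vx : V x ≡ true
      Vx = All.head inV

      e = proj₁ px
      oe = proj₁ (proj₂ px)
      te = proj₁ (proj₂ (proj₂ px))
      he = proj₂ (proj₂ (proj₂ px))

      cVx : suc (cnt (V ∘ hd) x) ≤ dU x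
      cVx = ≤-trans (s≤s (#-mono λ d q → let (o , v , t′) = cnt⇒ {V ∘ hd} q in
          ∧-intro (⇒cnt {isU} o (V⊆U (hd d) v) t′) (not-intro (≢⇒== λ { refl → true≢false v (trans (cong V he) Vp) }))))
        (≤-reflexive (sym (#-remove (λ d → (on d ∧ isU d) ∧ (tl d == x)) e (⇒cnt {isU} oe (trans (cong U he) Up) te))))

      -- A moved vertex other than `p` has no neighbour on the rest of the path, hence not `x`.
      stays : ∀ z → U z ≡ true → A z x → A z p → V z ≡ true
      stays z uz zx zp = case bdec (V z) of λ where
        (inj₁ v) → v
        (inj₂ v) → case gone z uz v of λ where
          (inj₁ refl) → ⊥-elim (A-irr zp refl)
          (inj₂ (n ∷ _)) → ⊥-elim (n zx)

      dart : ∀ {z} → V z ≡ true → A p z → ∃[ d ] ((on d ∧ V (hd d)) ∧ (tl d == p) ≡ true × hd d ≡ z)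
      dart v (d , o , t′ , refl) = d , ⇒cnt {V ∘ hd} o v t′ , refl

      rest : List (Fin M) → List (Fin N)
      rest ds = List.map hd (elems (λ d → ((on d ∧ V (hd d)) ∧ (tl d == p)) ∧ not (elemᵇ d ds)))

      length-rest : ∀ ds → Distinct ds → All (λ d → (on d ∧ V (hd d)) ∧ (tl d == p) ≡ true) ds → length (rest ds) + length ds ≤ 5
      length-rest ds di al = ≤-trans (≤-reflexive (trans (cong (_+ length ds) (length-image hd (λ d → ((on d ∧ V (hd d)) ∧ (tl d == p)) ∧ not (elemᵇ d ds)))) (#-removes (λ d → (on d ∧ V (hd d)) ∧ (tl d == p)) ds di al))) cVp

      through-p : ∀ ds → (∀ d → d ∈ˡ ds → hd d ≡ x ⊎ A (hd d) x) → ∀ u → V u ≡ true → u ≢ x → ¬ A u x → A p u → u ∈ˡ rest ds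
      through-p ds cov u vu ne na (d , o , t′ , refl) = ∈-map⁺ hd (∈-elems _ d (∧-intro (⇒cnt {V ∘ hd} o vu t′) (not-intro (≢true λ q →
        [ ne , na ] (cov d (elemᵇ⇒∈ ds q))))))

      direct : ∀ {u} → V u ≡ true → A u x → u ∈ˡ heads (V ∘ hd) x
      direct vu a with A-sym a
      ... | d , o , e′ , refl = ∈-heads (V ∘ hd) d o vu e′

      cover : ∀ (ys : List (Fin N)) → (∀ u → V u ≡ true → u ≢ x → ¬ A u x → A p u → u ∈ˡ ys) →
              (∀ u w → V u ≡ true → u ≢ x → ¬ A u x → U w ≡ false → A w u → A w x → u ∈ˡ ys) →
              cnt (V ∘ hd) x + length ys ≤ 7 → AtMost 7 (λ u → V u ≡ true × u ≢ x × TwoReach A V u x)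
      cover ys cp cC le = heads (V ∘ hd) x ++ ys , ≤-trans (≤-reflexive (trans (length-++ (heads (V ∘ hd) x)) (cong (_+ length ys) (length-heads (V ∘ hd) x)))) le , cov
        where
        cov : ∀ u → V u ≡ true × u ≢ x × TwoReach A V u x → u ∈ˡ (heads (V ∘ hd) x ++ ys)
        cov u (vu , ne , inj₁ a) = ∈-++⁺ˡ (direct vu a)
        cov u (vu , ne , inj₂ (w , vw , a , b)) = case A? u x of λ where
          (yes h) → ∈-++⁺ˡ (direct vu h)
          (no h) → ∈-++⁺ʳ (heads (V ∘ hd) x) (case bdec (U w) of λ where
            (inj₂ uw) → cC u w vu ne h uw a b
            (inj₁ uw) → case gone w uw vw of λ where
              (inj₁ refl) → cp u vu ne h a
              (inj₂ (n ∷ _)) → ⊥-elim (n b))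

      module Common (h : 5 ≤ deg x) where

        ar : nx e ≢ e × pv e ≢ e × nx e ≢ pv e
        ar = big-around e oe (subst (λ z → 5 ≤ deg z) (sym te) h)

        on-nx = trans (nx-on e) oe
        on-pv = trans (pv-on e) oe
        tn = trans (nx-tl e) te
        tp = trans (pv-tl e) te

        pz-nx : tri (nx e) ≡ true → A (hd (nx e)) p
        pz-nx tr = subst (A (hd (nx e))) (trans (cong hd (pvnx e)) he) (A-sym (third (nx e) on-nx tr (λ q → proj₁ ar (trans (sym q) (pvnx e)))))

        pz-pv : tri e ≡ true → A (hd (pv e)) p
        pz-pv tr = subst (A (hd (pv e))) he (third e oe tr (proj₁ (proj₂ ar)))

        xz-nx : A (hd (nx e)) x
        xz-nx = A-sym (nx e , on-nx , tn , refl)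
        xz-pv : A (hd (pv e)) x
        xz-pv = A-sym (pv e , on-pv , tp , refl)

        one : ∀ z → U z ≡ true → A z x → A z p → ∃[ ys ] (length ys ≤ 3 × (∀ u → V u ≡ true → u ≢ x → ¬ A u x → A p u → u ∈ˡ ys))
        one z uz zx zp with dart Vx (A-sym px) | dart (stays z uz zx zp) (A-sym zp)
        ... | d₀ , m₀ , refl | d₁ , m₁ , refl =
          rest ds , +-cancelʳ-≤ 2 _ _ (length-rest ds (((λ { refl → A-irr zx refl }) ∷ []) ∷ [] ∷ []) (m₀ ∷ m₁ ∷ []))
          , through-p ds λ { _ (here refl) → inj₁ refl ; _ (there (here refl)) → inj₂ zx }
          where ds = d₀ ∷ d₁ ∷ []

        -- Of the at most five remaining neighbours of `p`, one is `x` and the third vertices of the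
        -- two triangles along the edge are adjacent to `x`; two are left.
        both : good e ≡ true → ∃[ ys ] (length ys ≤ 2 × (∀ u → V u ≡ true → u ≢ x → ¬ A u x → A p u → u ∈ˡ ys))
        both g with good⇒ g
        ... | t₁ , t₂ , u₁ , u₂ with dart Vx (A-sym px) | dart (stays _ u₁ xz-nx (pz-nx t₂)) (A-sym (pz-nx t₂)) | dart (stays _ u₂ xz-pv (pz-pv t₁)) (A-sym (pz-pv t₁))
        ... | d₀ , m₀ , h₀ | d₁ , m₁ , h₁ | d₂ , m₂ , h₂ =
          rest ds , +-cancelʳ-≤ 3 _ _ (length-rest ds
              (((λ { refl → A-irr xz-nx (trans (sym h₁) h₀) }) ∷ (λ { refl → A-irr xz-pv (trans (sym h₂) h₀) }) ∷ [])
                ∷ ((λ { refl → proj₂ (proj₂ ar) (simple (nx e) (pv e) on-nx on-pv (trans tn (sym tp)) (trans (sym h₁) h₂)) }) ∷ []) ∷ [] ∷ []) (m₀ ∷ m₁ ∷ m₂ ∷ []))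
          , through-p ds λ { _ (here refl) → inj₁ h₀ ; _ (there (here refl)) → inj₂ (subst (λ z → A z x) (sym h₁) xz-nx) ; _ (there (there (here refl))) → inj₂ (subst (λ z → A z x) (sym h₂) xz-pv) }
          where ds = d₀ ∷ d₁ ∷ d₂ ∷ []

        -- Neighbours and opposite vertices make up at most 5, and `p` adds at most 2.
        good-L : good e ≡ true → cnt (V ∘ hd) x + dC x ≤ 5 → AtMost 7 (λ u → V u ≡ true × u ≢ x × TwoReach A V u x)
        good-L g le = use (both g)
          where
          use : ∃[ ys ] (length ys ≤ 2 × (∀ u → V u ≡ true → u ≢ x → ¬ A u x → A p u → u ∈ˡ ys)) → AtMost 7 (λ u → V u ≡ true × u ≢ x × TwoReach A V u x)
          use (ys , l , cp) = cover (ys ++ opps x) (λ u a b c d → ∈-++⁺ˡ (cp u a b c d)) (λ u w vu ne na uw a b → ∈-++⁺ʳ ys (∈-opps uw a b ne na)) le7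
            where
            len : length (ys ++ opps x) ≡ length ys + dC x
            len = trans (length-++ ys) (cong (length ys +_) (length-opps x))
            le7 : cnt (V ∘ hd) x + length (ys ++ opps x) ≤ 7
            le7 = subst (λ n → cnt (V ∘ hd) x + n ≤ 7) (sym len)
              (farkas (cnt (V ∘ hd) x ∷ length ys ∷ dC x ∷ []) ((1 *[ x₀ ⊕ x₂ ≼ cst 5 ]) ∷ (1 *[ x₁ ≼ cst 2 ]) ∷ []) (le ∷ l ∷ []) 0 (x₀ ⊕ (x₁ ⊕ x₂)) (cst 7) refl)

        -- With a single common neighbour `z`, the vertex `p` may add 5 - 2 = 3, so the total is 7
        -- only if what is seen through C is already a neighbour of `p`.
        flank-L : ∀ z → U z ≡ true → A z x → A z p → (∀ u w → u ≢ x → ¬ A u x → U w ≡ false → A w u → A w x → V u ≡ true → A p u) →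
                  cnt (V ∘ hd) x ≤ 4 → AtMost 7 (λ u → V u ≡ true × u ≢ x × TwoReach A V u x)
        flank-L z uz zx zp hC le with one z uz zx zp
        ... | ys , l , cp = cover ys cp (λ u w vu ne na uw a b → cp u vu ne na (hC u w ne na uw a b vu)) (+-mono-≤ le l)

        -- At a vertex with dC + t ≤ 1 at most one of the two corners next to e is not a triangle inside U.
        small-L : Small x → AtMost 7 (λ u → V u ≡ true × u ≢ x × TwoReach A V u x)
        small-L (ux , kx , d5 , q) = case bdec (good e) of λ where
            (inj₁ g) → good-L g (farkas (cnt (V ∘ hd) x ∷ dC x ∷ t x ∷ []) ((1 *[ x₀ ≼ cst 4 ]) ∷ (1 *[ x₁ ⊕ x₂ ≼ cst 1 ]) ∷ []) (le4 ∷ q ∷ []) 0 (x₀ ⊕ x₁) (cst 5) refl)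
            (inj₂ g) → sides (tri e) (tri (nx e)) (U (hd (nx e))) (U (hd (pv e))) refl refl refl refl g
          where
          le4 : cnt (V ∘ hd) x ≤ 4
          le4 = s≤s⁻¹ (≤-trans cVx (≤-reflexive d5))
          two : ∀ {m n} → 1 ≤ m → 1 ≤ n → m + n ≤ 1 → ⊥
          two a b c = 1+n≰n (≤-trans (+-mono-≤ a b) c)
          nt : ∀ {d} → on d ≡ true → tl d ≡ x → tri d ≡ false → 1 ≤ t x
          nt {d} o e′ b = #-pos _ d (⇒cnt {not ∘ tri} o (not-intro b) e′)
          nc : ∀ {d} → on d ≡ true → tl d ≡ x → U (hd d) ≡ false → 1 ≤ dC x
          nc {d} o e′ b = #-pos _ d (⇒cnt {isC} o (not-intro b) e′)
          two-of : ∀ {Q} d d′ → (on d ∧ Q d) ∧ (tl d == x) ≡ true → (on d′ ∧ Q d′) ∧ (tl d′ == x) ≡ true → d ≢ d′ → 2 ≤ cnt Q x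
          two-of d d′ m m′ ne = #-distinct _ (d ∷ d′ ∷ []) ((ne ∷ []) ∷ [] ∷ []) (m ∷ m′ ∷ [])
          noC : 1 ≤ t x → ∀ u w → u ≢ x → ¬ A u x → U w ≡ false → A w u → A w x → V u ≡ true → A p u
          noC b u w ne na uw a (c , oc , tc , refl) _ = ⊥-elim (two (nc {rev c} (trans (on-rev c) oc) refl (trans (cong (U ∘ tl) (rev² c)) (trans (cong U tc) uw))) b q)
          -- The vertex of C in the triangle at the edge is adjacent to both `x` and `p`. In its
          -- 4-cycle `p` lies beside `x`, so the vertex opposite to `x` is adjacent to `p` and has
          -- been counted.
          viaC : ∀ d → on d ≡ true → tl d ≡ x → U (hd d) ≡ false → A (hd d) p → ∀ u w → u ≢ x → ¬ A u x → U w ≡ false → A w u → A w x → V u ≡ true → A p u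
          viaC d od td ud (dp , odp , tdp , hdp) u w ne na uw (du , odu , tdu , refl) (c , oc , tc , hc) vu with d ≟ rev c
          ... | no p′ = ⊥-elim (1+n≰n (≤-trans (two-of {isC} d (rev c) (⇒cnt {isC} od (not-intro ud) td) (⇒cnt {isC} (trans (on-rev c) oc) (not-intro (trans (cong (U ∘ tl) (rev² c)) (trans (cong U tc) uw))) hc) p′) (≤-trans (m≤m+n _ _) q)))
          ... | yes refl = case A? (hd du) p of λ where
              (yes a) → A-sym a
              (no n) → ⊥-elim (A-irr px (trans (sym hc) (trans (cong hd (Copp du c dp odu oc odp (trans (cong U tdu) uw) (trans tc (sym tdu)) (trans tdp (trans (cong tl (rev² c)) (trans tc (sym tdu))))
                          (λ { refl → ne hc }) (λ { refl → true≢false vu (trans (cong V hdp) Vp) }) (λ a → na (subst (A (hd du)) hc a)) (λ a → n (subst (A (hd du)) hdp a)))) hdp)))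
          bad : ∀ {Q : Set} → ⊥ → Q
          bad ()
          sides : ∀ a b c′ d → tri e ≡ a → tri (nx e) ≡ b → U (hd (nx e)) ≡ c′ → U (hd (pv e)) ≡ d → (tri e ∧ tri (nx e)) ∧ (U (hd (nx e)) ∧ U (hd (pv e))) ≡ false →
                  AtMost 7 (λ u → V u ≡ true × u ≢ x × TwoReach A V u x)
          sides true true true true a b c′ d g = bad (true≢false (∧-intro (∧-intro a b) (∧-intro c′ d)) g)
          sides true true true false a b c′ d g = flank-L (hd (nx e)) c′ xz-nx (pz-nx b) (viaC (pv e) on-pv tp d (pz-pv a)) le4
          sides true true false true a b c′ d g = flank-L (hd (pv e)) d xz-pv (pz-pv a) (viaC (nx e) on-nx tn c′ (pz-nx b)) le4
          sides true true false false a b c′ d g = bad (1+n≰n (≤-trans (two-of {isC} (nx e) (pv e) (⇒cnt {isC} on-nx (not-intro c′) tn) (⇒cnt {isC} on-pv (not-intro d) tp) (proj₂ (proj₂ ar))) (≤-trans (m≤m+n _ _) q)))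
          sides true false c′ true a b _ d g = flank-L (hd (pv e)) d xz-pv (pz-pv a) (noC (nt on-nx tn b)) le4
          sides true false c′ false a b _ d g = bad (two (nc on-pv tp d) (nt on-nx tn b) q)
          sides false true true d a b c′ _ g = flank-L (hd (nx e)) c′ xz-nx (pz-nx b) (noC (nt oe te a)) le4
          sides false true false d a b c′ _ g = bad (two (nc on-nx tn c′) (nt oe te a) q)
          sides false false _ _ a b _ _ g = bad (1+n≰n (≤-trans (two-of {not ∘ tri} (nx e) e (⇒cnt {not ∘ tri} on-nx (not-intro b) tn) (⇒cnt {not ∘ tri} oe (not-intro a) te) (proj₁ ar)) (≤-trans (m≤n+m _ _) q)))

        flat-L : Flat x → AtMost 7 (λ u → V u ≡ true × u ≢ x × TwoReach A V u x)
        flat-L fl@(_ , _ , d6 , q) = good-L (flat-good fl e oe te)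
          (≤-trans (≤-reflexive (cong (cnt (V ∘ hd) x +_) (m+n≡0⇒m≡0 (dC x) q))) (≤-trans (≤-reflexive (+-identityʳ _)) (s≤s⁻¹ (≤-trans cVx (≤-reflexive d6)))))

      -- Moving `x` takes the fifth neighbour away from `p`.
      shrinkp : ∀ (U′ : Fin N → Bool) → (∀ z → U′ z ≡ true → (V ∖ x) z ≡ true) → cnt (U′ ∘ hd) p ≤ 4
      shrinkp U′ sub with dart Vx (A-sym px)
      ... | d₀ , m₀ , h₀ = s≤s⁻¹ (≤-trans (s≤s (#-mono λ d q → let (o , v , t′) = cnt⇒ {U′ ∘ hd} q ; (v′ , ne) = ∖⇒ {U = V} (sub _ v) in
            ∧-intro (⇒cnt {V ∘ hd} o v′ t′) (not-intro (≢⇒== λ { refl → ne h₀ })))) (≤-trans (≤-reflexive (sym (#-remove _ d₀ m₀))) cVp))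

    record Outcome (V : Fin N → Bool) (p : Fin N) : Set where
      field
        U′    : Fin N → Bool
        sub   : ∀ z → U′ z ≡ true → V z ≡ true
        keepK : ∀ z → K z ≡ true → U′ z ≡ true
        few   : ∀ z → z ≡ p ⊎ V z ≡ true × U′ z ≡ false → cnt (U′ ∘ hd) z ≤ 4
        lift  : Elim A K U′ → Elim A K V

    along : ∀ {V p x r} → IP s x r → State V p x r → Outcome V p
    along {V} {p} {x} end st = record
        { U′ = V ∖ x ; sub = λ z q → proj₁ (∖⇒ {U = V} q) ; keepK = λ z k → ⇒∖ {U = V} (State.V-K st z k) (λ { refl → true≢false k (proj₁ (proj₂ sm)) })
        ; few = λ where
            z (inj₁ refl) → shrinkp (V ∖ x) (λ _ q → q)
            z (inj₂ (v , u)) → case ∖-false {U = V} u of λ where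
              (inj₁ w) → ⊥-elim (true≢false v w)
              (inj₂ refl) → ≤-trans (cnt-mono {(V ∖ x) ∘ hd} {V ∘ hd} x λ d _ _ q → proj₁ (∖⇒ {U = V} q)) (s≤s⁻¹ (≤-trans cVx (≤-reflexive (proj₁ (proj₂ (proj₂ sm))))))
        ; lift = elim x Vx (proj₁ (proj₂ sm)) (Common.small-L (big-deg sm base) sm) }
      where open Step st
    along {V} {p} {x} (cons {y = y} {r} fl a na ne ip) st = record
        { U′ = O.U′ ; sub = λ z q → proj₁ (∖⇒ {U = V} (O.sub z q)) ; keepK = O.keepK
        ; few = λ where
            z (inj₁ refl) → shrinkp O.U′ O.sub
            z (inj₂ (v , u)) → case z ≟ x of λ where
              (yes refl) → O.few z (inj₁ refl)
              (no n) → O.few z (inj₂ (⇒∖ {U = V} v n , u))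
        ; lift = λ q → elim x Vx kx (Common.flat-L (5≤deg (≤-trans (n≤1+n 5) (≤-reflexive (sym d6)))) fl) (O.lift q) }
      where
      open Step st
      kx : K x ≡ false
      kx = proj₁ (proj₂ fl)
      d6 : dU x ≡ 6
      d6 = proj₁ (proj₂ (proj₂ fl))
      gone′ : ∀ z → U z ≡ true → (V ∖ x) z ≡ false → z ≡ x ⊎ All (λ y → ¬ A z y) (y ∷ r)
      gone′ z uz vz with ∖-false {U = V} vz
      ... | inj₂ e′ = inj₁ e′
      ... | inj₁ v with State.gone st z uz v
      ... | inj₁ refl = inj₂ (State.pr st)
      ... | inj₂ (_ ∷ al) = inj₂ al
      keep : ∀ {zs} → All (λ y → V y ≡ true) zs → All (x ≢_) zs → All (λ y → (V ∖ x) y ≡ true) zs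
      keep [] [] = []
      keep (v ∷ vs) (n ∷ ns) = ⇒∖ {U = V} v (n ∘ sym) ∷ keep vs ns
      st′ : State (V ∖ x) x y r
      st′ = record
        { V⊆U = λ z q → State.V⊆U st z (proj₁ (∖⇒ {U = V} q)) ; gone = gone′ ; pr = na ; px = A-sym a
        ; inV = keep (All.tail (State.inV st)) ne ; Vp = ≢true λ q → proj₂ (∖⇒ {U = V} q) refl ; Up = State.V⊆U st x Vx
        ; V-K = λ z k → ⇒∖ {U = V} (State.V-K st z k) (λ { refl → true≢false k kx })
        ; cVp = ≤-trans (cnt-mono {(V ∖ x) ∘ hd} {V ∘ hd} x λ d _ _ q → proj₁ (∖⇒ {U = V} q)) (s≤s⁻¹ (≤-trans cVx (≤-reflexive d6))) }
      module O = Outcome (along ip st′)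

  IP-U : ∀ {s x r} → Small s → IP s x r → All (λ y → U y ≡ true) (x ∷ r)
  IP-U sm end = proj₁ sm ∷ []
  IP-U sm (cons fl _ _ _ p) = proj₁ fl ∷ IP-U sm p

  -- `y` may go first because 5 + 2 ≤ 7 bounds its L; the fifth neighbour it keeps at that moment is
  -- the next vertex of the path.
  path : ∀ s y → Small s → Small y ⊎ Neutral y → Attached s y → Reduction
  path s y sm ky (x , r , ip , a , na , ne) = record
      { U′ = O.U′ ; sub = λ z q → proj₁ (∖⇒ {U = U} (O.sub z q)) ; keepK = O.keepK
      ; smaller = ≤-<-trans (#-mono O.sub) (#∖ y uy)
      ; bounded = bd
      ; lift = λ q → elim y uy ky′ (single-L y le7) (O.lift q) }
    where
    open Along s sm
    info : Small y ⊎ Neutral y → U y ≡ true × K y ≡ false × dU y ≡ 5 × dU y + dC y ≤ 7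
    info (inj₁ (a , b , c′ , d)) = a , b , c′ , ≤-trans (+-mono-≤ (≤-reflexive c′) (≤-trans (m≤m+n _ _) d)) (n≤1+n 6)
    info (inj₂ (a , b , c′ , d)) = a , b , c′ , +-mono-≤ (≤-reflexive c′) (≤-trans (m≤m+n _ _) (≤-reflexive d))
    uy = proj₁ (info ky)
    ky′ = proj₁ (proj₂ (info ky))
    le7 = proj₂ (proj₂ (proj₂ (info ky)))
    keep : ∀ {zs} → All (λ z → U z ≡ true) zs → All (y ≢_) zs → All (λ z → (U ∖ y) z ≡ true) zs
    keep [] [] = []
    keep (v ∷ vs) (n ∷ ns) = ⇒∖ {U = U} v (n ∘ sym) ∷ keep vs ns
    st : State (U ∖ y) y x r
    st = record
      { V⊆U = λ z q → proj₁ (∖⇒ {U = U} q)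
      ; gone = λ z uz q → case ∖-false {U = U} q of λ where
          (inj₁ w) → ⊥-elim (true≢false uz w)
          (inj₂ e) → inj₁ e
      ; pr = na ; px = A-sym a ; inV = keep (IP-U sm ip) ne ; Vp = ≢true λ q → proj₂ (∖⇒ {U = U} q) refl ; Up = uy
      ; V-K = λ z k → ⇒∖ {U = U} (K⊆U z k) (λ { refl → true≢false k ky′ })
      ; cVp = ≤-trans (cnt-mono {(U ∖ y) ∘ hd} {isU} y λ d _ _ q → proj₁ (∖⇒ {U = U} q)) (≤-reflexive (proj₁ (proj₂ (proj₂ (info ky))))) }
    module O = Outcome (along ip st)
    bd : BoundedC P O.U′
    bd w q with U w in uw
    ... | false = bounded-old w uw O.U′
    ... | true = bounded-new w O.U′ (O.few w (case w ≟ y of λ where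
        (yes e) → inj₁ e
        (no n) → inj₂ (⇒∖ {U = U} uw n , q)))

  record Region (s : Fin N) : Set where
    field
      B   : Fin N → Bool
      Bs  : B s ≡ true
      Bc  : ∀ b → B b ≡ true → Chain s b
      Bcl : ∀ b b′ → Flat b → A b b′ → B b′ ≡ true → B b ≡ true

  -- The fuel `k` bounds the number of vertices that can still join.
  grow : ∀ s k (B : Fin N → Bool) → B s ≡ true → (∀ b → B b ≡ true → Chain s b) → # (not ∘ B) ≤ k → Region s
  grow s k B bs bc le with any? (λ b → (B b ≟ᵇ false) ×-dec (flat? b ×-dec any? λ b′ → A? b b′ ×-dec (B b′ ≟ᵇ true)))
  ... | no none = record { B = B ; Bs = bs ; Bc = bc ; Bcl = λ b b′ fl a h → case bdec (B b) of λ where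
        (inj₁ q) → q
        (inj₂ q) → ⊥-elim (none (b , q , fl , b′ , a , h)) }
  grow s zero B bs bc le | yes (b , q , _) = ⊥-elim (1+n≰n (≤-trans (#-pos _ b (not-intro q)) le))
  grow s (suc k) B bs bc le | yes (b , q , fl , b′ , a , h) =
    grow s k (λ x → B x ∨ (x == b)) (∨-introˡ bs) bc′ (s≤s⁻¹ (≤-trans (≤-trans (s≤s (#-mono λ x p → lem x (not-elim p))) (≤-reflexive (sym (#-remove (not ∘ B) b (not-intro q))))) le))
    where
    bc′ : ∀ x → B x ∨ (x == b) ≡ true → Chain s x
    bc′ x p with ∨-elim {B x} p
    ... | inj₁ r = bc x r
    ... | inj₂ r rewrite ==⇒≡ r = link fl a (bc b′ h)
    lem : ∀ x → B x ∨ (x == b) ≡ false → not (B x) ∧ not (x == b) ≡ true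
    lem x p with B x | x == b
    ... | false | false = refl

  opaque
    region : ∀ s → Region s
    region s = grow s N (_== s) (≡⇒== refl) (λ b e → subst (Chain s) (sym (==⇒≡ e)) base) (#≤n _)

  -- The three ways in which K can be made to carry less than the required deficit: few vertices, a
  -- clique, or two components.
  record OuterShape : Set where
    field
      K≤3   : # K ≤ 3
      shape : # K ≤ 2 ⊎ (∀ a b → K a ≡ true → K b ≡ true → a ≢ b → A a b)
              ⊎ ∃[ S ] (Closed S × ∃[ a ] ∃[ b ] (K a ≡ true × K b ≡ true × S a ≡ true × S b ≡ false))

  module _ (ok : OuterShape) (stuck : ∀ x → U x ≡ true → K x ≡ false → 5 ≤ dU x ⊎ 8 ≤ dU x + dC x)
    (NR : ∀ s y b → Small s → Small y ⊎ Neutral y → y ≢ s → Region.B (region s) b ≡ true → ¬ A y b)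
    (x∗ : Fin N) (Ux∗ : U x∗ ≡ true) (Kx∗ : K x∗ ≡ false) where
    open OuterShape ok
    module R (s : Fin N) = Region (region s)
    open Stuck R.B R.Bs R.Bc R.Bcl stuck NR x∗ Ux∗ Kx∗

    R≥1 : 1 ≤ # root
    R≥1 = root≥1 (≤-trans (s≤s z≤n) big)

    -- By `hasU` a neighbour in C would come with one in U, so the vertex is isolated and forms a
    -- closed set by itself.
    isolated-root : ∀ k → K k ≡ true → dU k ≡ 0 → root k ≡ true
    isolated-root k kk e with hit (_== k) (λ d o → trans (≢⇒== (far (rev d) (trans (on-rev d) o))) (sym (≢⇒== (far d o)))) k (U-alive k (K⊆U k kk)) (≡⇒== refl)
      where
      far : ∀ d → on d ≡ true → tl d ≢ k
      far d o td = case bdec (U (hd d)) of λ where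
        (inj₁ u) → true≢false u (cnt0 e d o td)
        (inj₂ u) → let (d′ , o′ , t′ , u′) = hasU d o u in true≢false u′ (cnt0 e d′ o′ (trans t′ td))
    ... | r , rr , q rewrite ==⇒≡ q = rr

    -- All of K would be isolated, so there would be as many roots as vertices of K, and the
    -- constant 48 in `total` would be left over.
    no-KdU : KdU ≡ 0 → ⊥
    no-KdU z = 1+n≰n {0} (farkas (KdU ∷ # root ∷ # K ∷ []) ((1 *[ 7 ⊗ x₀ ⊕ cst 48 ⊕ 48 ⊗ x₁ ≼ 48 ⊗ x₂ ]) ∷ (48 *[ x₂ ≼ x₁ ]) ∷ [])
        (total ∷ #-mono (λ k kk → isolated-root k kk (dU0 k kk)) ∷ []) 0 (cst 1) (cst 0) refl)
      where
      dU0 : ∀ k → K k ≡ true → dU k ≡ 0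
      dU0 k kk = n≤0⇒n≡0 (≤-trans (≤-trans (≤-reflexive (cong (λ b → if b then dU k else 0) (sym kk))) (sum-≤-one (λ x → if K x then dU x else 0) k)) (≤-reflexive z))

    two-roots : ∀ S → Closed S → ∀ a b → alive a ≡ true → alive b ≡ true → S a ≡ true → S b ≡ false → 2 ≤ # root
    two-roots S cl a b aa ab sa sb with hit S cl a aa sa | hit (not ∘ S) (λ d o → cong not (cl d o)) b ab (not-intro sb)
    ... | r , rr , p | r′ , rr′ , p′ = #-distinct root (r ∷ r′ ∷ []) (((λ { refl → true≢false p (not-elim p′) }) ∷ []) ∷ [] ∷ []) (rr ∷ rr′ ∷ [])

    zero? : ∀ {m} → 7 * m ≤ 0 → m ≡ 0
    zero? {zero} _ = refl

    contradiction₁ : # K ≤ 2 → ⊥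
    contradiction₁ h = no-KdU (zero? (farkas (KdU ∷ # root ∷ # K ∷ []) ((1 *[ 7 ⊗ x₀ ⊕ cst 48 ⊕ 48 ⊗ x₁ ≼ 48 ⊗ x₂ ]) ∷ (48 *[ x₂ ≼ cst 2 ]) ∷ (48 *[ cst 1 ≼ x₁ ]) ∷ [])
        (total ∷ h ∷ R≥1 ∷ []) 0 (7 ⊗ x₀) (cst 0) refl))

    contradiction₃ : ∀ S → Closed S → ∀ a b → K a ≡ true → K b ≡ true → S a ≡ true → S b ≡ false → ⊥
    contradiction₃ S cl a b ka kb sa sb = no-KdU (zero? (farkas (KdU ∷ # root ∷ # K ∷ []) ((1 *[ 7 ⊗ x₀ ⊕ cst 48 ⊕ 48 ⊗ x₁ ≼ 48 ⊗ x₂ ]) ∷ (48 *[ x₂ ≼ cst 3 ]) ∷ (48 *[ cst 2 ≼ x₁ ]) ∷ [])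
        (total ∷ K≤3 ∷ two-roots S cl a b (U-alive a (K⊆U a ka)) (U-alive b (K⊆U b kb)) sa sb ∷ []) 0 (7 ⊗ x₀) (cst 0) refl))

    module Clique (adj : ∀ a b → K a ≡ true → K b ≡ true → a ≢ b → A a b) (K≥3 : 3 ≤ # K) where

      isK toOut : Fin M → Bool
      isK d = K (hd d)
      toOut d = U (hd d) ∧ not (K (hd d))

      inner : ∀ k → K k ≡ true → 2 ≤ cnt isK k
      inner k kk = s≤s⁻¹ (≤-trans K≥3 (≤-trans (≤-reflexive (#-remove K k kk)) (s≤s
          (≤-trans (≤-reflexive (#-def _)) (≤-trans (sum-mono each) (≤-reflexive (#-fibre (λ d → (on d ∧ isK d) ∧ (tl d == k)) hd)))))))
        where
        each : ∀ z → ind (K z ∧ not (z == k)) ≤ # (λ d → ((on d ∧ isK d) ∧ (tl d == k)) ∧ (hd d == z))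
        each z = go (K z ∧ not (z == k)) refl
          where
          go : ∀ b → K z ∧ not (z == k) ≡ b → ind b ≤ # (λ d → ((on d ∧ isK d) ∧ (tl d == k)) ∧ (hd d == z))
          go false _ = z≤n
          go true p with ∧-elim {K z} p
          ... | kz , ne with adj k z kk kz (λ e → ==⇒≢ (not-elim ne) (sym e))
          ... | d , o , t′ , refl = #-pos _ d (∧-intro (⇒cnt {isK} o kz t′) (≡⇒== refl))

      KdU≥ : 6 + # (λ d → (on d ∧ toOut d) ∧ K (tl d)) ≤ KdU
      KdU≥ = ≤-trans (+-mono-≤ six ≤-refl) (≤-trans (≤-reflexive (cong (2 * # K +_) (sym (cnt-sum toOut K))))
          (≤-trans (≤-reflexive (cong (_+ sum (λ x → if K x then cnt toOut x else 0)) (trans (cong (2 *_) (#-def K)) (sym (sum-* 2 _))))) (≤-trans (≤-reflexive (sym (sum-+ _ _))) (sum-mono each))))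
        where
        six : 6 ≤ 2 * # K
        six = *-monoʳ-≤ 2 K≥3
        each : ∀ k → 2 * ind (K k) + (if K k then cnt toOut k else 0) ≤ (if K k then dU k else 0)
        each k = go (K k) refl
          where
          go : ∀ b → K k ≡ b → 2 * ind b + (if b then cnt toOut k else 0) ≤ (if b then dU k else 0)
          go false _ = z≤n
          go true kk = ≤-trans (+-monoˡ-≤ _ (inner k kk)) (cnt-disjoint isU isK toOut k (λ d _ _ → K⊆U (hd d)) (λ d _ _ p → proj₁ (∧-elim p))
            (λ d p → ≢true λ q → true≢false p (not-elim (proj₂ (∧-elim {U (hd d)} q)))))

      -- One edge from K to the rest of U suffices: 7 · (6 + 1) + 48 + 48 = 145 exceeds 48 · 3 =
      -- 144.
      noOut : ∀ d → on d ≡ true → K (tl d) ≡ true → U (hd d) ≡ true → K (hd d) ≡ true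
      noOut d o kt u = case bdec (K (hd d)) of λ where
        (inj₁ q) → q
        (inj₂ q) → ⊥-elim (1+n≰n {0} (farkas (KdU ∷ # root ∷ # K ∷ # (λ d → (on d ∧ toOut d) ∧ K (tl d)) ∷ [])
          ((1 *[ 7 ⊗ x₀ ⊕ cst 48 ⊕ 48 ⊗ x₁ ≼ 48 ⊗ x₂ ]) ∷ (48 *[ x₂ ≼ cst 3 ]) ∷ (48 *[ cst 1 ≼ x₁ ]) ∷ (7 *[ cst 6 ⊕ x₃ ≼ x₀ ]) ∷ (7 *[ cst 1 ≼ x₃ ]) ∷ [])
          (total ∷ K≤3 ∷ R≥1 ∷ KdU≥ ∷ #-pos _ d (∧-intro (∧-intro o (∧-intro u (not-intro q))) kt) ∷ []) 0 (cst 1) (cst 0) refl))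

      -- Around a vertex of C adjacent to K, membership in K spreads along the 4-cycle by `noOut`;
      -- then K would have four vertices.
      noC : ∀ d → on d ≡ true → K (tl d) ≡ true → U (hd d) ≡ true
      noC d o kt = case bdec (U (hd d)) of λ where
          (inj₁ u) → u
          (inj₂ u) → ⊥-elim (1+n≰n (≤-trans (≤-trans (≤-reflexive (sym (deg4 (hd d) (on-alive (rev d) (trans (on-rev d) o)) u))) (#-inj _ hd (elems K) inj (cov u))) (≤-trans (≤-reflexive (length-elems K)) K≤3)))
        where
        or = trans (on-rev d) o
        inj : ∀ i j → on i ∧ (tl i == hd d) ≡ true → on j ∧ (tl j == hd d) ≡ true → hd i ≡ hd j → i ≡ j
        inj i j p q h = simple i j (proj₁ (∧-elim p)) (proj₁ (∧-elim q)) (trans (==⇒≡ (proj₂ (∧-elim {on i} p))) (sym (==⇒≡ (proj₂ (∧-elim {on j} q))))) h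
        cov : U (hd d) ≡ false → ∀ i → on i ∧ (tl i == hd d) ≡ true → hd i ∈ˡ elems K
        cov u i p = ∈-elems K (hd i) (proj₂ (∧-elim {tl i == hd d} (trans (sym (rotc S cl (rev d) i or oi (sym (==⇒≡ ti)))) (∧-intro (≡⇒== refl) (trans (cong (K ∘ tl) (rev² d)) kt)))))
          where
          oi = proj₁ (∧-elim p)
          ti = proj₂ (∧-elim {on i} p)
          S : Fin M → Bool
          S e = (tl e == hd d) ∧ K (hd e)
          spread : ∀ {x y} → A x y → U y ≡ true → K x ≡ true → K y ≡ true
          spread (e , oe , refl , refl) uy kx = noOut e oe kx uy
          cl : ∀ e → S (nx e) ≡ S e
          cl e = go (on e) refl
            where
            go : ∀ b → on e ≡ b → S (nx e) ≡ S e
            go false oe = cong S (nx-off e oe)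
            go true oe = bool-ext
                (λ q → let (a , b) = ∧-elim {tl (nx e) == hd d} q ; te = trans (sym (nx-tl e)) (==⇒≡ a) ; uw = trans (cong U te) u in
                   ∧-intro (≡⇒== te) (spread (A-sym (Cadj e oe uw)) (noCC e oe uw) b))
                (λ q → let (a , b) = ∧-elim {tl e == hd d} q ; uw = trans (cong U (==⇒≡ a)) u in
                   ∧-intro (≡⇒== (trans (nx-tl e) (==⇒≡ a))) (spread (Cadj e oe uw) (noCC (nx e) (trans (nx-on e) oe) (trans (cong U (nx-tl e)) uw)) b))

      closedK : Closed K
      closedK d o = bool-ext (λ h → trans (cong (K ∘ tl) (sym (rev² d))) (fw (rev d) (trans (on-rev d) o) h)) (fw d o)
        where fw : ∀ d → on d ≡ true → K (tl d) ≡ true → K (hd d) ≡ true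
              fw d o k = noOut d o k (noC d o k)

      -- K is now a union of components and `x∗` lies outside it, so there are two roots, and 7 · 6
      -- + 48 + 96 exceeds 144.
      contradiction₂ : ⊥
      contradiction₂ with any? (λ k → K k ≟ᵇ true)
      ... | no none = 1+n≰n (≤-trans K≥3 (≤-trans (≤-reflexive (#-empty λ k → ≢true λ p → none (k , p))) z≤n))
      ... | yes (k , kk) = 1+n≰n {0} (farkas (KdU ∷ # root ∷ # K ∷ # (λ d → (on d ∧ toOut d) ∧ K (tl d)) ∷ [])
          ((1 *[ 7 ⊗ x₀ ⊕ cst 48 ⊕ 48 ⊗ x₁ ≼ 48 ⊗ x₂ ]) ∷ (48 *[ x₂ ≼ cst 3 ]) ∷ (48 *[ cst 2 ≼ x₁ ]) ∷ (7 *[ cst 6 ⊕ x₃ ≼ x₀ ]) ∷ [])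
          (total ∷ K≤3 ∷ two-roots K closedK k x∗ (U-alive k (K⊆U k kk)) (U-alive x∗ Ux∗) kk Kx∗ ∷ KdU≥ ∷ []) 0 (cst 1) (cst 0) refl)

    impossible : ⊥
    impossible with shape
    ... | inj₁ h = contradiction₁ h
    ... | inj₂ (inj₂ (S , cl , a , b , ka , kb , sa , sb)) = contradiction₃ S cl a b ka kb sa sb
    ... | inj₂ (inj₁ adj) = case 3 ≤? # K of λ where
        (yes h) → Clique.contradiction₂ adj h
        (no h) → contradiction₁ (s≤s⁻¹ (≰⇒> h))

  opaque
    reduce : OuterShape → ∀ x∗ → U x∗ ≡ true → K x∗ ≡ false → Reduction
    reduce ok x∗ u∗ k∗ with any? (λ x → (U x ≟ᵇ true) ×-dec ((K x ≟ᵇ false) ×-dec ((dU x ≤? 4) ×-dec (dU x + dC x ≤? 7))))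
    ... | yes (x , u , k , a , b) = single x u k a b
    ... | no none with any? (λ s → any? λ y → any? λ b → small? s ×-dec ((small? y ⊎-dec neutral? y) ×-dec (¬? (y ≟ s) ×-dec ((Region.B (region s) b ≟ᵇ true) ×-dec A? y b))))
    ... | yes (s , y , b , sm , ky , ne , h , a) = path s y sm ky (attach sm ky ne (Region.Bc (region s) b h) a)
    ... | no none′ = ⊥-elim (impossible ok stuck (λ s y b sm ky ne h a → none′ (s , y , b , sm , ky , ne , h , a)) x∗ u∗ k∗)
      where
      stuck : ∀ x → U x ≡ true → K x ≡ false → 5 ≤ dU x ⊎ 8 ≤ dU x + dC x
      stuck x u k = case dU x ≤? 4 of λ where
        (no h) → inj₁ (≰⇒> h)
        (yes h) → case dU x + dC x ≤? 7 of λ where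
          (no h′) → inj₂ (≰⇒> h′)
          (yes h′) → ⊥-elim (none (x , u , k , h , h′))

-- Alternating normalisation and reduction.

module Elimination {N M : ℕ} (𝔻 : Darts N M) (K : Fin N → Bool) where

  open PlaneMaps 𝔻
  open Normalise 𝔻

  KShape : PMap → Set
  KShape P = # K ≤ 3 × (# K ≤ 2 ⊎ (∀ a b → K a ≡ true → K b ≡ true → a ≢ b → PMap.A P a b)
             ⊎ ∃[ S ] (PMap.Closed P S × ∃[ a ] ∃[ b ] (K a ≡ true × K b ≡ true × S a ≡ true × S b ≡ false)))

  -- The next round works on the normalised map with the moved vertices counted as C; the edges
  -- drawn there stay, and `back` carries the result to the original map.
  eliminate : ∀ k P U → # U ≤ k → (∀ x → U x ≡ true → PMap.alive P x ≡ true) → (∀ x → K x ≡ true → U x ≡ true) →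
              KShape P → BoundedC P U → Elim (PMap.A P) K U
  eliminate k P U le al K⊆U ks bd with any? (λ x → (U x ≟ᵇ true) ×-dec (K x ≟ᵇ false))
  ... | no none = done λ x u → case bdec (K x) of λ where
      (inj₁ q) → q
      (inj₂ q) → ⊥-elim (none (x , u , q))
  eliminate zero P U le al K⊆U ks bd | yes (x , u , _) = ⊥-elim (1+n≰n (≤-trans (#-pos U x u) le))
  eliminate (suc k) P U le al K⊆U (K≤3 , sh) bd | yes (x , u , q) = Elim-mono back (R.lift
      (eliminate k P* R.U′ (s≤s⁻¹ (≤-trans R.smaller le)) (λ y p → Normal.U-alive normal y (R.sub y p)) R.keepK (K≤3 , shape*) R.bounded))
    where
    open NormOf (normalise P U al bd)
    shape* : # K ≤ 2 ⊎ (∀ a b → K a ≡ true → K b ≡ true → a ≢ b → PMap.A P* a b)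
             ⊎ ∃[ S ] (PMap.Closed P* S × ∃[ a ] ∃[ b ] (K a ≡ true × K b ≡ true × S a ≡ true × S b ≡ false))
    shape* = case sh of λ where
      (inj₁ h) → inj₁ h
      (inj₂ (inj₁ adj)) → inj₂ (inj₁ λ a b ka kb ne → keepA a b (K⊆U a ka) (K⊆U b kb) (adj a b ka kb ne))
      (inj₂ (inj₂ (S , cl , rest))) → inj₂ (inj₂ (S , keepS S cl , rest))
    red : Reductions.Reduction 𝔻 P* U normal K K⊆U
    red = Reductions.reduce 𝔻 P* U normal K K⊆U (record { K≤3 = K≤3 ; shape = shape* }) x u q
    module R = Reductions.Reduction red
    back : ∀ V → (∀ y → V y ≡ true → U y ≡ true) → ∀ a b → V a ≡ true → V b ≡ true → a ≢ b → TwoReach (PMap.A P) V a b → TwoReach (PMap.A P*) V a b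
    back V sub a b va vb ne (inj₁ e) = inj₁ (keepA a b (sub a va) (sub b vb) e)
    back V sub a b va vb ne (inj₂ (w , vw , wa , wb)) = case bdec (U w) of λ where
      (inj₁ uw) → inj₂ (w , vw , keepA w a uw (sub a va) wa , keepA w b uw (sub b vb) wb)
      (inj₂ uw) → case keepR a b w (sub a va) (sub b vb) ne uw wa wb of λ where
        (inj₁ e) → inj₁ e
        (inj₂ (w′ , uw′ , e₁ , e₂)) → inj₂ (w′ , ≢true (λ p → true≢false (sub w′ p) uw′) , e₁ , e₂)

-- Drawing a triangle on three vertices of one face.

module OuterFace {N M : ℕ} (𝔻 : Darts N M) where

  open PlaneMaps 𝔻
  open Surgery 𝔻

  iter-+ : ∀ {A : Set} (f : A → A) i j x → iter f (i + j) x ≡ iter f i (iter f j x)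
  iter-+ f zero j x = refl
  iter-+ f (suc i) j x = cong f (iter-+ f i j x)

  module Orbits (P : PMap) where
    open PMap P

    φ-inj : ∀ {d e} → φ d ≡ φ e → d ≡ e
    φ-inj {d} {e} p = trans (sym (ψφ d)) (trans (cong ψ p) (ψφ e))

    iter-on : ∀ j d → on d ≡ true → on (iter φ j d) ≡ true
    iter-on zero d o = o
    iter-on (suc j) d o = trans (φ-on (iter φ j d)) (iter-on j d o)

    iter-lab : ∀ j d → on d ≡ true → lab (iter φ j d) ≡ lab d
    iter-lab zero d o = refl
    iter-lab (suc j) d o = trans (φ-lab _ (iter-on j d o)) (iter-lab j d o)

    cancel : ∀ i j X Y → i ≤ j → iter φ i X ≡ iter φ j Y → X ≡ iter φ (j ∸ i) Y
    cancel zero j X Y z≤n e = e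
    cancel (suc i) (suc j) X Y (s≤s le) e = cancel i j X Y le (φ-inj e)

    -- The shortest stretch of the face walk, so that its dart set `T` contains `X` but not `Y`.
    record Arc (X Y : Fin M) : Set where
      field
        len     : ℕ
        arrives : iter φ len X ≡ Y
        first   : ∀ j → j < len → iter φ j X ≢ Y

      In : Fin M → Set
      In d = ∃[ i ] iter φ (toℕ {len} i) X ≡ d

      in? : ∀ d → Dec (In d)
      in? d = any? λ i → iter φ (toℕ i) X ≟ d

      T : Fin M → Bool
      T d = ⌊ in? d ⌋

      ⇒T : ∀ j {d} → j < len → iter φ j X ≡ d → T d ≡ true
      ⇒T j {d} lt e = dec-true (in? d) (fromℕ< lt , trans (cong (λ i → iter φ i X) (toℕ-fromℕ< lt)) e)

      T⇒ : ∀ {d} → T d ≡ true → ∃[ j ] (j < len × iter φ j X ≡ d)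
      T⇒ {d} t with true-dec (in? d) t
      ... | i , e = toℕ i , toℕ<n i , e

    arc : ∀ X Y k → iter φ k X ≡ Y → Arc X Y
    arc X Y k e with upTo k
      where
      upTo : ∀ k → Arc X Y ⊎ (∀ j → j ≤ k → iter φ j X ≢ Y)
      upTo zero with X ≟ Y
      ... | yes e = inj₁ (record { len = 0 ; arrives = e ; first = λ _ () })
      ... | no n = inj₂ λ { zero z≤n → n }
      upTo (suc k) with upTo k
      ... | inj₁ a = inj₁ a
      ... | inj₂ f with iter φ (suc k) X ≟ Y
      ... | yes e = inj₁ (record { len = suc k ; arrives = e ; first = λ j lt → f j (s≤s⁻¹ lt) })
      ... | no n = inj₂ λ j le → case m≤n⇒m<n∨m≡n le of λ where
          (inj₁ lt) → f j (s≤s⁻¹ lt)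
          (inj₂ refl) → n
    ... | inj₁ a = a
    ... | inj₂ f = ⊥-elim (f k ≤-refl e)

    module ArcProps {X Y : Fin M} (a : Arc X Y) (X≢Y : X ≢ Y) (oX : on X ≡ true) where
      open Arc a

      pos : ∃[ k ] len ≡ suc k
      pos = go len refl
        where
        go : ∀ k → len ≡ k → ∃[ k′ ] len ≡ suc k′
        go zero e = ⊥-elim (X≢Y (trans (cong (λ i → iter φ i X) (sym e)) arrives))
        go (suc k) e = k , e

      T-X : T X ≡ true
      T-X = ⇒T 0 (≤-trans (s≤s z≤n) (≤-reflexive (sym (proj₂ pos)))) refl

      T-Y : T Y ≡ false
      T-Y = ≢true λ t → let (j , lt , e) = T⇒ t in first j lt e

      T-ψY : T (ψ Y) ≡ true
      T-ψY = ⇒T (proj₁ pos) (≤-reflexive (sym (proj₂ pos))) (trans (sym (ψφ _)) (cong ψ (trans (cong (λ i → iter φ i X) (sym (proj₂ pos))) arrives)))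

      -- Otherwise the walk would be back at `X` before reaching `Y`, and `Y` would have been met
      -- earlier.
      T-ψX : T (ψ X) ≡ false
      T-ψX = ≢true λ t → let (j , lt , e) = T⇒ t in
        first (len ∸ suc j) (∸-monoʳ-< {len} {suc j} {0} (s≤s z≤n) lt)
          (trans (sym (trans (cong (iter φ (len ∸ suc j)) (trans (cong φ e) (φψ X))) refl)) (trans (sym (iter-+ φ (len ∸ suc j) (suc j) X)) (trans (cong (λ i → iter φ i X) (m∸n+n≡m lt)) arrives)))

      T-lab : ∀ d → on d ≡ true → T d ≡ true → lab d ≡ lab X
      T-lab d o t = let (j , _ , e) = T⇒ t in trans (cong lab (sym e)) (iter-lab j X oX)

      lab-Y : lab Y ≡ lab X
      lab-Y = trans (cong lab (sym arrives)) (iter-lab len X oX)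

      T-φ : ∀ d → φ d ≢ X → φ d ≢ Y → T (φ d) ≡ T d
      T-φ d nX nY = bool-ext fw bw
        where
        fw : T (φ d) ≡ true → T d ≡ true
        fw t with T⇒ t
        ... | zero , _ , e = ⊥-elim (nX (sym e))
        ... | suc j , lt , e = ⇒T j (≤-trans (n≤1+n _) lt) (φ-inj e)
        bw : T d ≡ true → T (φ d) ≡ true
        bw t with T⇒ t
        ... | j , lt , e with m≤n⇒m<n∨m≡n lt
        ... | inj₁ lt′ = ⇒T (suc j) lt′ (cong φ e)
        ... | inj₂ refl = ⊥-elim (nY (trans (cong φ (sym e)) arrives))

  record Triangulated (P : PMap) (a b c : Fin N) : Set where
    field
      P′     : PMap
      alive′ : ∀ x → PMap.alive P′ x ≡ PMap.alive P x
      on′    : ∀ d → PMap.on P d ≡ true → PMap.on P′ d ≡ true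
      new    : ∀ d → PMap.on P′ d ≡ true → PMap.on P d ≡ true ⊎ (tl d ≡ a ⊎ tl d ≡ b ⊎ tl d ≡ c)
      ab     : PMap.A P′ a b
      bc     : PMap.A P′ b c
      ac     : PMap.A P′ a c

  -- The hypothesis `X∉` makes the arcs from `X` to `Y` and from `Y` to `Z` disjoint, so the first
  -- chord leaves the second arc intact.
  module Ordered (P : PMap) (fresh : ∀ x y → PMap.on P (fr x y) ≡ false) (X Y Z : Fin M)
    (oX : PMap.on P X ≡ true) (oY : PMap.on P Y ≡ true) (oZ : PMap.on P Z ≡ true)
    (xy : tl X ≢ tl Y) (yz : tl Y ≢ tl Z) (xz : tl X ≢ tl Z)
    (a₁ : Orbits.Arc P X Y) (a₂ : Orbits.Arc P Y Z) (X∉ : Orbits.Arc.T a₂ X ≡ false) where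
    open PMap P
    open Orbits P

    X≢Y : X ≢ Y
    X≢Y e = xy (cong tl e)
    Y≢Z : Y ≢ Z
    Y≢Z e = yz (cong tl e)
    X≢Z : X ≢ Z
    X≢Z e = xz (cong tl e)

    module A₁ = Arc a₁
    module A₂ = Arc a₂
    module Q₁ = ArcProps a₁ X≢Y oX
    module Q₂ = ArcProps a₂ Y≢Z oY

    hfr : ∀ x y → hd (fr x y) ≡ y
    hfr x y = trans (cong tl (rev-fr x y)) (tl-fr y x)

    g₁ g₂ : Fin M
    g₁ = fr (tl X) (tl Y)
    g₂ = fr (tl Y) (tl Z)

    opaque
      c₁ : Chorded P X Y g₁ A₁.T
      c₁ = Chord.chorded P X Y g₁ oX oY (fresh _ _) xy (tl-fr _ _) (hfr _ _) A₁.T Q₁.T-X Q₁.T-Y Q₁.T-ψX Q₁.T-ψY Q₁.T-lab Q₁.lab-Y (λ d _ → Q₁.T-φ d)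

    module C₁ = Chorded c₁
    P₁ = C₁.P′
    module P₁ = PMap P₁

    disjoint : ∀ d → A₂.T d ≡ true → A₁.T d ≡ false
    disjoint d t = ≢true λ t′ → let (j , jl , je) = A₂.T⇒ t ; (i , il , ie) = A₁.T⇒ t′ in
      case i ≤? j of λ where
        (yes le) → true≢false (A₂.⇒T (j ∸ i) (≤-<-trans (m∸n≤m j i) jl) (sym (cancel i j X Y le (trans ie (sym je))))) X∉
        (no gt) → A₁.first (i ∸ j) (≤-<-trans (m∸n≤m i j) il) (sym (cancel j i Y X (≰⇒≥ gt) (trans je (sym ie))))

    Z∉ : A₁.T Z ≡ false
    Z∉ = ≢true λ t → let (i , il , ie) = A₁.T⇒ t in case i ≤? A₂.len of λ where
        (yes le) → true≢false (A₂.⇒T (A₂.len ∸ i) (∸-monoʳ-< {A₂.len} {i} {0} (i>0 i ie) le) (sym (cancel i A₂.len X Y le (trans ie (sym A₂.arrives))))) X∉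
        (no gt) → A₁.first (i ∸ A₂.len) (≤-<-trans (m∸n≤m i A₂.len) il) (sym (cancel A₂.len i Y X (≰⇒≥ gt) (trans A₂.arrives (sym ie))))
      where
      i>0 : ∀ i → iter φ i X ≡ Z → 0 < i
      i>0 zero e = ⊥-elim (X≢Z e)
      i>0 (suc _) _ = s≤s z≤n

    T₂-off : ∀ {d} → on d ≡ false → A₂.T d ≡ false
    T₂-off {d} o = ≢true λ t → let (j , _ , e) = A₂.T⇒ t in true≢false (trans (cong on (sym e)) (iter-on j Y oY)) o

    og₁ : on g₁ ≡ false
    og₁ = fresh _ _
    org₁ : on (rev g₁) ≡ false
    org₁ = trans (on-rev g₁) og₁

    on-out : ∀ d → on d ≡ true → P₁.on d ≡ true
    on-out d o = C₁.on-o o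

    g₂-off : P₁.on g₂ ≡ false
    g₂-off = ≢true λ p → case C₁.on⇒ p of λ where
      (inj₁ o) → true≢false o (fresh _ _)
      (inj₂ (inj₁ e)) → xy (sym (trans (sym (tl-fr _ _)) (trans (cong tl e) (tl-fr _ _))))
      (inj₂ (inj₂ e)) → xz (sym (trans (sym (hfr _ _)) (trans (cong hd e) (trans (cong tl (rev² g₁)) (tl-fr _ _)))))

    pvY : P₁.pv Y ≡ rev g₁
    pvY = trans (cong P₁.pv (sym C₁.nx-rg′)) (P₁.pvnx (rev g₁))

    pvZ : P₁.pv Z ≡ pv Z
    pvZ = trans (cong P₁.pv (sym (trans (C₁.nx-o′ (pv Z) (trans (pv-on Z) oZ) (λ e → X≢Z (trans (sym e) (nxpv Z))) (λ e → Y≢Z (trans (sym e) (nxpv Z)))) (nxpv Z)))) (P₁.pvnx (pv Z))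

    T₂-lab : ∀ d → P₁.on d ≡ true → A₂.T d ≡ true → P₁.lab d ≡ P₁.lab Y
    T₂-lab d p t with C₁.on⇒ p
    ... | inj₁ o = C₁.lab-o d Y o oY (disjoint d t) Q₁.T-Y (Q₂.T-lab d o t)
    ... | inj₂ (inj₁ refl) = ⊥-elim (true≢false t (T₂-off og₁))
    ... | inj₂ (inj₂ refl) = ⊥-elim (true≢false t (T₂-off org₁))

    T₂-φ : ∀ d → P₁.on d ≡ true → P₁.φ d ≢ Y → P₁.φ d ≢ Z → A₂.T (P₁.φ d) ≡ A₂.T d
    T₂-φ d p nY nZ with C₁.on⇒ p
    ... | inj₂ (inj₁ refl) = ⊥-elim (nY C₁.nx-rg′)
    ... | inj₂ (inj₂ refl) = trans (cong A₂.T (trans (cong P₁.nx (rev² g₁)) C₁.nx-g′)) (trans X∉ (sym (T₂-off org₁)))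
    ... | inj₁ o = case φ d ≟ X of λ where
      (yes e) → trans (cong A₂.T (C₁.nx-a′ (rev d) e)) (trans (T₂-off og₁) (trans (sym X∉) (trans (cong A₂.T (sym e)) (Q₂.T-φ d (λ q → X≢Y (trans (sym e) q)) (λ q → X≢Z (trans (sym e) q))))))
      (no n) → case φ d ≟ Y of λ where
        (yes e) → trans (cong A₂.T (C₁.nx-b′ (rev d) e)) (trans (T₂-off org₁) (sym (trans (cong A₂.T (trans (sym (ψφ d)) (cong ψ e))) Q₂.T-ψX)))
        (no n′) → let eq = C₁.nx-o′ (rev d) (trans (on-rev d) o) n n′ in
          trans (cong A₂.T eq) (Q₂.T-φ d n′ (λ q → nZ (trans eq q)))

    opaque
     c₂ : Chorded P₁ Y Z g₂ A₂.T
     c₂ = Chord.chorded P₁ Y Z g₂ (on-out Y oY) (on-out Z oZ) g₂-off yz (tl-fr _ _) (hfr _ _) A₂.T Q₂.T-X Q₂.T-Y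
      (trans (cong (A₂.T ∘ rev) pvY) (trans (cong A₂.T (rev² g₁)) (T₂-off og₁)))
      (trans (cong (A₂.T ∘ rev) pvZ) Q₂.T-ψY)
      T₂-lab
      (C₁.lab-o Z Y oZ oY Z∉ Q₁.T-Y Q₂.lab-Y)
      T₂-φ

    module C₂ = Chorded c₂
    P₂ = C₂.P′
    module P₂ = PMap P₂

    -- The first two chords are consecutive at the middle vertex, so the third side is the chord
    -- that cuts off this corner.
    next : P₂.nx (rev g₁) ≡ g₂
    next = C₂.nx-a′ (rev g₁) C₁.nx-rg′

    hr : hd (rev g₁) ≡ tl X
    hr = trans (cong tl (rev² g₁)) (tl-fr _ _)
    hn : hd (P₂.nx (rev g₁)) ≡ tl Z
    hn = trans (cong hd next) (hfr _ _)

    off₃ : P₂.on (fr (hd (rev g₁)) (hd (P₂.nx (rev g₁)))) ≡ false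
    off₃ = trans (cong₂ (λ x y → P₂.on (fr x y)) hr hn) (≢true λ p → case C₂.on⇒ p of λ where
      (inj₂ (inj₁ e)) → xy (trans (sym (tl-fr _ _)) (trans (cong tl e) (tl-fr _ _)))
      (inj₂ (inj₂ e)) → xz (trans (sym (tl-fr _ _)) (trans (cong tl e) (hfr _ _)))
      (inj₁ q) → case C₁.on⇒ q of λ where
        (inj₁ o) → true≢false o (fresh _ _)
        (inj₂ (inj₁ e)) → yz (sym (trans (sym (hfr _ _)) (trans (cong hd e) (hfr _ _))))
        (inj₂ (inj₂ e)) → xy (trans (sym (tl-fr _ _)) (trans (cong tl e) (hfr _ _))))

    on-rg : P₂.on (rev g₁) ≡ true
    on-rg = C₂.on-o C₁.on-rg

    g₃ = fr (hd (rev g₁)) (hd (P₂.nx (rev g₁)))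

    opaque
      c₃ : Chorded P₂ (rev (rev g₁)) (P₂.nx (rev (P₂.nx (rev g₁)))) g₃ (λ e → (e == rev (rev g₁)) ∨ (e == P₂.nx (rev g₁)))
      c₃ = Corner.C.chorded P₂ (rev g₁) on-rg (λ e → xz (trans (sym hr) (trans e hn))) off₃

    module C = Chorded c₃

    result : Triangulated P (tl X) (tl Y) (tl Z)
    result = record
      { P′ = C.P′ ; alive′ = λ x → trans (C.alive′ x) (trans (C₂.alive′ x) (C₁.alive′ x)) ; on′ = λ d o → C.on-o (C₂.on-o (C₁.on-o o)) ; new = new
      ; ab = g₁ , C.on-o (C₂.on-o C₁.on-g) , tl-fr _ _ , hfr _ _
      ; bc = g₂ , C.on-o C₂.on-g , tl-fr _ _ , hfr _ _
      ; ac = g₃ , C.on-g , trans (tl-fr _ _) hr , trans (hfr _ _) hn }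
      where
      new : ∀ d → PMap.on C.P′ d ≡ true → on d ≡ true ⊎ (tl d ≡ tl X ⊎ tl d ≡ tl Y ⊎ tl d ≡ tl Z)
      new d p with C.on⇒ p
      ... | inj₂ (inj₁ refl) = inj₂ (inj₁ (trans (tl-fr _ _) hr))
      ... | inj₂ (inj₂ refl) = inj₂ (inj₂ (inj₂ (trans (hfr _ _) hn)))
      ... | inj₁ p₂ with C₂.on⇒ p₂
      ... | inj₂ (inj₁ refl) = inj₂ (inj₂ (inj₁ (tl-fr _ _)))
      ... | inj₂ (inj₂ refl) = inj₂ (inj₂ (inj₂ (hfr _ _)))
      ... | inj₁ p₁ with C₁.on⇒ p₁
      ... | inj₁ o = inj₁ o
      ... | inj₂ (inj₁ refl) = inj₂ (inj₁ (tl-fr _ _))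
      ... | inj₂ (inj₂ refl) = inj₂ (inj₂ (inj₁ (hfr _ _)))

  opaque
    -- Up to exchanging `X` and `Y`, the darts come in the cyclic order that `Ordered` requires.
    triangulate : ∀ (P : PMap) → (∀ x y → PMap.on P (fr x y) ≡ false) → ∀ X Y Z → PMap.on P X ≡ true → PMap.on P Y ≡ true → PMap.on P Z ≡ true →
      tl X ≢ tl Y → tl Y ≢ tl Z → tl X ≢ tl Z → ∀ i j k l → iter (PMap.φ P) i X ≡ Y → iter (PMap.φ P) j Y ≡ Z → iter (PMap.φ P) k Y ≡ X → iter (PMap.φ P) l X ≡ Z →
      Triangulated P (tl X) (tl Y) (tl Z) ⊎ Triangulated P (tl Y) (tl X) (tl Z)
    triangulate P fresh X Y Z oX oY oZ xy yz xz i j k l ei ej ek el = go (bdec (A₂.T X))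
      where
      open PMap P
      open Orbits P
      a₂ : Arc Y Z
      a₂ = arc Y Z j ej
      module A₂ = Arc a₂
      a₃ : Arc X Z
      a₃ = arc X Z l el
      module A₃ = Arc a₃
      Y∉ : A₂.T X ≡ true → A₃.T Y ≡ false
      -- If `X` came between `Y` and `Z`, and `Y` between `X` and `Z`, the walk would return to `Y`
      -- before its first visit to `Z`.
      Y∉ t = ≢true λ t′ →
        let (m , ml , me) = A₂.T⇒ t ; (q , ql , qe) = A₃.T⇒ t′
            e₁ = trans (sym (iter-+ φ (A₂.len ∸ m) m Y)) (trans (cong (λ z → iter φ z Y) (m∸n+n≡m (<⇒≤ ml))) A₂.arrives)
            short : A₃.len ≤ A₂.len ∸ m
            short = ≮⇒≥ λ lt → A₃.first (A₂.len ∸ m) lt (trans (cong (iter φ (A₂.len ∸ m)) (sym me)) e₁)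
            q+m<  : q + m < A₂.len
            q+m<  = ≤-trans (+-monoˡ-≤ m (≤-trans ql short)) (≤-reflexive (m∸n+n≡m (<⇒≤ ml)))
            round : iter φ (q + m) Y ≡ Y
            round = trans (iter-+ φ q m Y) (trans (cong (iter φ q) me) qe)
            again : iter φ (A₂.len ∸ (q + m)) Y ≡ Z
            again = trans (cong (iter φ (A₂.len ∸ (q + m))) (sym round)) (trans (sym (iter-+ φ (A₂.len ∸ (q + m)) (q + m) Y)) (trans (cong (λ z → iter φ z Y) (m∸n+n≡m (<⇒≤ q+m<))) A₂.arrives))
        in A₂.first (A₂.len ∸ (q + m)) (∸-monoʳ-< {A₂.len} {q + m} {0} (pos q m me) (<⇒≤ q+m<)) again
        where
        pos : ∀ q m → iter φ m Y ≡ X → 0 < q + m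
        pos q zero e = ⊥-elim (xy (cong tl (sym e)))
        pos q (suc m) _ = ≤-trans (s≤s z≤n) (m≤n+m (suc m) q)
      go : A₂.T X ≡ true ⊎ A₂.T X ≡ false → Triangulated P (tl X) (tl Y) (tl Z) ⊎ Triangulated P (tl Y) (tl X) (tl Z)
      go (inj₂ f) = inj₁ (Ordered.result P fresh X Y Z oX oY oZ xy yz xz (arc X Y i ei) a₂ f)
      go (inj₁ t) = inj₂ (Ordered.result P fresh Y X Z oY oX oZ (xy ∘ sym) xz yz (arc Y X k ek) a₃ (Y∉ t))

-- From a plane graph to a plane map.

module FromPlaneGraph (G : Graph) (PG : PlaneGraph G) where

  open Graph G
  open PlaneGraph PG

  -- Facial walks of different components share no edge, so the dual becomes connected only after
  -- one face of each component is glued to a common label `zero`. Each gluing costs at most one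
  -- label.
  mergeLabels : ∀ {M} f (on : Fin M → Bool) (rev : Fin M → Fin M) (lab : Fin M → Fin (suc f)) (L : List (Fin (suc f))) →
    (∀ (S : Fin (suc f) → Bool) → (∀ d → on d ≡ true → S (lab (rev d)) ≡ S (lab d)) → (∀ β → β ∈ˡ L → S β ≡ S zero) → ∀ α → S α ≡ S zero) →
    ∃[ f′ ] Σ (Fin (suc f) → Fin (suc f′)) λ h → f ≤ f′ + length L ×
      (∀ (S : Fin (suc f′) → Bool) → (∀ d → on d ≡ true → S (h (lab (rev d))) ≡ S (h (lab d))) → ∀ α β → S α ≡ S β)
  mergeLabels f on rev lab [] du = f , id , ≤-reflexive (sym (+-identityʳ f)) , λ S cl α β → trans (du S cl (λ _ ()) α) (sym (du S cl (λ _ ()) β))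
  mergeLabels f on rev lab (zero ∷ L) du with mergeLabels f on rev lab L (λ S cl h → du S cl λ { _ (here refl) → refl ; β (there q) → h β q })
  ... | f′ , h , le , du′ = f′ , h , ≤-trans le (+-monoʳ-≤ f′ (n≤1+n _)) , du′
  mergeLabels (suc f₀) on rev lab (suc β ∷ L) du with mergeLabels f₀ on rev (h₀ ∘ lab) (List.map h₀ L) du₀
    where
    h₀ : Fin (suc (suc f₀)) → Fin (suc f₀)
    h₀ = mergeF (suc β) zero λ ()
    du₀ : ∀ (S : Fin (suc f₀) → Bool) → (∀ d → on d ≡ true → S (h₀ (lab (rev d))) ≡ S (h₀ (lab d))) →
          (∀ γ → γ ∈ˡ List.map h₀ L → S γ ≡ S zero) → ∀ α → S α ≡ S zero
    du₀ S cl h α with mergeF-surj (suc β) zero (λ ()) α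
    ... | x , e = trans (cong S (sym e)) (du (S ∘ h₀) cl (λ { _ (here refl) → cong S (mergeF-eq (suc β) zero λ ()) ; γ (there q) → h (h₀ γ) (∈-map⁺ h₀ q) }) x)
  ... | f′ , h , le , du′ = f′ , h ∘ mergeF (suc β) zero (λ ()) , ≤-trans (s≤s (≤-trans le (≤-reflexive (cong (f′ +_) (length-map _ L))))) (≤-reflexive (sym (+-suc f′ (length L)))) , du′

  -- The real darts, followed by one spare dart for each ordered pair of vertices.
  Code : Set
  Code = Dart G ⊎ (Fin n × Fin n)

  M₀ : ℕ
  M₀ = (m + m) + n * n

  isDart : Code → Bool
  isDart (inj₁ _) = true
  isDart (inj₂ _) = false

  encE : Dart G → Fin (m + m)
  encE (e , false) = e ↑ˡ m
  encE (e , true)  = m ↑ʳ e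

  decE : Fin m ⊎ Fin m → Dart G
  decE (inj₁ e) = e , false
  decE (inj₂ e) = e , true

  decM : Fin (m + m) ⊎ Fin (n * n) → Code
  decM (inj₁ i) = inj₁ (decE (splitAt m i))
  decM (inj₂ k) = inj₂ (remQuot n k)

  opaque
    enc : Code → Fin M₀
    enc (inj₁ d) = encE d ↑ˡ (n * n)
    enc (inj₂ (x , y)) = (m + m) ↑ʳ combine x y

    dec : Fin M₀ → Code
    dec i = decM (splitAt (m + m) i)

    dec-enc : ∀ c → dec (enc c) ≡ c
    dec-enc (inj₁ (e , false)) = trans (cong decM (splitAt-↑ˡ (m + m) (e ↑ˡ m) (n * n))) (cong (inj₁ ∘ decE) (splitAt-↑ˡ m e m))
    dec-enc (inj₁ (e , true)) = trans (cong decM (splitAt-↑ˡ (m + m) (m ↑ʳ e) (n * n))) (cong (inj₁ ∘ decE) (splitAt-↑ʳ m m e))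
    dec-enc (inj₂ (x , y)) = trans (cong decM (splitAt-↑ʳ (m + m) (n * n) (combine x y))) (cong inj₂ (remQuot-combine x y))

    enc-dec : ∀ i → enc (dec i) ≡ i
    enc-dec i with splitAt (m + m) i in e
    ... | inj₂ k = trans (cong ((m + m) ↑ʳ_) (combine-remQuot {n} n k)) (splitAt⁻¹-↑ʳ e)
    ... | inj₁ j with splitAt m j in e′
    ... | inj₁ a = trans (cong (_↑ˡ (n * n)) (splitAt⁻¹-↑ˡ e′)) (splitAt⁻¹-↑ˡ e)
    ... | inj₂ a = trans (cong (_↑ˡ (n * n)) (splitAt⁻¹-↑ʳ e′)) (splitAt⁻¹-↑ˡ e)

    count-on : # (isDart ∘ dec) ≡ m + m
    count-on = trans (#-++ (m + m) (n * n) (isDart ∘ dec)) (trans (cong₂ _+_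
      (trans (#-cong λ i → cong (isDart ∘ decM) (splitAt-↑ˡ (m + m) i (n * n))) #-all)
      (#-empty λ k → cong (isDart ∘ decM) (splitAt-↑ʳ (m + m) (n * n) k))) (+-identityʳ (m + m)))

  flip² : ∀ d → flip G (flip G d) ≡ d
  flip² (e , true)  = refl
  flip² (e , false) = refl

  tail≢ : ∀ d → tail G d ≢ tail G (flip G d)
  tail≢ (e , false) = loopless e
  tail≢ (e , true)  = loopless e ∘ sym

  tlC : Code → Fin n
  tlC (inj₁ d) = tail G d
  tlC (inj₂ (x , y)) = x

  revC nxC pvC : Code → Code
  revC (inj₁ d) = inj₁ (flip G d)
  revC (inj₂ (x , y)) = inj₂ (y , x)
  nxC (inj₁ d) = inj₁ (σ d)
  nxC (inj₂ p) = inj₂ p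
  pvC (inj₁ d) = inj₁ (σ⁻¹ d)
  pvC (inj₂ p) = inj₂ p

  revC² : ∀ c → revC (revC c) ≡ c
  revC² (inj₁ d) = cong inj₁ (flip² d)
  revC² (inj₂ _) = refl

  lift : (Code → Code) → Fin M₀ → Fin M₀
  lift f i = enc (f (dec i))

  dec-lift : ∀ f i → dec (lift f i) ≡ f (dec i)
  dec-lift f i = dec-enc (f (dec i))

  lift-inv : ∀ f g → (∀ c → f (g c) ≡ c) → ∀ i → lift f (lift g i) ≡ i
  lift-inv f g h i = trans (cong (enc ∘ f) (dec-lift g i)) (trans (cong enc (h (dec i))) (enc-dec i))

  𝔻 : Darts n M₀
  𝔻 = record
    { tl = tlC ∘ dec ; rev = lift revC ; rev² = lift-inv revC revC revC²
    ; fr = λ x y → enc (inj₂ (x , y)) ; tl-fr = λ x y → cong tlC (dec-enc (inj₂ (x , y)))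
    ; rev-fr = λ x y → cong (enc ∘ revC) (dec-enc (inj₂ (x , y))) }

  open PlaneMaps 𝔻 hiding (cut; ins)

  on₀ : Fin M₀ → Bool
  on₀ i = isDart (dec i)

  δ : Dart G → Fin M₀
  δ d = enc (inj₁ d)

  dec-δ : ∀ d → dec (δ d) ≡ inj₁ d
  dec-δ d = dec-enc (inj₁ d)

  δ-on : ∀ d → on₀ (δ d) ≡ true
  δ-on d = cong isDart (dec-δ d)

  δ-tl : ∀ d → tl (δ d) ≡ tail G d
  δ-tl d = cong tlC (dec-δ d)

  δ-rev : ∀ d → rev (δ d) ≡ δ (flip G d)
  δ-rev d = cong (enc ∘ revC) (dec-δ d)

  is-δ : ∀ i → on₀ i ≡ true → ∃[ d ] i ≡ δ d
  is-δ i o with dec i in e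
  ... | inj₁ d = d , trans (sym (enc-dec i)) (cong enc e)

  rot₀ : Rot on₀
  rot₀ = record
    { nx = lift nxC ; pv = lift pvC
    ; nxpv = lift-inv nxC pvC λ { (inj₁ d) → cong inj₁ (σσ⁻¹ d) ; (inj₂ _) → refl }
    ; pvnx = lift-inv pvC nxC λ { (inj₁ d) → cong inj₁ (σ⁻¹σ d) ; (inj₂ _) → refl }
    ; nx-tl = λ i → trans (cong tlC (dec-lift nxC i)) (nt (dec i))
    ; nx-off = λ i o → trans (cong enc (fixed (dec i) o)) (enc-dec i)
    ; rotc = rc }
    where
    nt : ∀ c → tlC (nxC c) ≡ tlC c
    nt (inj₁ d) = σ-tail d
    nt (inj₂ _) = refl
    fixed : ∀ c → isDart c ≡ false → nxC c ≡ c
    fixed (inj₂ _) _ = refl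
    rc : ∀ (S : Fin M₀ → Bool) → (∀ i → S (lift nxC i) ≡ S i) → ∀ i j → on₀ i ≡ true → on₀ j ≡ true → tl i ≡ tl j → S i ≡ S j
    rc S cl i j oi oj e with is-δ i oi | is-δ j oj
    ... | d , refl | d′ , refl with σ-cyclic d d′ (trans (sym (δ-tl d)) (trans e (δ-tl d′)))
    ... | k , refl = sym (go k)
      where
      go : ∀ k → S (δ (iter σ k d)) ≡ S (δ d)
      go zero = refl
      go (suc k) = trans (trans (cong S (sym (cong (enc ∘ nxC) (dec-δ (iter σ k d))))) (cl (δ (iter σ k d)))) (go k)

  labC : Code → Fin (suc f)
  labC (inj₁ d) = suc (faceOf d)
  labC (inj₂ _) = zero

  lab₀ : Fin M₀ → Fin (suc f)
  lab₀ i = labC (dec i)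

  lab-δ : ∀ d → lab₀ (δ d) ≡ suc (faceOf d)
  lab-δ d = cong labC (dec-δ d)

  nx-δ : ∀ d → lift nxC (δ d) ≡ δ (σ d)
  nx-δ d = cong (enc ∘ nxC) (dec-δ d)

  face-σ : ∀ d → faceOf (σ d) ≡ faceOf (flip G d)
  face-σ d = sym (Equivalence.from (faceOf-ok (flip G d) (σ d)) (1 , cong σ (flip² d)))

  corner₀ : ∀ i → on₀ i ≡ true → lab₀ (lift nxC i) ≡ lab₀ (rev i)
  corner₀ i o with is-δ i o
  ... | d , refl = trans (cong lab₀ (nx-δ d)) (trans (lab-δ (σ d)) (trans (cong suc (face-σ d)) (trans (sym (lab-δ (flip G d))) (cong lab₀ (sym (δ-rev d))))))

  AdjDart : ∀ {u v} → Adj G u v → ∃[ d ] (tail G d ≡ u × tail G (flip G d) ≡ v)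
  AdjDart (e , inj₁ p) = (e , false) , cong proj₁ p , cong proj₂ p
  AdjDart (e , inj₂ p) = (e , true) , cong proj₂ p , cong proj₁ p

  DartAdj : ∀ d → Adj G (tail G d) (tail G (flip G d))
  DartAdj (e , false) = e , inj₁ refl
  DartAdj (e , true)  = e , inj₂ refl

  HasDart : Fin n → Set
  HasDart v = ∃[ d ] tail G d ≡ v

  hasDart? : ∀ v → Dec (HasDart v)
  hasDart? v with any? (λ e → (proj₁ (ends e) ≟ v) ⊎-dec (proj₂ (ends e) ≟ v))
  ... | yes (e , inj₁ p) = yes ((e , false) , p)
  ... | yes (e , inj₂ p) = yes ((e , true) , p)
  ... | no none = no λ { ((e , false) , p) → none (e , inj₁ p) ; ((e , true) , p) → none (e , inj₂ p) }

  isolated⇒ : ∀ v → isolatedᵇ G v ≡ true → ¬ HasDart v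
  isolated⇒ v e ((a , b) , p) = go (allFin m) e (∈-allFin a) b p
    where
    go : ∀ es → List.foldr (λ e b → not (⌊ proj₁ (ends e) ≟ v ⌋ ∨ ⌊ proj₂ (ends e) ≟ v ⌋) ∧ b) true es ≡ true → a ∈ˡ es → ∀ b → tail G (a , b) ≡ v → ⊥
    go (x ∷ es) e (there q) b p = go es (proj₂ (∧-elim {not (⌊ proj₁ (ends x) ≟ v ⌋ ∨ ⌊ proj₂ (ends x) ≟ v ⌋)} e)) q b p
    go (x ∷ es) e (here refl) false p = true≢false (∨-introˡ {b = ⌊ proj₂ (ends x) ≟ v ⌋} (≡⇒== p)) (not-elim (proj₁ (∧-elim e)))
    go (x ∷ es) e (here refl) true p = true≢false (∨-introʳ {⌊ proj₁ (ends x) ≟ v ⌋} (≡⇒== p)) (not-elim (proj₁ (∧-elim e)))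

  reach-dart : ∀ {u v} → Reach G u v → HasDart u → HasDart v
  reach-dart here h = h
  reach-dart (step a r) h = let (d , _ , q) = AdjDart a in reach-dart r (flip G d , q)

  reach-isolated : ∀ {u v} → Reach G u v → ¬ HasDart u → u ≡ v
  reach-isolated here n = refl
  reach-isolated (step a r) n = ⊥-elim (n (let (d , p , _) = AdjDart a in d , p))

  rep : Fin c → Fin n
  rep x = proj₁ (compOf-surj x)

  comp-rep : ∀ x → compOf (rep x) ≡ x
  comp-rep x = proj₂ (compOf-surj x)

  reach-rep : ∀ v → Reach G v (rep (compOf v))
  reach-rep v = Equivalence.to (compOf-ok v (rep (compOf v))) (sym (comp-rep (compOf v)))

  -- An arbitrary face of the component. The value `zero` is a default: `rootLabels` runs only over
  -- components with a dart.
  rootLabel : Fin c → Fin (suc f)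
  rootLabel x with hasDart? (rep x)
  ... | yes (d , _) = suc (faceOf d)
  ... | no _ = zero

  rooted : Fin c → Bool
  rooted x = ⌊ hasDart? (rep x) ⌋

  rootLabels : List (Fin (suc f))
  rootLabels = List.map rootLabel (elems rooted)

  -- The faces around a vertex agree, since `σ` only crosses edges; hence all faces of a component
  -- agree with its glued one.
  dual₀ : ∀ (S : Fin (suc f) → Bool) → (∀ i → on₀ i ≡ true → S (lab₀ (rev i)) ≡ S (lab₀ i)) → (∀ β → β ∈ˡ rootLabels → S β ≡ S zero) → ∀ α → S α ≡ S zero
  dual₀ S cl h zero = refl
  dual₀ S cl h (suc a) with faceOf-surj a
  ... | d , refl = go (hasDart? (rep x)) refl
    where
    x = compOf (tail G d)
    T : Dart G → Bool
    T d = S (suc (faceOf d))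
    T-flip : ∀ d → T (flip G d) ≡ T d
    T-flip d = trans (cong S (trans (sym (lab-δ (flip G d))) (cong lab₀ (sym (δ-rev d))))) (trans (cl (δ d) (δ-on d)) (cong S (lab-δ d)))
    T-iter : ∀ k d → T (iter σ k d) ≡ T d
    T-iter zero d = refl
    T-iter (suc k) d = trans (cong (S ∘ suc) (face-σ (iter σ k d))) (trans (T-flip (iter σ k d)) (T-iter k d))
    T-vertex : ∀ d d′ → tail G d ≡ tail G d′ → T d ≡ T d′
    T-vertex d d′ e with σ-cyclic d d′ e
    ... | k , refl = sym (T-iter k d)
    T-reach : ∀ {u v} → Reach G u v → ∀ d d′ → tail G d ≡ u → tail G d′ ≡ v → T d ≡ T d′
    T-reach here d d′ p q = T-vertex d d′ (trans p (sym q))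
    T-reach (step a r) d d′ p q = let (e , p′ , q′) = AdjDart a in
      trans (T-vertex d e (trans p (sym p′))) (trans (sym (T-flip e)) (T-reach r (flip G e) d′ q′ q))
    go : (w : Dec (HasDart (rep x))) → hasDart? (rep x) ≡ w → S (suc (faceOf d)) ≡ S zero
    go (no no-dart) e = ⊥-elim (no-dart (reach-dart (reach-rep (tail G d)) (d , refl)))
    go (yes (d′ , p)) e = trans (T-reach (reach-rep (tail G d)) d d′ refl p) (h (suc (faceOf d′)) (subst (_∈ˡ rootLabels) lem (∈-map⁺ rootLabel (∈-elems rooted x lem′))))
      where
      lem : rootLabel x ≡ suc (faceOf d′)
      lem rewrite e = refl
      lem′ : rooted x ≡ true
      lem′ rewrite e = refl

  length-filter : ∀ {k l} (P : Fin k → Bool) (g : Fin l → Fin k) → length (filterᵇ P (List.tabulate g)) ≡ # (P ∘ g)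
  length-filter {l = zero} P g = sym (#-empty {P = P ∘ g} λ ())
  length-filter {l = suc l} P g = trans (lem (P (g zero)) refl) (sym (trans (#-++ 1 l (P ∘ g)) (cong (_+ # (P ∘ g ∘ suc)) (one (P (g zero)) refl))))
    where
    one : ∀ b → P (g zero) ≡ b → # {1} (λ i → P (g (i ↑ˡ l))) ≡ ind b
    one true e = ≤-antisym (#≤n _) (#-pos _ zero e)
    one false e = #-empty λ { zero → e }
    lem : ∀ b → P (g zero) ≡ b → length (filterᵇ P (g zero ∷ List.tabulate (g ∘ suc))) ≡ ind b + # (P ∘ g ∘ suc)
    lem b e with P (g zero)
    lem true refl | true = cong suc (length-filter P (g ∘ suc))
    lem false refl | false = length-filter P (g ∘ suc)

  -- Distinct isolated vertices lie in distinct components, and these contribute no glued face.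
  few-roots : length rootLabels + numIsolated G ≤ c
  few-roots = ≤-trans (+-mono-≤ (≤-reflexive (length-image rootLabel rooted)) iso) (≤-trans (≤-reflexive (sym (#-split (λ _ → true) rooted))) (≤-reflexive #-all))
    where
    iso : numIsolated G ≤ # (λ x → not (rooted x))
    iso = ≤-trans (≤-reflexive (length-filter (isolatedᵇ G) id)) (≤-trans (#-inj (isolatedᵇ G) compOf (elems (not ∘ rooted)) inj cov) (≤-reflexive (length-elems (not ∘ rooted))))
      where
      inj : ∀ u v → isolatedᵇ G u ≡ true → isolatedᵇ G v ≡ true → compOf u ≡ compOf v → u ≡ v
      inj u v iu iv e = reach-isolated (Equivalence.to (compOf-ok u v) e) (isolated⇒ u iu)
      cov : ∀ v → isolatedᵇ G v ≡ true → compOf v ∈ˡ elems (not ∘ rooted)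
      cov v iv = ∈-elems (not ∘ rooted) (compOf v) (not-intro (≢true λ r →
        isolated⇒ v iv (subst HasDart (sym (reach-isolated (reach-rep v) (isolated⇒ v iv))) (true-dec (hasDart? (rep (compOf v))) r))))

  isRep? : ∀ v → Dec (∃[ x ] rep x ≡ v)
  isRep? v = any? λ x → rep x ≟ v

  root₀ : Fin n → Bool
  root₀ v = ⌊ isRep? v ⌋

  #root₀ : # root₀ ≤ c
  #root₀ = ≤-trans (#-inj root₀ compOf (elems (λ _ → true)) inj (λ v _ → ∈-elems (λ _ → true) (compOf v) refl)) (≤-reflexive (trans (length-elems _) #-all))
    where
    inj : ∀ u v → root₀ u ≡ true → root₀ v ≡ true → compOf u ≡ compOf v → u ≡ v
    inj u v ru rv e with true-dec (isRep? u) ru | true-dec (isRep? v) rv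
    ... | x , refl | y , refl = cong rep (trans (sym (comp-rep x)) (trans e (comp-rep y)))

  Closed₀ : (Fin n → Bool) → Set
  Closed₀ S = ∀ i → on₀ i ≡ true → S (hd i) ≡ S (tl i)

  closed-adj : ∀ S → Closed₀ S → ∀ {u v} → Adj G u v → S u ≡ S v
  closed-adj S cl a with AdjDart a
  ... | d , refl , refl = trans (cong S (sym (δ-tl d))) (trans (sym (cl (δ d) (δ-on d))) (cong S (trans (cong tl (δ-rev d)) (δ-tl (flip G d)))))

  closed-reach : ∀ S → Closed₀ S → ∀ {u v} → Reach G u v → S u ≡ S v
  closed-reach S cl here = refl
  closed-reach S cl (step a r) = trans (closed-adj S cl a) (closed-reach S cl r)

  record Start : Set where
    field
      P₀     : PMap
      on≡    : ∀ i → PMap.on P₀ i ≡ on₀ i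
      alive≡ : ∀ v → PMap.alive P₀ v ≡ true
      nx≡    : ∀ i → PMap.nx P₀ i ≡ lift nxC i

  opaque
    start : Start
    start with mergeLabels f on₀ rev lab₀ rootLabels dual₀
    ... | f′ , h , le , du = record
      { P₀ = record
          { f = suc f′ ; on = on₀
          ; on-rev = λ i → trans (cong isDart (dec-lift revC i)) (ir (dec i))
          ; alive = λ _ → true ; on-alive = λ _ _ → refl
          ; loopless = ll ; rot = rot₀ ; lab = h ∘ lab₀ ; corner = λ i o → cong h (corner₀ i o) ; dual = du
          ; root = root₀
          ; hit = λ S cl v _ sv → rep (compOf v) , dec-true (isRep? _) (compOf v , refl) , trans (sym (closed-reach S cl (reach-rep v))) sv
          -- Glued faces and isolated vertices number at most `c` together, so of the 2c in Euler's
          -- formula one c is left for the roots; the extra 2 is the label `zero`.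
          ; euler = farkas (# on₀ ∷ # root₀ ∷ # {n} (λ _ → true) ∷ f′ ∷ n ∷ m ∷ f ∷ numIsolated G ∷ c ∷ length rootLabels ∷ [])
              ((1 *[ x₀ ≼ x₅ ⊕ x₅ ]) ∷ (2 *[ x₁ ≼ x₈ ]) ∷ (2 *[ x₄ ≼ x₂ ]) ∷ (2 *[ x₆ ≼ x₃ ⊕ x₉ ]) ∷ (2 *[ x₉ ⊕ x₇ ≼ x₈ ]) ∷ (2 *[ x₅ ⊕ (x₈ ⊕ x₈) ≼ x₄ ⊕ x₆ ⊕ x₇ ]) ∷ [])
              (≤-reflexive count-on ∷ #root₀ ∷ ≤-reflexive (sym #-all) ∷ le ∷ few-roots ∷ ≤-reflexive (sym euler) ∷ []) 0
              (x₀ ⊕ (cst 2 ⊕ 2 ⊗ x₁)) (2 ⊗ x₂ ⊕ 2 ⊗ (cst 1 ⊕ x₃)) refl }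
      ; on≡ = λ _ → refl ; alive≡ = λ _ → refl ; nx≡ = λ _ → refl }
      where
      x₈ x₉ : Lin 10
      x₈ = var (suc (suc (suc (suc (suc (suc (suc (suc zero))))))))
      x₉ = var (suc (suc (suc (suc (suc (suc (suc (suc (suc zero)))))))))
      ir : ∀ c → isDart (revC c) ≡ isDart c
      ir (inj₁ _) = refl
      ir (inj₂ _) = refl
      ll : ∀ i → on₀ i ≡ true → tl i ≢ hd i
      ll i o with is-δ i o
      ... | d , refl = λ e → tail≢ d (trans (sym (δ-tl d)) (trans e (trans (cong tl (δ-rev d)) (δ-tl (flip G d)))))

  open Start start public

  A⇒Adj : ∀ {u v} → PMap.A P₀ u v → Adj G u v
  A⇒Adj (i , o , refl , refl) with is-δ i (trans (sym (on≡ i)) o)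
  ... | d , refl = subst₂ (Adj G) (sym (δ-tl d)) (sym (trans (cong tl (δ-rev d)) (δ-tl (flip G d)))) (DartAdj d)

  Adj⇒A : ∀ {u v} → Adj G u v → PMap.A P₀ u v
  Adj⇒A a with AdjDart a
  ... | d , refl , refl = δ d , trans (on≡ (δ d)) (δ-on d) , δ-tl d , trans (cong tl (δ-rev d)) (δ-tl (flip G d))

  fresh₀ : ∀ x y → PMap.on P₀ (fr x y) ≡ false
  fresh₀ x y = trans (on≡ _) (cong isDart (dec-enc (inj₂ (x , y))))

  iter-δ : ∀ k d → iter (PMap.φ P₀) k (δ d) ≡ δ (iter φ k d)
  iter-δ zero d = refl
  iter-δ (suc k) d = trans (cong (PMap.φ P₀) (iter-δ k d)) (trans (nx≡ _) (trans (cong (lift nxC) (δ-rev (iter φ k d))) (nx-δ (flip G (iter φ k d)))))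

  closed-comp : ∀ x → PMap.Closed P₀ (λ v → compOf v == x)
  closed-comp x i o = cong (_== x) (sym (Equivalence.from (compOf-ok _ _) (step (A⇒Adj (i , o , refl , refl)) here)))

  -- An isolated vertex would be alone in its component.
  outerDart : ∀ {u v} → u ≢ v → compOf u ≡ compOf v → OnOuterFace u → ∃[ d ] (tail G d ≡ u × outer (faceOf d) ≡ true)
  outerDart ne e (inj₂ h) = h
  outerDart {u} {v} ne e (inj₁ iso) = ⊥-elim (ne (reach-isolated (Equivalence.to (compOf-ok u v) e) (isolated⇒ u iso)))

  sameOrbit : ∀ d d′ → outer (faceOf d) ≡ true → outer (faceOf d′) ≡ true → compOf (tail G d) ≡ compOf (tail G d′) → ∃[ k ] iter (PMap.φ P₀) k (δ d) ≡ δ d′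
  sameOrbit d d′ o o′ e with Equivalence.to (faceOf-ok d d′) (outer-one d d′ o o′ (Equivalence.to (compOf-ok _ _) e))
  ... | k , p = k , trans (iter-δ k d) (cong δ p)

-- A rank increasing along the ordering: the eliminated vertices come last, in reverse order of elimination.
rank : ∀ {n} {A : Fin n → Fin n → Set} {K U : Fin n → Bool} → Elim A K U → Fin n → ℕ
rank (done _) x = toℕ x
rank {n} {U = U} (elim v _ _ _ e) x = if x == v then n + # U else rank e x

-- The linear ordering read off from an elimination.

module _ {n : ℕ} {A : Fin n → Fin n → Set} {K : Fin n → Bool} where

  rank-v : ∀ {U} {v : Fin n} {a b c} (e : Elim A K (U ∖ v)) → rank (elim {U = U} v a b c e) v ≡ n + # U
  rank-v {v = v} e rewrite ≡⇒== {x = v} refl = refl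

  rank-o : ∀ {U} {v x : Fin n} {a b c} (e : Elim A K (U ∖ v)) → x ≢ v → rank (elim {U = U} v a b c e) x ≡ rank e x
  rank-o e ne rewrite ≢⇒== ne = refl

  rank< : ∀ {U} (e : Elim A K U) x → U x ≡ true → rank e x < n + suc (# U)
  rank< (done _) x u = ≤-trans (toℕ<n x) (m≤m+n n _)
  rank< {U} (elim v uv k l e) x u = case x ≟ v of λ where
    (yes refl) → ≤-trans (≤-reflexive (cong suc (rank-v {U} {x} {uv} {k} {l} e))) (≤-reflexive (sym (+-suc n (# U))))
    (no ne) → ≤-trans (≤-reflexive (cong suc (rank-o {U} {v} {x} {uv} {k} {l} e ne)))
      (≤-trans (rank< e x (⇒∖ {U = U} u ne)) (+-monoʳ-≤ n (≤-trans (≤-reflexive (sym (#-remove U v uv))) (n≤1+n _))))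

  below : ∀ {U} v {uv k l} (e : Elim A K (U ∖ v)) x → U x ≡ true → x ≢ v → rank (elim {U = U} v uv k l e) x < rank (elim {U = U} v uv k l e) v
  below {U} v {uv} {k} {l} e x u ne = ≤-trans (≤-reflexive (cong suc (rank-o {U} {v} {x} {uv} {k} {l} e ne)))
    (≤-trans (rank< e x (⇒∖ {U = U} u ne)) (≤-reflexive (trans (cong (n +_) (sym (#-remove U v uv))) (sym (rank-v {U} {v} {uv} {k} {l} e)))))

  rank-inj : ∀ {U} (e : Elim A K U) x y → U x ≡ true → U y ≡ true → rank e x ≡ rank e y → x ≡ y
  rank-inj (done _) x y _ _ r = toℕ-injective r
  rank-inj {U} el@(elim v uv k l e) x y ux uy r = case x ≟ v of λ where
    (yes refl) → case y ≟ v of λ where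
      (yes refl) → refl
      (no ny) → ⊥-elim (<-irrefl (sym r) (below v {uv} {k} {l} e y uy ny))
    (no nx) → case y ≟ v of λ where
      (yes refl) → ⊥-elim (<-irrefl r (below v {uv} {k} {l} e x ux nx))
      (no ny) → rank-inj e x y (⇒∖ {U = U} ux nx) (⇒∖ {U = U} uy ny)
        (trans (sym (rank-o {U} {v} {x} {uv} {k} {l} e nx)) (trans r (rank-o {U} {v} {y} {uv} {k} {l} e ny)))

  K-first : ∀ {U} (e : Elim A K U) → (∀ x → K x ≡ true → U x ≡ true) → ∀ x y → K x ≡ true → U y ≡ true → K y ≡ false → rank e x < rank e y
  K-first (done d) KU x y kx uy ky = ⊥-elim (true≢false (d y uy) ky)
  K-first {U} (elim v uv k l e) KU x y kx uy ky = case y ≟ v of λ where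
      (yes refl) → below v {uv} {k} {l} e x (KU x kx) (x≢v kx)
      (no ny) → subst₂ _<_ (sym (rank-o {U} {v} {x} {uv} {k} {l} e (x≢v kx))) (sym (rank-o {U} {v} {y} {uv} {k} {l} e ny))
        (K-first e (λ z kz → ⇒∖ {U = U} (KU z kz) (x≢v kz)) x y kx (⇒∖ {U = U} uy ny) ky)
    where
    x≢v : ∀ {z} → K z ≡ true → z ≢ v
    x≢v kz refl = true≢false kz k

  Left : (Fin n → Bool) → (Fin n → ℕ) → Fin n → Fin n → Set
  Left U r v u = U u ≡ true × r u < r v × (A u v ⊎ (∃[ w ] (U w ≡ true × r v < r w × A w u × A w v)) ⊎ (∃[ w ] (U w ≡ false × A w u × A w v)))

  -- For the last vertex the clause about later neighbours is void. For every other vertex, a common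
  -- neighbour `v₀` that comes later turns into one outside the current set.
  left : # K ≤ 7 → ∀ {U} (e : Elim A K U) v → U v ≡ true → AtMost 7 (Left U (rank e) v)
  left K≤7 (done d) v uv = elems K , ≤-trans (≤-reflexive (length-elems K)) K≤7 , λ u (uu , _) → ∈-elems K u (d u uu)
  left K≤7 {U} (elim v₀ u₀ k l@(xs , le , cov) e) v uv = case v ≟ v₀ of λ where
      (yes refl) → xs , le , λ u h → cov u (last u h)
      (no ne) → let (ys , le′ , cov′) = left K≤7 e v (⇒∖ {U = U} uv ne) in ys , le′ , λ u h → cov′ u (smaller ne u h)
    where
    r = rank (elim {U = U} v₀ u₀ k l e)
    top : ∀ x → U x ≡ true → r x ≤ r v₀
    top x ux = case x ≟ v₀ of λ where
      (yes refl) → ≤-refl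
      (no ne) → <⇒≤ (below v₀ {u₀} {k} {l} e x ux ne)
    last : ∀ u → Left U r v₀ u → U u ≡ true × u ≢ v₀ × TwoReach A U u v₀
    last u (uu , lt , a) = uu , (λ { refl → <-irrefl refl lt }) , (case a of λ where
      (inj₁ b) → inj₁ b
      (inj₂ (inj₁ (w , uw , lt′ , _))) → ⊥-elim (<-irrefl refl (<-≤-trans lt′ (top w uw)))
      (inj₂ (inj₂ h)) → inj₂ h)
    ro : ∀ {x} → x ≢ v₀ → r x ≡ rank e x
    ro = rank-o {U} {v₀} {_} {u₀} {k} {l} e
    smaller : v ≢ v₀ → ∀ u → Left U r v u → Left (U ∖ v₀) (rank e) v u
    smaller ne u (uu , lt , a) = ⇒∖ {U = U} uu nu , subst₂ _<_ (ro nu) (ro ne) lt , (case a of λ where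
        (inj₁ b) → inj₁ b
        (inj₂ (inj₁ (w , uw , lt′ , p , q))) → case w ≟ v₀ of λ where
          (yes refl) → inj₂ (inj₂ (w , ≢true (λ h → proj₂ (∖⇒ {U = U} h) refl) , p , q))
          (no nw) → inj₂ (inj₁ (w , ⇒∖ {U = U} uw nw , subst₂ _<_ (ro ne) (ro nw) lt′ , p , q))
        (inj₂ (inj₂ (w , uw , p , q))) → inj₂ (inj₂ (w , ≢true (λ h → true≢false (proj₁ (∖⇒ {U = U} h)) uw) , p , q)))
      where
      nu : u ≢ v₀
      nu refl = <-irrefl refl (<-≤-trans lt (top v uv))

-- Completing K in the outer face, and the final ordering.

module _ (G : Graph) (PG : PlaneGraph G) (K : List (Fin (Graph.n G))) (K≤3 : length K ≤ 3)
  (Kout : ∀ v → v ∈ˡ K → PlaneGraph.OnOuterFace PG v) (C : Subset (Graph.n G)) (K∉C : ∀ v → v ∈ˡ K → v ∉ C)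
  (C≤4 : ∀ v → v ∈ C → AtMost 4 (λ u → u ∉ C × Adj G v u)) where

  open Graph G
  open PlaneGraph PG using (compOf; outer; faceOf)
  open FromPlaneGraph G PG
  open PlaneMaps 𝔻
  open Normalise 𝔻
  open OuterFace 𝔻

  U Kᵇ : Fin n → Bool
  U v = not (lookup C v)
  Kᵇ v = elemᵇ v K

  U⇒∉ : ∀ {v} → U v ≡ true → v ∉ C
  U⇒∉ {v} u h = true≢false ([]=⇒lookup h) (not-elim u)

  ∉⇒U : ∀ {v} → v ∉ C → U v ≡ true
  ∉⇒U {v} h = not-intro (≢true λ e → h (lookup⇒[]= v C e))

  ¬U⇒∈ : ∀ {v} → U v ≡ false → v ∈ C
  ¬U⇒∈ {v} u = lookup⇒[]= v C (lem u)
    where lem : ∀ {b} → not b ≡ false → b ≡ true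
          lem {true} _ = refl

  K⊆U : ∀ v → Kᵇ v ≡ true → U v ≡ true
  K⊆U v k = ∉⇒U (K∉C v (elemᵇ⇒∈ K k))

  #K≤ : ∀ xs → (∀ v → v ∈ˡ K → v ∈ˡ xs) → # Kᵇ ≤ length xs
  #K≤ xs h = #-inj Kᵇ id xs (λ _ _ _ _ e → e) λ v k → h v (elemᵇ⇒∈ K k)

  #K≤3 : # Kᵇ ≤ 3
  #K≤3 = ≤-trans (#K≤ K λ _ p → p) K≤3

  bounded₀ : ∀ w → U w ≡ false → AtMost 4 (λ u → U u ≡ true × Adj G w u)
  bounded₀ w u = let (xs , le , cov) = C≤4 w (¬U⇒∈ u) in xs , le , λ v (uv , a) → cov v (U⇒∉ uv , a)

  record Ready : Set where
    field
      P₁    : PMap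
      al    : ∀ v → PMap.alive P₁ v ≡ true
      adj   : ∀ {u v} → Adj G u v → PMap.A P₁ u v
      bd    : BoundedC P₁ U
      shape : # Kᵇ ≤ 2 ⊎ (∀ a b → Kᵇ a ≡ true → Kᵇ b ≡ true → a ≢ b → PMap.A P₁ a b)
              ⊎ ∃[ S ] (PMap.Closed P₁ S × ∃[ a ] ∃[ b ] (Kᵇ a ≡ true × Kᵇ b ≡ true × S a ≡ true × S b ≡ false))

  plain : # Kᵇ ≤ 2 ⊎ ∃[ S ] (PMap.Closed P₀ S × ∃[ a ] ∃[ b ] (Kᵇ a ≡ true × Kᵇ b ≡ true × S a ≡ true × S b ≡ false)) → Ready
  plain h = record
    { P₁ = P₀ ; al = alive≡ ; adj = Adj⇒A
    ; bd = λ w u → let (xs , le , cov) = bounded₀ w u in xs , le , λ v (uv , a) → cov v (uv , A⇒Adj a)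
    ; shape = [ inj₁ , (λ s → inj₂ (inj₂ s)) ] h }

  -- Here no edge is drawn: the component of `a` is itself the separating closed set.
  split : ∀ a b → a ∈ˡ K → b ∈ˡ K → compOf a ≢ compOf b → Ready
  split a b ka kb ne = plain (inj₂ ((λ v → compOf v == compOf a) , closed-comp (compOf a) , a , b , ∈⇒elemᵇ ka , ∈⇒elemᵇ kb , ≡⇒== refl , ≢⇒== (ne ∘ sym)))

  -- Every new dart starts in K, which is disjoint from C, so no vertex of C gains a neighbour.
  clique : ∀ a b c → (∀ v → v ∈ˡ K → v ∈ˡ (a ∷ b ∷ c ∷ [])) → a ∈ˡ K → b ∈ˡ K → c ∈ˡ K → Triangulated P₀ a b c → Ready
  clique a b c cov ka kb kc tr = record
    { P₁ = P′ ; al = λ v → trans (alive′ v) (alive≡ v)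
    ; adj = λ e → let (d , o , t , h) = Adj⇒A e in d , on′ d o , t , h
    ; bd = λ w u → let (xs , le , cv) = bounded₀ w u in xs , le , λ v (uv , a) → cv v (uv , old w u a)
    ; shape = inj₂ (inj₁ λ x y kx ky ne → pair (cov x (elemᵇ⇒∈ K kx)) (cov y (elemᵇ⇒∈ K ky)) ne) }
    where
    open Triangulated tr
    old : ∀ w → U w ≡ false → ∀ {v} → PMap.A P′ w v → Adj G w v
    old w u (d , o , refl , h) with new d o
    ... | inj₁ o′ = A⇒Adj (d , o′ , refl , h)
    ... | inj₂ (inj₁ e) = ⊥-elim (true≢false (trans (cong U e) (∉⇒U (K∉C a ka))) u)
    ... | inj₂ (inj₂ (inj₁ e)) = ⊥-elim (true≢false (trans (cong U e) (∉⇒U (K∉C b kb))) u)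
    ... | inj₂ (inj₂ (inj₂ e)) = ⊥-elim (true≢false (trans (cong U e) (∉⇒U (K∉C c kc))) u)
    pair : ∀ {x y} → x ∈ˡ (a ∷ b ∷ c ∷ []) → y ∈ˡ (a ∷ b ∷ c ∷ []) → x ≢ y → PMap.A P′ x y
    pair (here refl) (here refl) ne = ⊥-elim (ne refl)
    pair (here refl) (there (here refl)) ne = ab
    pair (here refl) (there (there (here refl))) ne = ac
    pair (there (here refl)) (here refl) ne = PMap.A-sym P′ ab
    pair (there (here refl)) (there (here refl)) ne = ⊥-elim (ne refl)
    pair (there (here refl)) (there (there (here refl))) ne = bc
    pair (there (there (here refl))) (here refl) ne = PMap.A-sym P′ ac
    pair (there (there (here refl))) (there (here refl)) ne = PMap.A-sym P′ bc
    pair (there (there (here refl))) (there (there (here refl))) ne = ⊥-elim (ne refl)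

  triple : ∀ a b c → (∀ v → v ∈ˡ K → v ∈ˡ (a ∷ b ∷ c ∷ [])) → a ∈ˡ K → b ∈ˡ K → c ∈ˡ K → a ≢ b → b ≢ c → a ≢ c →
           compOf a ≡ compOf b → compOf a ≡ compOf c → Ready
  triple a b c cov ka kb kc a≢b b≢c a≢c eb ec
    with outerDart a≢b eb (Kout a ka) | outerDart (a≢b ∘ sym) (sym eb) (Kout b kb) | outerDart (a≢c ∘ sym) (sym ec) (Kout c kc)
  ... | x , refl , ox | y , refl , oy | z , refl , oz
    with sameOrbit x y ox oy eb | sameOrbit y z oy oz (trans (sym eb) ec) | sameOrbit y x oy ox (sym eb) | sameOrbit x z ox oz ec
  ... | i , ei | j , ej | k , ek | l , el
    with triangulate P₀ fresh₀ (δ x) (δ y) (δ z) (on x) (on y) (on z)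
           (λ e → a≢b (trans (sym (δ-tl x)) (trans e (δ-tl y)))) (λ e → b≢c (trans (sym (δ-tl y)) (trans e (δ-tl z)))) (λ e → a≢c (trans (sym (δ-tl x)) (trans e (δ-tl z))))
           i j k l ei ej ek el
    where
    on : ∀ d → PMap.on P₀ (δ d) ≡ true
    on d = trans (on≡ (δ d)) (δ-on d)
  ... | inj₁ tr = clique _ _ _ cov ka kb kc (subst (λ w → Triangulated P₀ _ _ w) (δ-tl z) (subst₂ (λ u v → Triangulated P₀ u v (tl (δ z))) (δ-tl x) (δ-tl y) tr))
  ... | inj₂ tr = clique _ _ _ (λ v p → swap (cov v p)) kb ka kc (subst (λ w → Triangulated P₀ _ _ w) (δ-tl z) (subst₂ (λ u v → Triangulated P₀ u v (tl (δ z))) (δ-tl y) (δ-tl x) tr))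
    where
    swap : ∀ {v p q r : Fin n} → v ∈ˡ (p ∷ q ∷ r ∷ []) → v ∈ˡ (q ∷ p ∷ r ∷ [])
    swap (here e) = there (here e)
    swap (there (here e)) = here e
    swap (there (there h)) = there (there h)

  ready : Ready
  ready = go K (λ _ p → p) (λ _ p → p) K≤3
    where
    -- `K` is a list and may repeat vertices; repetitions lead back to the case of at most two
    -- vertices.
    go : ∀ xs → (∀ v → v ∈ˡ K → v ∈ˡ xs) → (∀ v → v ∈ˡ xs → v ∈ˡ K) → length xs ≤ 3 → Ready
    go [] cov _ _ = plain (inj₁ (≤-trans (#K≤ [] cov) z≤n))
    go (a ∷ []) cov _ _ = plain (inj₁ (≤-trans (#K≤ (a ∷ []) cov) (s≤s z≤n)))
    go (a ∷ b ∷ []) cov _ _ = plain (inj₁ (#K≤ (a ∷ b ∷ []) cov))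
    go (_ ∷ _ ∷ _ ∷ _ ∷ _) _ _ (s≤s (s≤s (s≤s ())))
    go (a ∷ b ∷ c ∷ []) cov sub _ = case (a ≟ b) of λ where
      (yes refl) → plain (inj₁ (#K≤ (b ∷ c ∷ []) λ v p → case cov v p of λ where
        (here e) → here e
        (there q) → q))
      (no a≢b) → case (b ≟ c) of λ where
        (yes refl) → plain (inj₁ (#K≤ (a ∷ b ∷ []) λ v p → case cov v p of λ where
          (here e) → here e
          (there (here e)) → there (here e)
          (there (there (here e))) → there (here e)))
        (no b≢c) → case (a ≟ c) of λ where
          (yes refl) → plain (inj₁ (#K≤ (b ∷ a ∷ []) λ v p → case cov v p of λ where
            (here e) → there (here e)
            (there q) → q))
          (no a≢c) → case (compOf a ≟ compOf b) of λ where
            (no ne) → split a b (sub a (here refl)) (sub b (there (here refl))) ne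
            (yes eb) → case (compOf a ≟ compOf c) of λ where
              (no ne) → split a c (sub a (here refl)) (sub c (there (there (here refl)))) ne
              (yes ec) → triple a b c cov (sub a (here refl)) (sub b (there (here refl))) (sub c (there (there (here refl)))) a≢b b≢c a≢c eb ec

  ordering : Elim (Adj G) Kᵇ U
  ordering = Elim-mono (λ V _ u v _ _ _ → up V u v) (Elimination.eliminate 𝔻 Kᵇ n R.P₁ U (#≤n U) (λ x _ → R.al x) K⊆U (#K≤3 , R.shape) R.bd)
    where
    module R = Ready ready
    up : ∀ V u v → TwoReach (Adj G) V u v → TwoReach (PMap.A R.P₁) V u v
    up V u v (inj₁ a) = inj₁ (R.adj a)
    up V u v (inj₂ (w , vw , a , b)) = inj₂ (w , vw , R.adj a , R.adj b)

  Adj-sym : ∀ {u v} → Adj G u v → Adj G v u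
  Adj-sym (e , inj₁ p) = e , inj₂ p
  Adj-sym (e , inj₂ p) = e , inj₁ p

  infix 4 _≺_
  _≺_ : Fin n → Fin n → Set
  u ≺ v = rank ordering u < rank ordering v

  linear : StrictLinearOrderOn (λ v → v ∉ C) _≺_
  linear = record
    { irrefl = λ _ → <-irrefl refl
    ; trans = λ _ _ _ → <-trans
    ; total = λ {x} {y} p q ne → case <-cmp (rank ordering x) (rank ordering y) of λ where
        (tri< lt _ _) → inj₁ lt
        (tri≈ _ e _) → ⊥-elim (ne (rank-inj ordering x y (∉⇒U p) (∉⇒U q) e))
        (tri> _ _ gt) → inj₂ gt }

  degenerate : TwoDegenerate G 7 C _≺_
  degenerate v v∉ = let (xs , le , cov) = left (≤-trans #K≤3 (m≤m+n 3 4)) ordering v (∉⇒U v∉) in xs , le , λ u (u∉ , lt , a) → cov u (∉⇒U u∉ , lt , (case a of λ where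
    (inj₁ h) → inj₁ h
    (inj₂ (inj₁ (w , w∉ , lt′ , p , q))) → inj₂ (inj₁ (w , ∉⇒U w∉ , lt′ , Adj-sym p , Adj-sym q))
    (inj₂ (inj₂ (w , w∈ , p , q))) → inj₂ (inj₂ (w , cong not ([]=⇒lookup w∈) , Adj-sym p , Adj-sym q))))

  first : ∀ u v → u ∈ˡ K → v ∉ C → v ∉ˡ K → u ≺ v
  first u v u∈ v∉ v∉K = K-first ordering K⊆U u v (∈⇒elemᵇ u∈) (∉⇒U v∉) (≢true λ k → v∉K (elemᵇ⇒∈ K k))

theorem2 : (G : Graph) → (P : PlaneGraph G) →
    (K : List (Fin (Graph.n G))) → length K ≤ 3 →
    (∀ v → v ∈ˡ K → PlaneGraph.OnOuterFace P v) →
    (C : Subset (Graph.n G)) →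
    (∀ v → v ∈ˡ K → v ∉ C) →
    (∀ v → v ∈ C → AtMost 4 (λ u → u ∉ C × Adj G v u)) →
    ∃[ _≺_ ] (StrictLinearOrderOn (λ v → v ∉ C) _≺_
    × TwoDegenerate G 7 C _≺_
    × (∀ u v → u ∈ˡ K → v ∉ C → v ∉ˡ K → u ≺ v))
theorem2 G P K K≤3 Kout C K∉C C≤4 = _≺_ G P K K≤3 Kout C K∉C C≤4 , linear G P K K≤3 Kout C K∉C C≤4 , degenerate G P K K≤3 Kout C K∉C C≤4 , first G P K K≤3 Kout C K∉C C≤4
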